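{- Let $a,b$ be integers with $2 \le a \le 2b$ and $2 \le b \le 2a$, let $R$ be the $(a,b)$-benzel, and let $c \in \{0,1,-1\}$ with $c \equiv a+b \pmod 3$ be its class. Then the (unrescaled) Conway–Lagarias invariant of $R$ is $$I(R) = \begin{cases} (-3a^2+6ab-3b^2+a+b)/2 & \text{if } c = 0,\\ (a^2-4ab+b^2+a+b-2)/2 & \text{if } c = 1,\\ (-3a^2+6ab-3b^2-a-b+2)/2 & \text{if } c = -1.\end{cases}$$
   Context: Identify the plane with $\mathbb{C}$ and let $\omega = e^{2\pi i/3}$. For $r \in \{0,1,-1\}$ let $L_r = \{x + y\omega : x,y \in \mathbb{Z},\ x+y \equiv r \pmod 3\}$. The hexagonal grid is the graph with vertex set $L_0 \cup L_1$ and an edge between two vertices at distance $1$. Each $\alpha \in L_{ -1}$ is the center of a unit hexagonal cell with corners $\alpha \pm 1, \alpha \pm \omega, \alpha \pm \omega^2$. For integers $a,b$ with $2 \le a \le 2b$ and $2 \le b \le 2a$, the $(a,b)$-benzel is the union of all unit cells lying entirely within the hexagon with vertices $a\omega+b$, $-a\omega^2-b$, $a\omega^2+b\omega$, $-a-b\omega$, $a+b\omega^2$, $-a\omega-b\omega^2$; its class is the residue of $a+b$ mod $3$ in $\{0,1,-1\}$. Conway–Lagarias invariant (Thurston's formulation). For a simply connected region $R$ that is a union of cells, let $\pi = (e_1,\dots,e_n)$ be the closed edge path traversing the boundary of $R$ once counterclockwise, starting and ending at a boundary vertex $p \in L_0$; indices are cyclic ($e_0 = e_n$, $e_{n+1}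 = e_1$). Say that a closed edge path $(e_1,\dots,e_n)$ weaves at step $i$ if $e_{i-1}$ and $e_{i+1}$ are parallel segments, and winds at step $i$ otherwise (i.e. $e_{i-1},e_i,e_{i+1}$ are consecutive edges of one hexagonal cell). A path $\pi' = (e'_1,\dots,e'_n)$ in the hexagonal grid starting at a vertex $p' \in L_0$ shadows $\pi$ if for every $1\le i\le n$, $\pi'$ weaves at step $i$ exactly when $\pi$ winds at step $i$. Such a $\pi'$ exists and is closed, and its signed area (the sum over all unit cells of the winding number of $\pi'$ around the cell) does not depend on the choices of $p$, $p'$ or $\pi'$; this signed area is $I(R)$. Equivalently, if $R$ is tiled by stones and bones, then $I(R) = 3(r - l)$, where $r$ is the number of right-pointing stones and $l$ the number of left-pointing stones; here a right-pointing stone is the union of the three cells centered at $v+1, v+\omega, v+\omega^2$ for some $v \in L_1$, a left-pointing stone is the union of the three cells centered at $v-1, v-\omega, v-\omega^2$ for some $v \in L_0$, and a bone is the union of three cells centered at $\alpha, \alpha+d, \alpha+2d$ with $\alpha \in L_{ -1}$ and $d \in \{\pm(1-\omega), \pm(\omega-\omega^2), \pm(\omega^2-1)\}$.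
   Formalization: Mirror-image shadows would give both I and -I, so a shadow is also required to have no immediate reversals and to turn at the end of its first edge the same way as the boundary path; signed area is computed by the shoelace formula in units of a cell. -}

module Defs where

open import Data.Nat as ℕ using (ℕ; zero; suc; _≡ᵇ_)
open import Data.Integer using (ℤ; +_; -_; _+_; _-_; _*_; _≤_)
open import Data.Integer.Divisibility using (_∣_)
open import Data.Product using (Σ; ∃; _×_; _,_)
open import Data.Sum using (_⊎_)
open import Data.Bool using (if_then_else_)
open import Relation.Binary.PropositionalEquality using (_≡_)

-- Points of the plane of the form x + y ω  (ω = e^{2πi/3}),
-- represented by their integer coordinates (x , y).

Pt : Set
Pt = ℤ × ℤ

_⊕_ : Pt → Pt → Pt
(x , y) ⊕ (x' , y') = (x + x' , y + y')

neg : Pt → Pt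
neg (x , y) = (- x , - y)

_⊖_ : Pt → Pt → Pt
p ⊖ q = p ⊕ neg q

-- complex multiplication, using ω² = -1 - ω
_⊗_ : Pt → Pt → Pt
(x , y) ⊗ (x' , y') = (x * x' - y * y' , (x * y' + x' * y) - y * y')

one ω ω² : Pt
one = (+ 1 , + 0)
ω   = (+ 0 , + 1)
ω²  = (- + 1 , - + 1)

L : ℤ → Pt → Set
L r (x , y) = (+ 3) ∣ ((x + y) - r)

IsUnit : Pt → Set
IsUnit d = d ≡ one ⊎ d ≡ neg one ⊎ d ≡ ω ⊎ d ≡ neg ω ⊎ d ≡ ω² ⊎ d ≡ neg ω²

Vertex : Pt → Set
Vertex p = L (+ 0) p ⊎ L (+ 1) p

GridEdge : Pt → Pt → Set
GridEdge u v = Vertex u × Vertex v × IsUnit (v ⊖ u)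

-- The (a,b)-benzel.
-- The hexagon with vertices aω+b, -aω²-b, aω²+bω, -a-bω, a+bω², -aω-bω²
-- has, in coordinates (x , y), the vertices
--   (b,a), (a-b,a), (-a,b-a), (-a,-b), (a-b,-b), (b,b-a),
-- and is the (closed) intersection of the six half-planes
--   -b ≤ y ≤ a ,  -a ≤ x ≤ b ,  -b ≤ x - y ≤ a .

InHexagon : ℤ → ℤ → Pt → Set
InHexagon a b (x , y) =
  (- b ≤ y × y ≤ a) × (- a ≤ x × x ≤ b) × (- b ≤ x - y × x - y ≤ a)

-- a unit cell (centre α ∈ L_{-1}, corners α ± 1, α ± ω, α ± ω²) lies
-- entirely within the (convex) hexagon iff its six corners do.
InBenzel : ℤ → ℤ → Pt → Set
InBenzel a b α =
  L (- + 1) α ×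
  InHexagon a b (α ⊕ one) × InHexagon a b (α ⊖ one) ×
  InHexagon a b (α ⊕ ω)   × InHexagon a b (α ⊖ ω)   ×
  InHexagon a b (α ⊕ ω²)  × InHexagon a b (α ⊖ ω²)

-- The two cells containing a directed grid edge u → v:
-- the one to its left has centre u + (-ω²)(v - u),
-- the one to its right has centre u + (-ω)(v - u).
leftCell rightCell : Pt → Pt → Pt
leftCell  u v = u ⊕ (neg ω² ⊗ (v ⊖ u))
rightCell u v = u ⊕ (neg ω  ⊗ (v ⊖ u))

BoundaryEdge : ℤ → ℤ → Pt → Pt → Set
BoundaryEdge a b u v =
  GridEdge u v × InBenzel a b (leftCell u v) × (InBenzel a b (rightCell u v) → ⊥′)
  where open import Data.Empty renaming (⊥ to ⊥′)

-- Edge paths.  A path with n edges is given by its vertices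
-- v 0, v 1, …, v n (values of v beyond n are irrelevant); its k-th edge
-- (k = 0, …, n-1) goes from v k to v (suc k).  Edges are indexed
-- cyclically modulo n: the edge before edge 0 is edge n-1, the edge after
-- edge n-1 is edge 0.  (Step j, 0 ≤ j < n, here corresponds to step j+1
-- of the paper, whose edges are e_1 … e_n.)

dir : (ℕ → Pt) → ℕ → Pt
dir v k = v (suc k) ⊖ v k

prevIdx : ℕ → ℕ → ℕ
prevIdx n zero    = ℕ.pred n
prevIdx n (suc j) = j

nextIdx : ℕ → ℕ → ℕ
nextIdx n j = if suc j ≡ᵇ n then 0 else suc j

Parallel : Pt → Pt → Set
Parallel d d' = d' ≡ d ⊎ d' ≡ neg d

Weaves : ℕ → (ℕ → Pt) → ℕ → Set
Weaves n v j = Parallel (dir v (prevIdx n j)) (dir v (nextIdx n j))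

Winds : ℕ → (ℕ → Pt) → ℕ → Set
Winds n v j = Weaves n v j → ⊥′
  where open import Data.Empty renaming (⊥ to ⊥′)

TurnsLeft : (ℕ → Pt) → ℕ → Set
TurnsLeft v k = dir v (suc k) ≡ (neg ω² ⊗ dir v k)

BoundaryPath : ℤ → ℤ → ℕ → (ℕ → Pt) → Set
BoundaryPath a b n v =
  (1 ℕ.≤ n) ×
  L (+ 0) (v 0) ×
  v n ≡ v 0 ×
  (∀ k → k ℕ.< n → BoundaryEdge a b (v k) (v (suc k))) ×
  (∀ k k' → k ℕ.< n → k' ℕ.< n →
     v k ≡ v k' → v (suc k) ≡ v (suc k') → k ≡ k') ×
  (∀ u u' → BoundaryEdge a b u u' →
     Σ ℕ λ k → k ℕ.< n × v k ≡ u × v (suc k) ≡ u')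

Shadows : ℕ → (ℕ → Pt) → (ℕ → Pt) → Set
Shadows n v w =
  L (+ 0) (w 0) ×
  (∀ k → k ℕ.< n → GridEdge (w k) (w (suc k))) ×
  (∀ j → j ℕ.< n → (Weaves n w j → Winds n v j) × (Winds n v j → Weaves n w j)) ×
  (∀ k → suc k ℕ.< n → dir w (suc k) ≡ neg (dir w k) → ⊥′) ×
  -- orientation convention: at the end of the first edge (a vertex of L₁)
  -- the shadow turns in the same direction as the boundary path
  (TurnsLeft w 0 → TurnsLeft v 0) × (TurnsLeft v 0 → TurnsLeft w 0)
  where open import Data.Empty renaming (⊥ to ⊥′)

-- Signed area.  For a closed polygon with vertices in the lattice, the
-- signed area (sum over unit cells of the winding number) equals the
-- Euclidean signed area divided by the area 3√3/2 of a unit cell.  In the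
-- coordinates (x , y) the shoelace formula gives Euclidean signed area
-- (√3/4) Σ det, hence
--     signed area (in cells) = (1/6) Σ_{k<n} det(w k , w (k+1)).
-- We work with six times the signed area, which is an integer.

det : Pt → Pt → ℤ
det (x , y) (x' , y') = x * y' - x' * y

sixTimesSignedArea : ℕ → (ℕ → Pt) → ℤ
sixTimesSignedArea zero    w = + 0
sixTimesSignedArea (suc n) w = sixTimesSignedArea n w + det (w n) (w (suc n))

data Cls : Set where
  c0 c1 c-1 : Cls

⟦_⟧ : Cls → ℤ
⟦ c0 ⟧  = + 0
⟦ c1 ⟧  = + 1
⟦ c-1 ⟧ = - + 1

-- the numerator N in I(R) = N / 2
numer : Cls → ℤ → ℤ → ℤ
numer c0  a b = (((- (+ 3 * a * a)) + + 6 * a * b) - + 3 * b * b) + a + b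
numer c1  a b = ((((a * a - + 4 * a * b) + b * b) + a) + b) - + 2
numer c-1 a b = (((((- (+ 3 * a * a)) + + 6 * a * b) - + 3 * b * b) - a) - b) + + 2

{-# OPTIONS --safe #-}

-- Following the boundary of the benzel with the region on the left, one turns right at a vertex
-- exactly when the cell ahead belongs to the region; hence a boundary path is determined by its first
-- edge, and any two differ by a cyclic shift.  Since weaving and winding mean that two successive turns
-- differ or agree, the shadow makes alternately the same turns as the path and the opposite ones; hence
-- it is unique up to a translation and a rotation by a power of ω, which do not affect the signed area.
-- It remains to compute one example.  The benzel is invariant under multiplication by ω, and a third of
-- its boundary is a word block₁ˢ corner₁ block₂ᵗ corner₂ in the turns left and right, where s and t are
-- determined by 2b - a and 2a - b and the blocks and corners depend only on the class.  The end point
-- and the area of a concatenation of paths multiply as in the Heisenberg group, so the area of the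
-- shadow is an explicit quadratic polynomial in s and t.  When s or t would be -1, the benzel equals
-- one of class 1 with smaller parameters.
module Submission where

open import Defs
open import Data.Bool using (Bool; true; false; if_then_else_; T; _∧_; _∨_; not)
open import Data.Bool.ListAction using (all; any)
open import Data.Bool.Properties using (T-∨)
open import Data.Empty using (⊥; ⊥-elim)
open import Data.Integer using (ℤ; +_; -[1+_]; _+_; _-_; -_; _*_; _≤_; _≤ᵇ_; +≤+; +<+)
open import Data.Integer.Divisibility using (_∣_)
open import Data.Integer.Divisibility.Signed using (divides; ∣ᵤ⇒∣; ∣⇒∣ᵤ) renaming (_∣_ to _∣ˢ_)
import Data.Integer.Properties as ℤ
open import Data.Integer.Tactic.RingSolver using (solve-∀)
open import Data.List using (List; []; _∷_; _++_; map; length)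
import Data.List.Properties as List
open import Data.List.Relation.Unary.All as All using (All; []; _∷_; all?)
import Data.List.Relation.Unary.All.Properties as All
open import Data.List.Relation.Unary.Any as Any using (Any; here; there)
import Data.List.Relation.Unary.Any.Properties as Any
open import Data.Maybe using (Maybe; just; nothing)
open import Data.Nat as ℕ using (ℕ; zero; suc; _≡ᵇ_)
import Data.Nat.Divisibility as ℕ
open import Data.Nat.GeneralisedArithmetic using (fold; fold-+)
import Data.Nat.Properties as ℕ
open import Data.Product using (Σ; ∃; _×_; _,_; proj₁; proj₂)
open import Data.Product.Properties using (≡-dec)
open import Data.Sum using (_⊎_; inj₁; inj₂)
open import Data.Unit using (⊤; tt)
open import Function.Bundles using (Equivalence)
open import Relation.Binary.Definitions using (DecidableEquality; tri<; tri≈; tri>)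
open import Relation.Binary.PropositionalEquality using (_≡_; _≢_; refl; sym; trans; cong; cong₂; subst; subst₂; module ≡-Reasoning)
open import Relation.Nullary using (¬_; contradiction; Dec; yes; no; does)
open import Relation.Nullary.Decidable using (map′; ⌊_⌋; toWitness; from-no)

-- Directions, turns and darts of the hexagonal grid

data Axis : Set where
  x0 x1 x2 : Axis

next prev : Axis → Axis
next x0 = x1
next x1 = x2
next x2 = x0
prev x0 = x2
prev x1 = x0
prev x2 = x1

-- fwd z is the direction ω^z, leading from L₀ to L₁; bwd z is -ω^z, leading from L₁ to L₀.
data Dir : Set where
  fwd bwd : Axis → Dir

axis : Dir → Axis
axis (fwd z) = z
axis (bwd z) = z

data Turn : Set where
  left right : Turn

flip : Turn → Turn
flip left = right
flip right = left

turn : Turn → Dir → Dir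
turn left  (fwd z) = bwd (prev z)
turn left  (bwd z) = fwd (prev z)
turn right (fwd z) = bwd (next z)
turn right (bwd z) = fwd (next z)

spin : Dir → Dir
spin (fwd z) = fwd (next z)
spin (bwd z) = bwd (next z)

power : Axis → Pt
power x0 = one
power x1 = ω
power x2 = ω²

unit : Dir → Pt
unit (fwd z) = power z
unit (bwd z) = neg (power z)

rot : Pt → Pt
rot (x , y) = (- y , x - y)

origin : Pt
origin = (+ 0 , + 0)

⊕-assoc : ∀ p q r → (p ⊕ q) ⊕ r ≡ p ⊕ (q ⊕ r)
⊕-assoc (x , y) (x' , y') (x'' , y'') = cong₂ _,_ (ℤ.+-assoc x x' x'') (ℤ.+-assoc y y' y'')

⊕-origin : ∀ p → p ⊕ origin ≡ p
⊕-origin (x , y) = cong₂ _,_ (ℤ.+-identityʳ x) (ℤ.+-identityʳ y)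

⊖-cancel : ∀ p q → (p ⊕ q) ⊖ p ≡ q
⊖-cancel (x , y) (x' , y') = cong₂ _,_ (h x x') (h y y')
  where
  h : ∀ x x' → (x + x') + - x ≡ x'
  h = solve-∀

⊕-cancel : ∀ p q → p ⊕ (q ⊖ p) ≡ q
⊕-cancel (x , y) (x' , y') = cong₂ _,_ (h x x') (h y y')
  where
  h : ∀ x x' → x + (x' + - x) ≡ x'
  h = solve-∀

rot-⊕ : ∀ p q → rot (p ⊕ q) ≡ rot p ⊕ rot q
rot-⊕ (x , y) (x' , y') = cong₂ _,_ (ℤ.neg-distrib-+ y y') (h x y x' y')
  where
  h : ∀ x y x' y' → (x + x') - (y + y') ≡ (x - y) + (x' - y')
  h = solve-∀

rot³ : ∀ p → rot (rot (rot p)) ≡ p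
rot³ (x , y) = cong₂ _,_ (h₁ x y) (h₂ x y)
  where
  h₁ : ∀ x y → - ((- y) - (x - y)) ≡ x
  h₁ = solve-∀
  h₂ : ∀ x y → (- (x - y)) - ((- y) - (x - y)) ≡ y
  h₂ = solve-∀

spin³ : ∀ d → spin (spin (spin d)) ≡ d
spin³ (fwd x0) = refl
spin³ (fwd x1) = refl
spin³ (fwd x2) = refl
spin³ (bwd x0) = refl
spin³ (bwd x1) = refl
spin³ (bwd x2) = refl

∀-Dir : {P : Dir → Set} → P (fwd x0) → P (fwd x1) → P (fwd x2) →
        P (bwd x0) → P (bwd x1) → P (bwd x2) → ∀ d → P d
∀-Dir a b c d e f (fwd x0) = a
∀-Dir a b c d e f (fwd x1) = b
∀-Dir a b c d e f (fwd x2) = c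
∀-Dir a b c d e f (bwd x0) = d
∀-Dir a b c d e f (bwd x1) = e
∀-Dir a b c d e f (bwd x2) = f

-- A dart (α , d) is the edge of direction d having the cell with centre α on its left.
Dart : Set
Dart = Pt × Dir

-- The displacements from α to the right-hand cell, to the cell faced by the
-- dart, and to the initial vertex.
aside ahead back : Dir → Pt
aside d = rot (rot (unit d)) ⊖ rot (unit d)
ahead d = unit d ⊖ rot (unit d)
back  d = rot (rot (unit d))

beside front tail head : Dart → Pt
beside (α , d) = α ⊕ aside d
front  (α , d) = α ⊕ ahead d
tail   (α , d) = α ⊕ back d
head   δ       = tail δ ⊕ unit (proj₂ δ)

move : Turn → Dart → Dart
move left  δ = (proj₁ δ , turn left (proj₂ δ))
move right δ = (front δ , turn right (proj₂ δ))

rotD : Dart → Dart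
rotD (α , d) = (rot α , spin d)

rotD³ : ∀ δ → rotD (rotD (rotD δ)) ≡ δ
rotD³ (α , d) = cong₂ _,_ (rot³ α) (spin³ d)

aside-left : ∀ d → aside (turn left d) ≡ ahead d
aside-left = ∀-Dir refl refl refl refl refl refl

aside-right : ∀ d → ahead d ⊕ aside (turn right d) ≡ aside d
aside-right = ∀-Dir refl refl refl refl refl refl

aside-left² : ∀ d → ahead (turn left (turn left d)) ⊕ aside d ≡ origin
aside-left² = ∀-Dir refl refl refl refl refl refl

back-left : ∀ d → back d ⊕ unit d ≡ back (turn left d)
back-left = ∀-Dir refl refl refl refl refl refl

back-right : ∀ d → back d ⊕ unit d ≡ ahead d ⊕ back (turn right d)
back-right = ∀-Dir refl refl refl refl refl refl

aside-spin : ∀ d → aside (spin d) ≡ rot (aside d)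
aside-spin = ∀-Dir refl refl refl refl refl refl

ahead-spin : ∀ d → ahead (spin d) ≡ rot (ahead d)
ahead-spin = ∀-Dir refl refl refl refl refl refl

unit-spin : ∀ d → unit (spin d) ≡ rot (unit d)
unit-spin = ∀-Dir refl refl refl refl refl refl

turn-spin : ∀ t d → turn t (spin d) ≡ spin (turn t d)
turn-spin left  = ∀-Dir refl refl refl refl refl refl
turn-spin right = ∀-Dir refl refl refl refl refl refl

turn-left-right : ∀ d → turn left (turn right d) ≡ d
turn-left-right = ∀-Dir refl refl refl refl refl refl

turn-right-left : ∀ d → turn right (turn left d) ≡ d
turn-right-left = ∀-Dir refl refl refl refl refl refl

turn-injective : ∀ t {d d'} → turn t d ≡ turn t d' → d ≡ d'
turn-injective left  {d} {d'} eq =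
  trans (sym (turn-right-left d)) (trans (cong (turn right) eq) (turn-right-left d'))
turn-injective right {d} {d'} eq =
  trans (sym (turn-left-right d)) (trans (cong (turn left) eq) (turn-left-right d'))

head-move : ∀ t δ → tail (move t δ) ≡ head δ
head-move left  (α , d) = sym (trans (⊕-assoc α (back d) (unit d)) (cong (α ⊕_) (back-left d)))
head-move right (α , d) = begin
  (α ⊕ ahead d) ⊕ back (turn right d) ≡⟨ ⊕-assoc α (ahead d) (back (turn right d)) ⟩
  α ⊕ (ahead d ⊕ back (turn right d)) ≡⟨ cong (α ⊕_) (back-right d) ⟨
  α ⊕ (back d ⊕ unit d)               ≡⟨ ⊕-assoc α (back d) (unit d) ⟨
  (α ⊕ back d) ⊕ unit d               ∎
  where open ≡-Reasoning

beside-left : ∀ δ → beside (move left δ) ≡ front δ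
beside-left (α , d) = cong (α ⊕_) (aside-left d)

beside-right : ∀ δ → beside (move right δ) ≡ beside δ
beside-right (α , d) = trans (⊕-assoc α (ahead d) (aside (turn right d))) (cong (α ⊕_) (aside-right d))

front-rotD : ∀ δ → front (rotD δ) ≡ rot (front δ)
front-rotD (α , d) = trans (cong (rot α ⊕_) (ahead-spin d)) (sym (rot-⊕ α (ahead d)))

beside-rotD : ∀ δ → beside (rotD δ) ≡ rot (beside δ)
beside-rotD (α , d) = trans (cong (rot α ⊕_) (aside-spin d)) (sym (rot-⊕ α (aside d)))

move-rotD : ∀ t δ → move t (rotD δ) ≡ rotD (move t δ)
move-rotD left  (α , d) = cong (rot α ,_) (turn-spin left d)
move-rotD right (α , d) = cong₂ _,_ (front-rotD (α , d)) (turn-spin right d)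

L-elim : ∀ r p → L r p → ∃ λ k → proj₁ p + proj₂ p ≡ r + + 3 * k
L-elim r (x , y) l with ∣ᵤ⇒∣ {+ 3} {(x + y) - r} l
... | divides k e = k , trans (h x y r) (cong (_+_ r) (trans e (ℤ.*-comm k (+ 3))))
  where
  h : ∀ x y r → x + y ≡ r + ((x + y) - r)
  h = solve-∀

L-intro : ∀ r p k → proj₁ p + proj₂ p ≡ r + + 3 * k → L r p
L-intro r (x , y) k e = ∣⇒∣ᵤ {+ 3} {(x + y) - r} (divides k (trans (cong (_- r) e) (h r k)))
  where
  h : ∀ r k → (r + + 3 * k) - r ≡ k * + 3
  h = solve-∀

L-translate : ∀ r r' j p q → r + (proj₁ q + proj₂ q) ≡ r' + + 3 * j → L r p → L r' (p ⊕ q)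
L-translate r r' j p@(x , y) q@(x' , y') eq l with L-elim r p l
... | k , e = L-intro r' (p ⊕ q) (j + k) (begin
  (x + x') + (y + y')            ≡⟨ h₁ x x' y y' ⟩
  (x + y) + (x' + y')            ≡⟨ cong (_+ (x' + y')) e ⟩
  (r + + 3 * k) + (x' + y')      ≡⟨ h₂ r k (x' + y') ⟩
  (r + (x' + y')) + + 3 * k      ≡⟨ cong (_+ + 3 * k) eq ⟩
  (r' + + 3 * j) + + 3 * k       ≡⟨ h₃ r' j k ⟩
  r' + + 3 * (j + k)             ∎)
  where
  open ≡-Reasoning
  h₁ : ∀ x x' y y' → (x + x') + (y + y') ≡ (x + y) + (x' + y')
  h₁ = solve-∀
  h₂ : ∀ r k z → (r + + 3 * k) + z ≡ (r + z) + + 3 * k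
  h₂ = solve-∀
  h₃ : ∀ r j k → (r + + 3 * j) + + 3 * k ≡ r + + 3 * (j + k)
  h₃ = solve-∀

L-rot : ∀ p → L (- + 1) p → L (- + 1) (rot p)
L-rot p@(x , y) l with L-elim (- + 1) p l
... | k , e = L-intro (- + 1) (rot p) (k - y) (trans (h₁ x y) (trans (cong (_- + 3 * y) e) (h₂ k y)))
  where
  h₁ : ∀ x y → (- y) + (x - y) ≡ (x + y) - + 3 * y
  h₁ = solve-∀
  h₂ : ∀ k y → (- + 1 + + 3 * k) - + 3 * y ≡ - + 1 + + 3 * (k - y)
  h₂ = solve-∀

L-ahead : ∀ d p → L (- + 1) p → L (- + 1) (p ⊕ ahead d)
L-ahead (fwd x0) p = L-translate (- + 1) (- + 1) (+ 0) p (ahead (fwd x0)) refl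
L-ahead (fwd x1) p = L-translate (- + 1) (- + 1) (+ 1) p (ahead (fwd x1)) refl
L-ahead (fwd x2) p = L-translate (- + 1) (- + 1) (- + 1) p (ahead (fwd x2)) refl
L-ahead (bwd x0) p = L-translate (- + 1) (- + 1) (+ 0) p (ahead (bwd x0)) refl
L-ahead (bwd x1) p = L-translate (- + 1) (- + 1) (- + 1) p (ahead (bwd x1)) refl
L-ahead (bwd x2) p = L-translate (- + 1) (- + 1) (+ 1) p (ahead (bwd x2)) refl

residue : Dir → ℤ
residue (fwd _) = + 0
residue (bwd _) = + 1

L-back : ∀ d p → L (- + 1) p → L (residue d) (p ⊕ back d)
L-back (fwd x0) p = L-translate (- + 1) (+ 0) (- + 1) p (back (fwd x0)) refl
L-back (fwd x1) p = L-translate (- + 1) (+ 0) (+ 0) p (back (fwd x1)) refl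
L-back (fwd x2) p = L-translate (- + 1) (+ 0) (+ 0) p (back (fwd x2)) refl
L-back (bwd x0) p = L-translate (- + 1) (+ 1) (+ 0) p (back (bwd x0)) refl
L-back (bwd x1) p = L-translate (- + 1) (+ 1) (- + 1) p (back (bwd x1)) refl
L-back (bwd x2) p = L-translate (- + 1) (+ 1) (- + 1) p (back (bwd x2)) refl

-- Following the boundary of a region

opp : Dir → Dir
opp (fwd z) = bwd z
opp (bwd z) = fwd z

dirOf : Pt → Dir
dirOf (+ 1      , + 0)      = fwd x0
dirOf (+ 0      , + 1)      = fwd x1
dirOf (-[1+ 0 ] , -[1+ 0 ]) = fwd x2
dirOf (-[1+ 0 ] , + 0)      = bwd x0
dirOf (+ 0      , -[1+ 0 ]) = bwd x1
dirOf _                     = bwd x2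

dirOf-unit : ∀ d → dirOf (unit d) ≡ d
dirOf-unit = ∀-Dir refl refl refl refl refl refl

unit-injective : ∀ {d d'} → unit d ≡ unit d' → d ≡ d'
unit-injective {d} {d'} eq = trans (sym (dirOf-unit d)) (trans (cong dirOf eq) (dirOf-unit d'))

unit-opp : ∀ d → unit (opp d) ≡ neg (unit d)
unit-opp = ∀-Dir refl refl refl refl refl refl

isUnit : ∀ d → IsUnit (unit d)
isUnit = ∀-Dir (inj₁ refl) (inj₂ (inj₂ (inj₁ refl))) (inj₂ (inj₂ (inj₂ (inj₂ (inj₁ refl)))))
  (inj₂ (inj₁ refl)) (inj₂ (inj₂ (inj₂ (inj₁ refl)))) (inj₂ (inj₂ (inj₂ (inj₂ (inj₂ refl)))))

isUnit⁻¹ : ∀ {p} → IsUnit p → ∃ λ d → p ≡ unit d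
isUnit⁻¹ (inj₁ e) = fwd x0 , e
isUnit⁻¹ (inj₂ (inj₁ e)) = bwd x0 , e
isUnit⁻¹ (inj₂ (inj₂ (inj₁ e))) = fwd x1 , e
isUnit⁻¹ (inj₂ (inj₂ (inj₂ (inj₁ e)))) = bwd x1 , e
isUnit⁻¹ (inj₂ (inj₂ (inj₂ (inj₂ (inj₁ e))))) = fwd x2 , e
isUnit⁻¹ (inj₂ (inj₂ (inj₂ (inj₂ (inj₂ e))))) = bwd x2 , e

axis-opp : ∀ d → axis (opp d) ≡ axis d
axis-opp (fwd z) = refl
axis-opp (bwd z) = refl

parallel⇒axis : ∀ d d' → Parallel (unit d) (unit d') → axis d ≡ axis d'
parallel⇒axis d d' (inj₁ e) = cong axis (sym (unit-injective {d'} {d} e))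
parallel⇒axis d d' (inj₂ e) =
  sym (trans (cong axis (unit-injective {d'} {opp d} (trans e (sym (unit-opp d))))) (axis-opp d))

axis⇒parallel : ∀ d d' → axis d ≡ axis d' → Parallel (unit d) (unit d')
axis⇒parallel (fwd z) (fwd .z) refl = inj₁ refl
axis⇒parallel (fwd z) (bwd .z) refl = inj₂ refl
axis⇒parallel (bwd z) (fwd .z) refl = inj₂ (unit-opp (bwd z))
axis⇒parallel (bwd z) (bwd .z) refl = inj₁ refl

axis-trichotomy : ∀ z z' → z' ≡ prev z ⊎ z' ≡ next z ⊎ z' ≡ z
axis-trichotomy x0 x0 = inj₂ (inj₂ refl)
axis-trichotomy x0 x1 = inj₂ (inj₁ refl)
axis-trichotomy x0 x2 = inj₁ refl
axis-trichotomy x1 x0 = inj₁ refl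
axis-trichotomy x1 x1 = inj₂ (inj₂ refl)
axis-trichotomy x1 x2 = inj₂ (inj₁ refl)
axis-trichotomy x2 x0 = inj₂ (inj₁ refl)
axis-trichotomy x2 x1 = inj₁ refl
axis-trichotomy x2 x2 = inj₂ (inj₂ refl)

turn-or-back : ∀ d d' → residue d' ≡ residue (opp d) → (∃ λ t → d' ≡ turn t d) ⊎ d' ≡ opp d
turn-or-back (fwd z) (bwd z') _ with axis-trichotomy z z'
... | inj₁ e        = inj₁ (left , cong bwd e)
... | inj₂ (inj₁ e) = inj₁ (right , cong bwd e)
... | inj₂ (inj₂ e) = inj₂ (cong bwd e)
turn-or-back (bwd z) (fwd z') _ with axis-trichotomy z z'
... | inj₁ e        = inj₁ (left , cong fwd e)
... | inj₂ (inj₁ e) = inj₁ (right , cong fwd e)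
... | inj₂ (inj₂ e) = inj₂ (cong fwd e)
turn-or-back (fwd z) (fwd z') ()
turn-or-back (bwd z) (bwd z') ()

residue-turn : ∀ t d → residue (turn t d) ≡ residue (opp d)
residue-turn left  (fwd z) = refl
residue-turn left  (bwd z) = refl
residue-turn right (fwd z) = refl
residue-turn right (bwd z) = refl

next-prev : ∀ z → next (prev z) ≡ z
next-prev x0 = refl
next-prev x1 = refl
next-prev x2 = refl

prev-next : ∀ z → prev (next z) ≡ z
prev-next x0 = refl
prev-next x1 = refl
prev-next x2 = refl

next-distinct : ∀ z → next z ≢ z
next-distinct x0 ()
next-distinct x1 ()
next-distinct x2 ()

prev-distinct : ∀ z → prev z ≢ z
prev-distinct x0 ()
prev-distinct x1 ()
prev-distinct x2 ()

next²-distinct : ∀ z → next (next z) ≢ z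
next²-distinct x0 ()
next²-distinct x1 ()
next²-distinct x2 ()

prev²-distinct : ∀ z → prev (prev z) ≢ z
prev²-distinct x0 ()
prev²-distinct x1 ()
prev²-distinct x2 ()

-- The shadow makes the same turns as the boundary path at vertices in L₁, and the opposite turns
-- at vertices in L₀.
swerve : Turn → Dir → Dir
swerve t e@(fwd _) = turn t e
swerve t e@(bwd _) = turn (flip t) e

flip² : ∀ t → flip (flip t) ≡ t
flip² left  = refl
flip² right = refl

residue-swerve : ∀ t d → residue (swerve t d) ≡ residue (opp d)
residue-swerve t (fwd z) = residue-turn t (fwd z)
residue-swerve t (bwd z) = residue-turn (flip t) (bwd z)

turn-as-swerve : ∀ t d → ∃ λ t' → turn t d ≡ swerve t' d
turn-as-swerve t (fwd z) = t , refl
turn-as-swerve t (bwd z) = flip t , cong (λ t → turn t (bwd z)) (sym (flip² t))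

axis-turn² : ∀ t d → axis (turn (flip t) (turn t d)) ≡ axis d
axis-turn² left  (fwd z) = next-prev z
axis-turn² left  (bwd z) = next-prev z
axis-turn² right (fwd z) = prev-next z
axis-turn² right (bwd z) = prev-next z

axis-turn²⁻¹ : ∀ t t' d → axis (turn t' (turn t d)) ≡ axis d → t' ≡ flip t
axis-turn²⁻¹ left  left  (fwd z) e = contradiction e (prev²-distinct z)
axis-turn²⁻¹ left  left  (bwd z) e = contradiction e (prev²-distinct z)
axis-turn²⁻¹ left  right d e = refl
axis-turn²⁻¹ right left  d e = refl
axis-turn²⁻¹ right right (fwd z) e = contradiction e (next²-distinct z)
axis-turn²⁻¹ right right (bwd z) e = contradiction e (next²-distinct z)

axis-swerve² : ∀ t d → axis (swerve t (swerve t d)) ≡ axis d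
axis-swerve² left  (fwd z) = axis-turn² left (fwd z)
axis-swerve² right (fwd z) = axis-turn² right (fwd z)
axis-swerve² left  (bwd z) = axis-turn² right (bwd z)
axis-swerve² right (bwd z) = axis-turn² left (bwd z)

axis-swerve²⁻¹ : ∀ t t' d → axis (swerve t' (swerve t d)) ≡ axis d → t' ≡ t
axis-swerve²⁻¹ left  left  d e = refl
axis-swerve²⁻¹ right right d e = refl
axis-swerve²⁻¹ left  right (fwd z) e = contradiction e (prev²-distinct z)
axis-swerve²⁻¹ left  right (bwd z) e = contradiction e (next²-distinct z)
axis-swerve²⁻¹ right left  (fwd z) e = contradiction e (next²-distinct z)
axis-swerve²⁻¹ right left  (bwd z) e = contradiction e (prev²-distinct z)

axis-turn-distinct : ∀ t d → axis (turn t d) ≢ axis d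
axis-turn-distinct left  (fwd z) = prev-distinct z
axis-turn-distinct left  (bwd z) = prev-distinct z
axis-turn-distinct right (fwd z) = next-distinct z
axis-turn-distinct right (bwd z) = next-distinct z

axis-swerve-distinct : ∀ t d → axis (swerve t d) ≢ axis d
axis-swerve-distinct t (fwd z) = axis-turn-distinct t (fwd z)
axis-swerve-distinct t (bwd z) = axis-turn-distinct (flip t) (bwd z)

unit-left : ∀ d → neg ω² ⊗ unit d ≡ unit (turn left d)
unit-left = ∀-Dir refl refl refl refl refl refl

turnsLeft⇒left : ∀ t d → unit (turn t d) ≡ neg ω² ⊗ unit d → t ≡ left
turnsLeft⇒left left  d e = refl
turnsLeft⇒left right d e =
  contradiction (unit-injective {turn right d} {turn left d} (trans e (unit-left d))) (h d)
  where
  h : ∀ d → turn right d ≢ turn left d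
  h = ∀-Dir (λ ()) (λ ()) (λ ()) (λ ()) (λ ()) (λ ())

L-unique : ∀ r r' p → L r p → L r' p → (+ 3) ∣ˢ (r - r')
L-unique r r' p@(x , y) l l' with L-elim r p l | L-elim r' p l'
... | k , e | k' , e' = divides (k' - k) (begin
  r - r'                                          ≡⟨ h₁ r r' k k' ⟩
  ((r + + 3 * k) - (r' + + 3 * k')) + (k' - k) * + 3 ≡⟨ cong₂ (λ a b → (a - b) + (k' - k) * + 3) e e' ⟨
  ((x + y) - (x + y)) + (k' - k) * + 3            ≡⟨ h₂ (x + y) ((k' - k) * + 3) ⟩
  (k' - k) * + 3                                  ∎)
  where
  open ≡-Reasoning
  h₁ : ∀ r r' k k' → r - r' ≡ ((r + + 3 * k) - (r' + + 3 * k')) + (k' - k) * + 3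
  h₁ = solve-∀
  h₂ : ∀ z q → (z - z) + q ≡ q
  h₂ = solve-∀

L0∩L1 : ∀ p → L (+ 0) p → L (+ 1) p → ⊥
L0∩L1 p l l' = from-no (3 ℕ.∣? 1) (∣⇒∣ᵤ (L-unique (+ 0) (+ 1) p l l'))

L0∩L-1 : ∀ p → L (+ 0) p → L (- + 1) p → ⊥
L0∩L-1 p l l' = from-no (3 ℕ.∣? 1) (∣⇒∣ᵤ (L-unique (+ 0) (- + 1) p l l'))

L1∩L-1 : ∀ p → L (+ 1) p → L (- + 1) p → ⊥
L1∩L-1 p l l' = from-no (3 ℕ.∣? 2) (∣⇒∣ᵤ (L-unique (+ 1) (- + 1) p l l'))

residue-unique : ∀ d d' p → L (residue d) p → L (residue d') p → residue d ≡ residue d'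
residue-unique (fwd _) (fwd _) p l l' = refl
residue-unique (fwd _) (bwd _) p l l' = ⊥-elim (L0∩L1 p l l')
residue-unique (bwd _) (fwd _) p l l' = ⊥-elim (L0∩L1 p l' l)
residue-unique (bwd _) (bwd _) p l l' = refl

residue⇒vertex : ∀ d {p} → L (residue d) p → Vertex p
residue⇒vertex (fwd _) l = inj₁ l
residue⇒vertex (bwd _) l = inj₂ l

L-unit : ∀ d p → L (residue d) p → L (residue (opp d)) (p ⊕ unit d)
L-unit (fwd x0) p = L-translate (+ 0) (+ 1) (+ 0) p one refl
L-unit (fwd x1) p = L-translate (+ 0) (+ 1) (+ 0) p ω refl
L-unit (fwd x2) p = L-translate (+ 0) (+ 1) (- + 1) p ω² refl
L-unit (bwd x0) p = L-translate (+ 1) (+ 0) (+ 0) p (neg one) refl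
L-unit (bwd x1) p = L-translate (+ 1) (+ 0) (+ 0) p (neg ω) refl
L-unit (bwd x2) p = L-translate (+ 1) (+ 0) (+ 1) p (neg ω²) refl

-- An edge in the wrong direction for its initial vertex leads to a cell centre.
L-unit-opp : ∀ d p → L (residue (opp d)) p → L (- + 1) (p ⊕ unit d)
L-unit-opp (fwd x0) p = L-translate (+ 1) (- + 1) (+ 1) p one refl
L-unit-opp (fwd x1) p = L-translate (+ 1) (- + 1) (+ 1) p ω refl
L-unit-opp (fwd x2) p = L-translate (+ 1) (- + 1) (+ 0) p ω² refl
L-unit-opp (bwd x0) p = L-translate (+ 0) (- + 1) (+ 0) p (neg one) refl
L-unit-opp (bwd x1) p = L-translate (+ 0) (- + 1) (+ 0) p (neg ω) refl
L-unit-opp (bwd x2) p = L-translate (+ 0) (- + 1) (+ 1) p (neg ω²) refl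

residue-forced : ∀ d d' p → L (residue d) p → Vertex (p ⊕ unit d') → residue d' ≡ residue d
residue-forced (fwd _) (fwd _) p l v = refl
residue-forced (bwd _) (bwd _) p l v = refl
residue-forced (fwd _) d'@(bwd _) p l (inj₁ v) = ⊥-elim (L0∩L-1 (p ⊕ unit d') v (L-unit-opp d' p l))
residue-forced (fwd _) d'@(bwd _) p l (inj₂ v) = ⊥-elim (L1∩L-1 (p ⊕ unit d') v (L-unit-opp d' p l))
residue-forced (bwd _) d'@(fwd _) p l (inj₁ v) = ⊥-elim (L0∩L-1 (p ⊕ unit d') v (L-unit-opp d' p l))
residue-forced (bwd _) d'@(fwd _) p l (inj₂ v) = ⊥-elim (L1∩L-1 (p ⊕ unit d') v (L-unit-opp d' p l))

⊕-cancelʳ : ∀ {p q} r → p ⊕ r ≡ q ⊕ r → p ≡ q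
⊕-cancelʳ {p} {q} r e = trans (sym (h p r)) (trans (cong (_⊖ r) e) (h q r))
  where
  h' : ∀ x x' → (x + x') + - x' ≡ x
  h' = solve-∀
  h : ∀ p r → (p ⊕ r) ⊖ r ≡ p
  h (x , y) (x' , y') = cong₂ _,_ (h' x x') (h' y y')

back-opp : ∀ d → aside d ⊕ back (opp d) ≡ back d ⊕ unit d
back-opp = ∀-Dir refl refl refl refl refl refl

L-beside : ∀ δ → L (- + 1) (proj₁ δ) → L (- + 1) (beside δ)
L-beside (α , d) l = subst (λ p → L (- + 1) (α ⊕ p))
  (trans (sym (aside-left (turn right d))) (cong aside (turn-left-right d)))
  (L-ahead (turn right d) α l)

module Walk (In : Pt → Set) (In? : (α : Pt) → Dec (In α)) (In-rot : (α : Pt) → In α → In (rot α)) where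

  turnAt : Dart → Turn
  turnAt δ = if does (In? (front δ)) then right else left

  turnAt-right : ∀ δ → In (front δ) → turnAt δ ≡ right
  turnAt-right δ i with In? (front δ)
  ... | yes _ = refl
  ... | no ¬i = contradiction i ¬i

  turnAt-left : ∀ δ → ¬ In (front δ) → turnAt δ ≡ left
  turnAt-left δ ¬i with In? (front δ)
  ... | yes i = contradiction i ¬i
  ... | no _  = refl

  step : Dart → Dart
  step δ = move (turnAt δ) δ

  walk : ℕ → Dart → Dart
  walk k δ = fold δ step k

  walk-+ : ∀ m n δ → walk (m ℕ.+ n) δ ≡ walk m (walk n δ)
  walk-+ m n δ = fold-+ δ step m

  walk-comm : ∀ m n δ → walk m (walk n δ) ≡ walk n (walk m δ)
  walk-comm m n δ = trans (sym (walk-+ m n δ)) (trans (cong (λ k → walk k δ) (ℕ.+-comm m n)) (walk-+ n m δ))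

  record Boundary (δ : Dart) : Set where
    constructor boundary
    field
      centre  : L (- + 1) (proj₁ δ)
      inside  : In (proj₁ δ)
      outside : ¬ In (beside δ)
  open Boundary public

  step-boundary : ∀ δ → Boundary δ → Boundary (step δ)
  step-boundary δ@(α , d) (boundary c i o) with In? (front δ)
  ... | yes i' = boundary (L-ahead d α c) i' (λ j → o (subst In (beside-right δ) j))
  ... | no ¬i  = boundary c i (λ j → ¬i (subst In (beside-left δ) j))

  walk-boundary : ∀ k δ → Boundary δ → Boundary (walk k δ)
  walk-boundary zero    δ b = b
  walk-boundary (suc k) δ b = step-boundary (walk k δ) (walk-boundary k δ b)

  In-rot⁻¹ : ∀ α → In (rot α) → In α
  In-rot⁻¹ α i = subst In (rot³ α) (In-rot _ (In-rot _ i))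

  turnAt-rotD : ∀ δ → turnAt (rotD δ) ≡ turnAt δ
  turnAt-rotD δ with In? (front δ)
  ... | yes i = turnAt-right (rotD δ) (subst In (sym (front-rotD δ)) (In-rot _ i))
  ... | no ¬i = turnAt-left (rotD δ) (λ j → ¬i (In-rot⁻¹ _ (subst In (front-rotD δ) j)))

  step-rotD : ∀ δ → step (rotD δ) ≡ rotD (step δ)
  step-rotD δ = trans (cong (λ t → move t (rotD δ)) (turnAt-rotD δ)) (move-rotD (turnAt δ) δ)

  walk-rotD : ∀ k δ → walk k (rotD δ) ≡ rotD (walk k δ)
  walk-rotD zero    δ = refl
  walk-rotD (suc k) δ = trans (cong step (walk-rotD k δ)) (step-rotD (walk k δ))

  rotD-boundary : ∀ δ → Boundary δ → Boundary (rotD δ)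
  rotD-boundary δ (boundary c i o) =
    boundary (L-rot (proj₁ δ) c) (In-rot _ i) (λ j → o (In-rot⁻¹ _ (subst In (beside-rotD δ) j)))

  right-left-absurd : ∀ δ δ' → In (proj₁ δ) → ¬ In (beside δ') → move right δ ≢ move left δ'
  right-left-absurd δ@(α , d) (α' , d') i o e = o (subst In (sym eq) i)
    where
    d≡ : d ≡ turn left (turn left d')
    d≡ = trans (sym (turn-left-right d)) (cong (turn left) (cong proj₂ e))
    eq : α' ⊕ aside d' ≡ α
    eq = begin
      α' ⊕ aside d'               ≡⟨ cong (λ p → proj₁ p ⊕ aside d') e ⟨
      (α ⊕ ahead d) ⊕ aside d'    ≡⟨ ⊕-assoc α (ahead d) (aside d') ⟩
      α ⊕ (ahead d ⊕ aside d')    ≡⟨ cong (λ d → α ⊕ (ahead d ⊕ aside d')) d≡ ⟩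
      α ⊕ (ahead (turn left (turn left d')) ⊕ aside d') ≡⟨ cong (α ⊕_) (aside-left² d') ⟩
      α ⊕ origin                  ≡⟨ ⊕-origin α ⟩
      α                           ∎
      where open ≡-Reasoning

  move-injective : ∀ t δ δ' → move t δ ≡ move t δ' → δ ≡ δ'
  move-injective left  (α , d) (α' , d') e =
    cong₂ _,_ (cong proj₁ e) (turn-injective left (cong proj₂ e))
  move-injective right (α , d) (α' , d') e with turn-injective right {d} {d'} (cong proj₂ e)
  ... | refl = cong (_, d) (⊕-cancelʳ (ahead d) (cong proj₁ e))

  step-injective : ∀ δ δ' → Boundary δ → Boundary δ' → step δ ≡ step δ' → δ ≡ δ'
  step-injective δ δ' b b' e with turnAt δ | turnAt δ'
  ... | left  | left  = move-injective left δ δ' e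
  ... | right | right = move-injective right δ δ' e
  ... | right | left  = contradiction e (right-left-absurd δ δ' (inside b) (outside b'))
  ... | left  | right = contradiction (sym e) (right-left-absurd δ' δ (inside b') (outside b))

  walk-injective : ∀ k δ δ' → Boundary δ → Boundary δ' → walk k δ ≡ walk k δ' → δ ≡ δ'
  walk-injective zero    δ δ' b b' e = e
  walk-injective (suc k) δ δ' b b' e = walk-injective k δ δ' b b'
    (step-injective (walk k δ) (walk k δ') (walk-boundary k δ b) (walk-boundary k δ' b') e)

  step-unique : ∀ δ δ' → Boundary δ → Boundary δ' → head δ ≡ tail δ' → δ' ≡ step δ
  step-unique δ@(α , d) δ'@(α' , d') b b' e with turn-or-back d d' parity
    where
    parity : residue d' ≡ residue (opp d)
    parity = trans (residue-unique d' (turn left d) (tail δ') (L-back d' α' (centre b'))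
        (subst (L (residue (turn left d))) (trans (head-move left δ) e)
          (L-back (turn left d) α (centre b))))
      (residue-turn left d)
  ... | inj₁ (left , refl) =
    trans eq (cong (λ t → move t δ) (sym (turnAt-left δ λ i →
      outside b' (subst In (sym (trans (cong beside eq) (beside-left δ))) i))))
    where
    eq : δ' ≡ move left δ
    eq = cong (_, d') (⊕-cancelʳ (back d') (trans (sym e) (sym (head-move left δ))))
  ... | inj₁ (right , refl) =
    trans eq (cong (λ t → move t δ) (sym (turnAt-right δ (subst In (cong proj₁ eq) (inside b')))))
    where
    eq : δ' ≡ move right δ
    eq = cong (_, d') (⊕-cancelʳ (back d') (trans (sym e) (sym (head-move right δ))))
  ... | inj₂ refl = contradiction (subst In eq (inside b')) (outside b)
    where
    eq : α' ≡ beside δ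
    eq = ⊕-cancelʳ (back (opp d)) (begin
      α' ⊕ back (opp d)             ≡⟨ e ⟨
      (α ⊕ back d) ⊕ unit d         ≡⟨ ⊕-assoc α (back d) (unit d) ⟩
      α ⊕ (back d ⊕ unit d)         ≡⟨ cong (α ⊕_) (back-opp d) ⟨
      α ⊕ (aside d ⊕ back (opp d))  ≡⟨ ⊕-assoc α (aside d) (back (opp d)) ⟨
      (α ⊕ aside d) ⊕ back (opp d)  ∎)
      where open ≡-Reasoning

  Spells : Dart → List Turn → Set
  Spells δ []       = ⊤
  Spells δ (t ∷ ts) = turnAt δ ≡ t × Spells (step δ) ts

  spells-++ : ∀ ts us δ → Spells δ ts → Spells (walk (length ts) δ) us → Spells δ (ts ++ us)
  spells-++ []       us δ _       g = g
  spells-++ (t ∷ ts) us δ (e , f) g =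
    e , spells-++ ts us (step δ) f (subst (λ ε → Spells ε us) (walk-comm 1 (length ts) δ) g)

  spells-rotD : ∀ ts δ → Spells δ ts → Spells (rotD δ) ts
  spells-rotD []       δ _       = tt
  spells-rotD (t ∷ ts) δ (e , f) = trans (turnAt-rotD δ) e ,
    subst (λ ε → Spells ε ts) (sym (step-rotD δ)) (spells-rotD ts (step δ) f)

-- Boundary paths and their shadows

left-back : ∀ d → (neg ω² ⊗ unit d) ⊕ back d ≡ origin
left-back = ∀-Dir refl refl refl refl refl refl

back-left-cell : ∀ d → back d ⊕ (neg ω² ⊗ unit d) ≡ origin
back-left-cell = ∀-Dir refl refl refl refl refl refl

left-aside : ∀ d → (neg ω² ⊗ unit d) ⊕ aside d ≡ neg ω ⊗ unit d
left-aside = ∀-Dir refl refl refl refl refl refl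

back-right-cell : ∀ d → back d ⊕ (neg ω ⊗ unit d) ≡ aside d
back-right-cell = ∀-Dir refl refl refl refl refl refl

leftCell-dart : ∀ δ → leftCell (tail δ) (head δ) ≡ proj₁ δ
leftCell-dart δ@(α , d) = begin
  tail δ ⊕ (neg ω² ⊗ (head δ ⊖ tail δ)) ≡⟨ cong (λ q → tail δ ⊕ (neg ω² ⊗ q)) (⊖-cancel (tail δ) (unit d)) ⟩
  (α ⊕ back d) ⊕ (neg ω² ⊗ unit d)      ≡⟨ ⊕-assoc α (back d) (neg ω² ⊗ unit d) ⟩
  α ⊕ (back d ⊕ (neg ω² ⊗ unit d))      ≡⟨ cong (α ⊕_) (back-left-cell d) ⟩
  α ⊕ origin                            ≡⟨ ⊕-origin α ⟩
  α                                     ∎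
  where open ≡-Reasoning

rightCell-dart : ∀ δ → rightCell (tail δ) (head δ) ≡ beside δ
rightCell-dart δ@(α , d) = begin
  tail δ ⊕ (neg ω ⊗ (head δ ⊖ tail δ)) ≡⟨ cong (λ q → tail δ ⊕ (neg ω ⊗ q)) (⊖-cancel (tail δ) (unit d)) ⟩
  (α ⊕ back d) ⊕ (neg ω ⊗ unit d)      ≡⟨ ⊕-assoc α (back d) (neg ω ⊗ unit d) ⟩
  α ⊕ (back d ⊕ (neg ω ⊗ unit d))      ≡⟨ cong (α ⊕_) (back-right-cell d) ⟩
  α ⊕ aside d                          ∎
  where open ≡-Reasoning

dartOf : Pt → Pt → Dir → Dart
dartOf u u' d = (leftCell u u' , d)

tail-dartOf : ∀ u u' d → u' ⊖ u ≡ unit d → tail (dartOf u u' d) ≡ u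
tail-dartOf u u' d e = begin
  (u ⊕ (neg ω² ⊗ (u' ⊖ u))) ⊕ back d ≡⟨ cong (λ q → (u ⊕ (neg ω² ⊗ q)) ⊕ back d) e ⟩
  (u ⊕ (neg ω² ⊗ unit d)) ⊕ back d   ≡⟨ ⊕-assoc u (neg ω² ⊗ unit d) (back d) ⟩
  u ⊕ ((neg ω² ⊗ unit d) ⊕ back d)   ≡⟨ cong (u ⊕_) (left-back d) ⟩
  u ⊕ origin                         ≡⟨ ⊕-origin u ⟩
  u                                  ∎
  where open ≡-Reasoning

head-dartOf : ∀ u u' d → u' ⊖ u ≡ unit d → head (dartOf u u' d) ≡ u'
head-dartOf u u' d e = begin
  tail (dartOf u u' d) ⊕ unit d ≡⟨ cong₂ _⊕_ (tail-dartOf u u' d e) (sym e) ⟩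
  u ⊕ (u' ⊖ u)                  ≡⟨ ⊕-cancel u u' ⟩
  u'                            ∎
  where open ≡-Reasoning

beside-dartOf : ∀ u u' d → u' ⊖ u ≡ unit d → beside (dartOf u u' d) ≡ rightCell u u'
beside-dartOf u u' d e = begin
  (u ⊕ (neg ω² ⊗ (u' ⊖ u))) ⊕ aside d ≡⟨ cong (λ q → (u ⊕ (neg ω² ⊗ q)) ⊕ aside d) e ⟩
  (u ⊕ (neg ω² ⊗ unit d)) ⊕ aside d   ≡⟨ ⊕-assoc u (neg ω² ⊗ unit d) (aside d) ⟩
  u ⊕ ((neg ω² ⊗ unit d) ⊕ aside d)   ≡⟨ cong (u ⊕_) (left-aside d) ⟩
  u ⊕ (neg ω ⊗ unit d)                ≡⟨ cong (λ q → u ⊕ (neg ω ⊗ q)) e ⟨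
  u ⊕ (neg ω ⊗ (u' ⊖ u))              ∎
  where open ≡-Reasoning

opp-residue : ∀ d d' → residue d ≡ residue d' → residue (opp d) ≡ residue (opp d')
opp-residue (fwd _) (fwd _) e = refl
opp-residue (bwd _) (bwd _) e = refl
opp-residue (fwd _) (bwd _) ()
opp-residue (bwd _) (fwd _) ()

spins : ℕ → Dir → Dir
spins j d = fold d spin j

rots : ℕ → Pt → Pt
rots j p = fold p rot j

unit-spins : ∀ j d → unit (spins j d) ≡ rots j (unit d)
unit-spins zero    d = refl
unit-spins (suc j) d = trans (unit-spin (spins j d)) (cong rot (unit-spins j d))

swerve-spin : ∀ t d → swerve t (spin d) ≡ spin (swerve t d)
swerve-spin t (fwd z) = turn-spin t (fwd z)
swerve-spin t (bwd z) = turn-spin (flip t) (bwd z)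

swerve-spins : ∀ j t d → swerve t (spins j d) ≡ spins j (swerve t d)
swerve-spins zero    t d = refl
swerve-spins (suc j) t d = trans (swerve-spin t (spins j d)) (cong spin (swerve-spins j t d))

residue-spins : ∀ j d → residue (spins j d) ≡ residue d
residue-spins zero    d = refl
residue-spins (suc j) d = trans (h (spins j d)) (residue-spins j d)
  where
  h : ∀ d → residue (spin d) ≡ residue d
  h (fwd _) = refl
  h (bwd _) = refl

rots-⊕ : ∀ j p q → rots j (p ⊕ q) ≡ rots j p ⊕ rots j q
rots-⊕ zero    p q = refl
rots-⊕ (suc j) p q = trans (cong rot (rots-⊕ j p q)) (rot-⊕ (rots j p) (rots j q))

det-rot : ∀ p q → det (rot p) (rot q) ≡ det p q
det-rot (x , y) (x' , y') = h x y x' y'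
  where
  h : ∀ x y x' y' → (- y) * (x' - y') - (- y') * (x - y) ≡ x * y' - x' * y
  h = solve-∀

det-rots : ∀ j p q → det (rots j p) (rots j q) ≡ det p q
det-rots zero    p q = refl
det-rots (suc j) p q = trans (det-rot (rots j p) (rots j q)) (det-rots j p q)

det-⊕ˡ : ∀ p q r → det (p ⊕ q) r ≡ det p r + det q r
det-⊕ˡ (x , y) (x' , y') (x'' , y'') = h x y x' y' x'' y''
  where
  h : ∀ x y x' y' x'' y'' → (x + x') * y'' - x'' * (y + y') ≡ (x * y'' - x'' * y) + (x' * y'' - x'' * y')
  h = solve-∀

det-⊕ʳ : ∀ p q r → det p (q ⊕ r) ≡ det p q + det p r
det-⊕ʳ (x , y) (x' , y') (x'' , y'') = h x y x' y' x'' y''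
  where
  h : ∀ x y x' y' x'' y'' → x * (y' + y'') - (x' + x'') * y ≡ (x * y' - x' * y) + (x * y'' - x'' * y)
  h = solve-∀

det-self : ∀ p → det p p ≡ + 0
det-self (x , y) = h x y
  where
  h : ∀ x y → x * y - x * y ≡ + 0
  h = solve-∀

det-step : ∀ p q → det p (p ⊕ q) ≡ det p q
det-step p q = begin
  det p (p ⊕ q)     ≡⟨ det-⊕ʳ p p q ⟩
  det p p + det p q ≡⟨ cong (_+ det p q) (det-self p) ⟩
  + 0 + det p q     ≡⟨ ℤ.+-identityˡ (det p q) ⟩
  det p q           ∎
  where open ≡-Reasoning

-- A lattice path from the origin is summarised by its end point and six times its signed area;
-- concatenation of paths then becomes a Heisenberg group law.
join : Pt × ℤ → Pt × ℤ → Pt × ℤ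
join (p , z) (p' , z') = (p ⊕ p' , (z + z') + det p p')

run : Dir → List Turn → Dir × (Pt × ℤ)
run e []       = e , (origin , + 0)
run e (t ∷ ts) = proj₁ (run (swerve t e) ts) , join (unit e , + 0) (proj₂ (run (swerve t e) ts))

join-assoc : ∀ g h k → join (join g h) k ≡ join g (join h k)
join-assoc (p , z) (p' , z') (p'' , z'') = cong₂ _,_ (⊕-assoc p p' p'') (begin
  ((z + z') + det p p') + z'' + det (p ⊕ p') p''
    ≡⟨ cong (_+_ (((z + z') + det p p') + z'')) (det-⊕ˡ p p' p'') ⟩
  ((z + z') + det p p') + z'' + (det p p'' + det p' p'')
    ≡⟨ h z z' z'' (det p p') (det p p'') (det p' p'') ⟩
  z + ((z' + z'') + det p' p'') + (det p p' + det p p'')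
    ≡⟨ cong (_+_ (z + ((z' + z'') + det p' p''))) (det-⊕ʳ p p' p'') ⟨
  z + ((z' + z'') + det p' p'') + det p (p' ⊕ p'') ∎)
  where
  open ≡-Reasoning
  h : ∀ a b c d e f → ((a + b) + d) + c + (e + f) ≡ a + ((b + c) + f) + (d + e)
  h = solve-∀

join-identityˡ : ∀ g → join (origin , + 0) g ≡ g
join-identityˡ ((x , y) , z) = cong₂ _,_ (cong₂ _,_ (ℤ.+-identityˡ x) (ℤ.+-identityˡ y)) (h x y z)
  where
  h : ∀ x y z → (+ 0 + z) + (+ 0 * y - x * + 0) ≡ z
  h = solve-∀

join-identityʳ : ∀ g → join g (origin , + 0) ≡ g
join-identityʳ (p@(x , y) , z) = cong₂ _,_ (⊕-origin p) (h x y z)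
  where
  h : ∀ x y z → (z + + 0) + (x * + 0 - + 0 * y) ≡ z
  h = solve-∀

run-++ : ∀ e ts us → run e (ts ++ us) ≡
  (proj₁ (run (proj₁ (run e ts)) us) , join (proj₂ (run e ts)) (proj₂ (run (proj₁ (run e ts)) us)))
run-++ e []       us = cong (proj₁ (run e us) ,_) (sym (join-identityˡ (proj₂ (run e us))))
run-++ e (t ∷ ts) us = trans (cong (λ r → proj₁ r , join (unit e , + 0) (proj₂ r)) (run-++ (swerve t e) ts us))
  (cong (proj₁ (run e' us) ,_) (sym (join-assoc (unit e , + 0) (proj₂ (run (swerve t e) ts)) (proj₂ (run e' us)))))
  where
  e' : Dir
  e' = proj₁ (run (swerve t e) ts)

run-then : ∀ {e e' e'' g g'} ts us → run e ts ≡ (e' , g) → run e' us ≡ (e'' , g') →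
           run e (ts ++ us) ≡ (e'' , join g g')
run-then {e} ts us refl refl = run-++ e ts us

rotate : Pt × ℤ → Pt × ℤ
rotate (p , z) = (rot p , z)

rotate-join : ∀ g h → rotate (join g h) ≡ join (rotate g) (rotate h)
rotate-join (p , z) (p' , z') = cong₂ _,_ (rot-⊕ p p') (cong (_+_ (z + z')) (sym (det-rot p p')))

run-spin : ∀ e ts → run (spin e) ts ≡ (spin (proj₁ (run e ts)) , rotate (proj₂ (run e ts)))
run-spin e []       = refl
run-spin e (t ∷ ts) = begin
  (proj₁ (run (swerve t (spin e)) ts) , join (unit (spin e) , + 0) (proj₂ (run (swerve t (spin e)) ts)))
    ≡⟨ cong (λ r → proj₁ r , join (unit (spin e) , + 0) (proj₂ r))
         (trans (cong (λ e → run e ts) (swerve-spin t e)) (run-spin (swerve t e) ts)) ⟩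
  (spin (proj₁ r) , join (unit (spin e) , + 0) (rotate (proj₂ r)))
    ≡⟨ cong (λ u → spin (proj₁ r) , join (u , + 0) (rotate (proj₂ r))) (unit-spin e) ⟩
  (spin (proj₁ r) , join (rotate (unit e , + 0)) (rotate (proj₂ r)))
    ≡⟨ cong (spin (proj₁ r) ,_) (rotate-join (unit e , + 0) (proj₂ r)) ⟨
  (spin (proj₁ r) , rotate (join (unit e , + 0) (proj₂ r))) ∎
  where
  open ≡-Reasoning
  r : Dir × (Pt × ℤ)
  r = run (swerve t e) ts

_×ʲ_ : ℕ → Pt × ℤ → Pt × ℤ
n ×ʲ ((x , y) , z) = ((+ n * x , + n * y) , + n * z)

repeat : ℕ → List Turn → List Turn
repeat zero    ts = []
repeat (suc n) ts = ts ++ repeat n ts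

join-× : ∀ n g → join g (n ×ʲ g) ≡ suc n ×ʲ g
join-× n ((x , y) , z) = cong₂ _,_ (cong₂ _,_ (h (+ n) x) (h (+ n) y)) (h' (+ n) x y z)
  where
  h : ∀ n x → x + n * x ≡ (+ 1 + n) * x
  h = solve-∀
  h' : ∀ n x y z → (z + n * z) + (x * (n * y) - (n * x) * y) ≡ (+ 1 + n) * z
  h' = solve-∀

run-repeat : ∀ {e g} ts n → run e ts ≡ (e , g) → run e (repeat n ts) ≡ (e , n ×ʲ g)
run-repeat {e} {(x , y) , z} ts zero    eq = refl
run-repeat {e} {g}           ts (suc n) eq =
  trans (run-then ts (repeat n ts) eq (run-repeat ts n eq)) (cong (e ,_) (join-× n g))

rotate-onto : ∀ d d' → residue d ≡ residue d' → ∃ λ j → d' ≡ spins j d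
rotate-onto (fwd x0) (fwd x0) e = 0 , refl
rotate-onto (fwd x0) (fwd x1) e = 1 , refl
rotate-onto (fwd x0) (fwd x2) e = 2 , refl
rotate-onto (fwd x1) (fwd x0) e = 2 , refl
rotate-onto (fwd x1) (fwd x1) e = 0 , refl
rotate-onto (fwd x1) (fwd x2) e = 1 , refl
rotate-onto (fwd x2) (fwd x0) e = 1 , refl
rotate-onto (fwd x2) (fwd x1) e = 2 , refl
rotate-onto (fwd x2) (fwd x2) e = 0 , refl
rotate-onto (bwd x0) (bwd x0) e = 0 , refl
rotate-onto (bwd x0) (bwd x1) e = 1 , refl
rotate-onto (bwd x0) (bwd x2) e = 2 , refl
rotate-onto (bwd x1) (bwd x0) e = 2 , refl
rotate-onto (bwd x1) (bwd x1) e = 0 , refl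
rotate-onto (bwd x1) (bwd x2) e = 1 , refl
rotate-onto (bwd x2) (bwd x0) e = 1 , refl
rotate-onto (bwd x2) (bwd x1) e = 2 , refl
rotate-onto (bwd x2) (bwd x2) e = 0 , refl
rotate-onto (fwd _) (bwd _) ()
rotate-onto (bwd _) (fwd _) ()

≡ᵇ-false : ∀ {m n} → m ≢ n → (m ≡ᵇ n) ≡ false
≡ᵇ-false {m} {n} m≢n with m ≡ᵇ n in eq
... | false = refl
... | true  = contradiction (ℕ.≡ᵇ⇒≡ m n (subst T (sym eq) tt)) m≢n

≡ᵇ-refl : ∀ n → (n ≡ᵇ n) ≡ true
≡ᵇ-refl zero    = refl
≡ᵇ-refl (suc n) = ≡ᵇ-refl n

nextIdx-inner : ∀ n j → suc j ℕ.< n → nextIdx n j ≡ suc j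
nextIdx-inner n j lt = cong (λ b → if b then 0 else suc j) (≡ᵇ-false (ℕ.<⇒≢ lt))

-- Around step j of a periodic sequence of period suc m, the preceding, current
-- and following terms may be read off at j + m, 1 + (j + m) and 2 + (j + m).
prevIdx-periodic : {A : Set} (m : ℕ) (f : ℕ → A) → (∀ k → f (k ℕ.+ suc m) ≡ f k) →
                   ∀ j → f (prevIdx (suc m) j) ≡ f (j ℕ.+ m)
prevIdx-periodic m f per zero    = refl
prevIdx-periodic m f per (suc j) = trans (sym (per j)) (cong f (ℕ.+-suc j m))

nextIdx-periodic : {A : Set} (m : ℕ) (f : ℕ → A) → (∀ k → f (k ℕ.+ suc m) ≡ f k) →
                   ∀ j → j ℕ.< suc m → f (nextIdx (suc m) j) ≡ f (2 ℕ.+ (j ℕ.+ m))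
nextIdx-periodic m f per j lt with ℕ.<-cmp (suc j) (suc m)
... | tri< lt' _ _ = trans (cong f (nextIdx-inner (suc m) j lt'))
    (trans (sym (per (suc j))) (cong (λ k → f (suc k)) (ℕ.+-suc j m)))
... | tri≈ _ refl _ = trans (cong f (cong (λ b → if b then 0 else suc j) (≡ᵇ-refl (suc j))))
    (trans (sym (per 0)) (trans (sym (per (suc m))) (cong f (cong suc (ℕ.+-suc m m)))))
... | tri> _ _ gt = contradiction lt (ℕ.<⇒≱ gt)

same-or-flip : ∀ t t' → t' ≡ t ⊎ t' ≡ flip t
same-or-flip left  left  = inj₁ refl
same-or-flip left  right = inj₂ refl
same-or-flip right left  = inj₂ refl
same-or-flip right right = inj₁ refl

flip-distinct : ∀ t → flip t ≢ t
flip-distinct left  ()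
flip-distinct right ()

L-origin : L (+ 0) origin
L-origin = L-intro (+ 0) origin (+ 0) refl

module Circuit
  (In : Pt → Set) (In? : (α : Pt) → Dec (In α)) (In-rot : (α : Pt) → In α → In (rot α))
  (a b : ℤ)
  (benzel⇒In : (α : Pt) → InBenzel a b α → In α)
  (In⇒benzel : (α : Pt) → L (- + 1) α → In α → InBenzel a b α)
  where

  open Walk In In? In-rot

  edge⇒dart : ∀ u u' → BoundaryEdge a b u u' → ∃ λ δ → Boundary δ × tail δ ≡ u × head δ ≡ u'
  edge⇒dart u u' ((_ , _ , iu) , l , ¬r) with isUnit⁻¹ iu
  ... | d , e = dartOf u u' d ,
    boundary (proj₁ l) (benzel⇒In (leftCell u u') l)
      (λ i → ¬r (subst (InBenzel a b) (beside-dartOf u u' d e)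
        (In⇒benzel (beside (dartOf u u' d)) (L-beside (dartOf u u' d) (proj₁ l)) i))) ,
    tail-dartOf u u' d e , head-dartOf u u' d e

  tail-residue : ∀ δ → Boundary δ → L (residue (proj₂ δ)) (tail δ)
  tail-residue (α , d) bd = L-back d α (centre bd)

  dart⇒edge : ∀ δ → Boundary δ → BoundaryEdge a b (tail δ) (head δ)
  dart⇒edge δ@(α , d) bd =
    ( residue⇒vertex d {tail δ} (tail-residue δ bd)
    , residue⇒vertex (opp d) {head δ} (L-unit d (tail δ) (tail-residue δ bd))
    , subst IsUnit (sym (⊖-cancel (tail δ) (unit d))) (isUnit d)) ,
    subst (InBenzel a b) (sym (leftCell-dart δ)) (In⇒benzel α (centre bd) (inside bd)) ,
    λ r → outside bd (benzel⇒In (beside δ) (subst (InBenzel a b) (rightCell-dart δ) r))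

  module Loop (δ₀ : Dart) (m : ℕ)
    (start : Boundary δ₀) (start-fwd : residue (proj₂ δ₀) ≡ + 0)
    (closes : walk (suc m) δ₀ ≡ δ₀)
    (minimal : ∀ j → 0 ℕ.< j → j ℕ.< suc m → walk j δ₀ ≢ δ₀)
    (covers : ∀ δ → Boundary δ → ∃ λ k → walk k δ ≡ δ₀)
    where

    n : ℕ
    n = suc m

    loop : ℕ → Dart
    loop k = walk k δ₀

    loop-boundary : ∀ k → Boundary (loop k)
    loop-boundary k = walk-boundary k δ₀ start

    loop-periodic : ∀ k → loop (k ℕ.+ n) ≡ loop k
    loop-periodic k = trans (walk-+ k n δ₀) (cong (walk k) closes)

    loop-periodic* : ∀ k q → loop (k ℕ.+ q ℕ.* n) ≡ loop k
    loop-periodic* k zero    = cong loop (ℕ.+-identityʳ k)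
    loop-periodic* k (suc q) = trans (cong loop (trans (cong (k ℕ.+_) (ℕ.+-comm n (q ℕ.* n)))
      (sym (ℕ.+-assoc k (q ℕ.* n) n)))) (trans (loop-periodic (k ℕ.+ q ℕ.* n)) (loop-periodic* k q))

    walk-n : ∀ k → walk n (loop k) ≡ loop k
    walk-n k = trans (walk-comm n k δ₀) (cong (walk k) closes)

    -- Running k steps forward to δ₀ and then on to the next multiple of n undoes k steps.
    on-loop : ∀ δ → Boundary δ → ∃ λ k → δ ≡ loop k
    on-loop δ bd with covers δ bd
    ... | k , e = k ℕ.* m , walk-injective k δ (loop (k ℕ.* m)) bd (loop-boundary (k ℕ.* m))
      (trans e (trans (sym (loop-periodic* 0 k))
        (trans (cong loop (ℕ.*-suc k m)) (walk-+ k (k ℕ.* m) δ₀))))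

    reduce : ∀ k → ∃ λ j → j ℕ.< n × loop j ≡ loop k
    reduce zero = 0 , ℕ.s≤s ℕ.z≤n , refl
    reduce (suc k) with reduce k
    ... | j , j<n , e with ℕ.m≤n⇒m<n∨m≡n j<n
    ...   | inj₁ lt = suc j , lt , cong step e
    ...   | inj₂ eq = 0 , ℕ.s≤s ℕ.z≤n , trans (sym closes) (trans (cong loop (sym eq)) (cong step e))

    V : ℕ → Pt
    V k = tail (loop k)

    V-suc : ∀ k → V (suc k) ≡ head (loop k)
    V-suc k = head-move (turnAt (loop k)) (loop k)

    distinct : ∀ j k → j ℕ.< k → k ℕ.< n → loop j ≢ loop k
    distinct j k j<k k<n e = minimal (k ℕ.∸ j) (ℕ.m<n⇒0<n∸m j<k)
      (ℕ.≤-<-trans (ℕ.m∸n≤m k j) k<n)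
      (walk-injective j (walk (k ℕ.∸ j) δ₀) δ₀ (loop-boundary (k ℕ.∸ j)) start
        (trans (sym (walk-+ j (k ℕ.∸ j) δ₀))
          (trans (cong loop (ℕ.m+[n∸m]≡n (ℕ.<⇒≤ j<k))) (sym e))))

    loop-injective : ∀ j k → j ℕ.< n → k ℕ.< n → loop j ≡ loop k → j ≡ k
    loop-injective j k j<n k<n e with ℕ.<-cmp j k
    ... | tri< lt _ _ = contradiction e (distinct j k lt k<n)
    ... | tri≈ _ eq _ = eq
    ... | tri> _ _ gt = contradiction (sym e) (distinct k j gt j<n)

    dart-unique : ∀ δ δ' → tail δ ≡ tail δ' → head δ ≡ head δ' → δ ≡ δ'
    dart-unique δ@(α , d) δ'@(α' , d') e e' with unit-injective {d} {d'} (begin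
      unit d           ≡⟨ ⊖-cancel (tail δ) (unit d) ⟨
      head δ ⊖ tail δ  ≡⟨ cong₂ _⊖_ e' e ⟩
      head δ' ⊖ tail δ' ≡⟨ ⊖-cancel (tail δ') (unit d') ⟩
      unit d'          ∎)
      where open ≡-Reasoning
    ... | refl = cong (_, d) (⊕-cancelʳ (back d) e)

    V-edge : ∀ k → BoundaryEdge a b (V k) (V (suc k))
    V-edge k = subst (BoundaryEdge a b (V k)) (sym (V-suc k)) (dart⇒edge (loop k) (loop-boundary k))

    V-path : BoundaryPath a b n V
    V-path =
      ℕ.s≤s ℕ.z≤n ,
      subst (λ r → L r (V 0)) start-fwd (tail-residue δ₀ start) ,
      cong tail closes ,
      (λ k _ → V-edge k) ,
      (λ k k' k<n k'<n e e' → loop-injective k k' k<n k'<n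
        (dart-unique (loop k) (loop k') e (trans (sym (V-suc k)) (trans e' (V-suc k'))))) ,
      λ u u' be → surj u u' be
      where
      surj : ∀ u u' → BoundaryEdge a b u u' → Σ ℕ λ k → k ℕ.< n × V k ≡ u × V (suc k) ≡ u'
      surj u u' be with edge⇒dart u u' be
      ... | δ , bd , t , h with on-loop δ bd
      ...   | k , refl with reduce k
      ...     | j , j<n , e = j , j<n , trans (cong tail e) t , trans (V-suc j) (trans (cong head e) h)

    D : ℕ → Dir
    D k = proj₂ (loop k)

    τ : ℕ → Turn
    τ k = turnAt (loop k)

    D-suc : ∀ k → D (suc k) ≡ turn (τ k) (D k)
    D-suc k = h (τ k) (loop k)
      where
      h : ∀ t δ → proj₂ (move t δ) ≡ turn t (proj₂ δ)
      h left  δ = refl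
      h right δ = refl

    dir-V : ∀ k → dir V k ≡ unit (D k)
    dir-V k = trans (cong (_⊖ V k) (V-suc k)) (⊖-cancel (V k) (unit (D k)))

    Y : ℕ → Dir
    Y zero    = fwd x0
    Y (suc k) = swerve (τ k) (Y k)

    W : ℕ → Pt
    W zero    = origin
    W (suc k) = W k ⊕ unit (Y k)

    dir-W : ∀ k → dir W k ≡ unit (Y k)
    dir-W k = ⊖-cancel (W k) (unit (Y k))

    traces : ∀ ts k → Spells (loop k) ts →
             Y (length ts ℕ.+ k) ≡ proj₁ (run (Y k) ts) ×
             (W (length ts ℕ.+ k) , sixTimesSignedArea (length ts ℕ.+ k) W) ≡
             join (W k , sixTimesSignedArea k W) (proj₂ (run (Y k) ts))
    traces []       k _       = refl , sym (join-identityʳ (W k , sixTimesSignedArea k W))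
    traces (t ∷ ts) k (refl , f) with traces ts (suc k) f
    ... | eY , eW = trans (cong Y (sym (ℕ.+-suc (length ts) k))) eY ,
      (begin
        (W (suc (length ts ℕ.+ k)) , sixTimesSignedArea (suc (length ts ℕ.+ k)) W)
          ≡⟨ cong (λ j → W j , sixTimesSignedArea j W) (ℕ.+-suc (length ts) k) ⟨
        (W (length ts ℕ.+ suc k) , sixTimesSignedArea (length ts ℕ.+ suc k) W)
          ≡⟨ eW ⟩
        join (W (suc k) , sixTimesSignedArea (suc k) W) g
          ≡⟨ cong (λ z → join (W (suc k) , z) g) (cong₂ _+_ (sym (ℤ.+-identityʳ (sixTimesSignedArea k W)))
               (det-step (W k) (unit (Y k)))) ⟩
        join (join (W k , sixTimesSignedArea k W) (unit (Y k) , + 0)) g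
          ≡⟨ join-assoc (W k , sixTimesSignedArea k W) (unit (Y k) , + 0) g ⟩
        join (W k , sixTimesSignedArea k W) (join (unit (Y k) , + 0) g) ∎)
      where
      open ≡-Reasoning
      g : Pt × ℤ
      g = proj₂ (run (Y (suc k)) ts)

    parity : ∀ k → residue (Y k) ≡ residue (D k)
    parity zero    = sym start-fwd
    parity (suc k) = begin
      residue (swerve (τ k) (Y k)) ≡⟨ residue-swerve (τ k) (Y k) ⟩
      residue (opp (Y k))          ≡⟨ opp-residue (Y k) (D k) (parity k) ⟩
      residue (opp (D k))          ≡⟨ residue-turn (τ k) (D k) ⟨
      residue (turn (τ k) (D k))   ≡⟨ cong residue (D-suc k) ⟨
      residue (D (suc k))          ∎
      where open ≡-Reasoning

    D-periodic : ∀ k → D (k ℕ.+ n) ≡ D k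
    D-periodic k = cong proj₂ (loop-periodic k)

    D-suc² : ∀ k → D (2 ℕ.+ k) ≡ turn (τ (suc k)) (turn (τ k) (D k))
    D-suc² k = trans (D-suc (suc k)) (cong (turn (τ (suc k))) (D-suc k))

    W-residue : ∀ k → L (residue (Y k)) (W k)
    W-residue zero    = L-origin
    W-residue (suc k) = subst (λ r → L r (W (suc k))) (sym (residue-swerve (τ k) (Y k)))
      (L-unit (Y k) (W k) (W-residue k))

    W-edge : ∀ k → GridEdge (W k) (W (suc k))
    W-edge k = residue⇒vertex (Y k) {W k} (W-residue k) ,
      residue⇒vertex (Y (suc k)) {W (suc k)} (W-residue (suc k)) ,
      subst IsUnit (sym (dir-W k)) (isUnit (Y k))

    weavesV⇒ : ∀ k → axis (D k) ≡ axis (D (2 ℕ.+ k)) → τ (suc k) ≡ flip (τ k)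
    weavesV⇒ k e = axis-turn²⁻¹ (τ k) (τ (suc k)) (D k) (trans (cong axis (sym (D-suc² k))) (sym e))

    ⇒weavesV : ∀ k → τ (suc k) ≡ flip (τ k) → axis (D k) ≡ axis (D (2 ℕ.+ k))
    ⇒weavesV k e = sym (trans (cong axis (D-suc² k))
      (trans (cong (λ t → axis (turn t (turn (τ k) (D k)))) e) (axis-turn² (τ k) (D k))))

    module Shadow (Y-closes : Y n ≡ Y 0) where

      τ-periodic : ∀ k → τ (k ℕ.+ n) ≡ τ k
      τ-periodic k = cong turnAt (loop-periodic k)

      Y-periodic : ∀ k → Y (k ℕ.+ n) ≡ Y k
      Y-periodic zero    = Y-closes
      Y-periodic (suc k) = cong₂ swerve (τ-periodic k) (Y-periodic k)

      weavesW⇒ : ∀ k → axis (Y k) ≡ axis (Y (2 ℕ.+ k)) → τ (suc k) ≡ τ k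
      weavesW⇒ k e = axis-swerve²⁻¹ (τ k) (τ (suc k)) (Y k) (sym e)

      ⇒weavesW : ∀ k → τ (suc k) ≡ τ k → axis (Y k) ≡ axis (Y (2 ℕ.+ k))
      ⇒weavesW k e = sym (trans (cong (λ t → axis (swerve t (swerve (τ k) (Y k)))) e) (axis-swerve² (τ k) (Y k)))

      V-weaves⇒ : ∀ j → j ℕ.< n → Weaves n V j → axis (D (j ℕ.+ m)) ≡ axis (D (2 ℕ.+ (j ℕ.+ m)))
      V-weaves⇒ j lt p = trans (cong axis (sym (prevIdx-periodic m D D-periodic j)))
        (trans (parallel⇒axis (D (prevIdx n j)) (D (nextIdx n j)) (subst₂ Parallel (dir-V (prevIdx n j)) (dir-V (nextIdx n j)) p))
          (cong axis (nextIdx-periodic m D D-periodic j lt)))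

      V-weaves⇐ : ∀ j → j ℕ.< n → axis (D (j ℕ.+ m)) ≡ axis (D (2 ℕ.+ (j ℕ.+ m))) → Weaves n V j
      V-weaves⇐ j lt e = subst₂ Parallel (sym (dir-V (prevIdx n j))) (sym (dir-V (nextIdx n j)))
        (axis⇒parallel (D (prevIdx n j)) (D (nextIdx n j)) (trans (cong axis (prevIdx-periodic m D D-periodic j))
          (trans e (cong axis (sym (nextIdx-periodic m D D-periodic j lt))))))

      W-weaves⇒ : ∀ j → j ℕ.< n → Weaves n W j → axis (Y (j ℕ.+ m)) ≡ axis (Y (2 ℕ.+ (j ℕ.+ m)))
      W-weaves⇒ j lt p = trans (cong axis (sym (prevIdx-periodic m Y Y-periodic j)))
        (trans (parallel⇒axis (Y (prevIdx n j)) (Y (nextIdx n j)) (subst₂ Parallel (dir-W (prevIdx n j)) (dir-W (nextIdx n j)) p))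
          (cong axis (nextIdx-periodic m Y Y-periodic j lt)))

      W-weaves⇐ : ∀ j → j ℕ.< n → axis (Y (j ℕ.+ m)) ≡ axis (Y (2 ℕ.+ (j ℕ.+ m))) → Weaves n W j
      W-weaves⇐ j lt e = subst₂ Parallel (sym (dir-W (prevIdx n j))) (sym (dir-W (nextIdx n j)))
        (axis⇒parallel (Y (prevIdx n j)) (Y (nextIdx n j)) (trans (cong axis (prevIdx-periodic m Y Y-periodic j))
          (trans e (cong axis (sym (nextIdx-periodic m Y Y-periodic j lt))))))

      V-turnsLeft⇒ : ∀ k → TurnsLeft V k → τ k ≡ left
      V-turnsLeft⇒ k e = turnsLeft⇒left (τ k) (D k) (trans (sym (trans (dir-V (suc k)) (cong unit (D-suc k))))
        (trans e (cong (neg ω² ⊗_) (dir-V k))))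

      V-turnsLeft⇐ : ∀ k → τ k ≡ left → TurnsLeft V k
      V-turnsLeft⇐ k e = trans (trans (dir-V (suc k)) (cong unit (trans (D-suc k) (cong (λ t → turn t (D k)) e))))
        (trans (sym (unit-left (D k))) (cong (neg ω² ⊗_) (sym (dir-V k))))

      W-turnsLeft⇒ : TurnsLeft W 0 → τ 0 ≡ left
      W-turnsLeft⇒ e = turnsLeft⇒left (τ 0) (fwd x0) (trans (sym (dir-W 1))
        (trans e (cong (neg ω² ⊗_) (dir-W 0))))

      W-turnsLeft⇐ : τ 0 ≡ left → TurnsLeft W 0
      W-turnsLeft⇐ e = trans (dir-W 1) (trans (cong (λ t → unit (turn t (fwd x0))) e)
        (cong (neg ω² ⊗_) (sym (dir-W 0))))

      W-shadows : Shadows n V W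
      W-shadows =
        L-origin ,
        (λ k _ → W-edge k) ,
        (λ j lt → (λ p q → flip-distinct (τ (j ℕ.+ m)) (trans
              (sym (weavesV⇒ (j ℕ.+ m) (V-weaves⇒ j lt q))) (weavesW⇒ (j ℕ.+ m) (W-weaves⇒ j lt p)))) ,
            winds⇒weaves j lt) ,
        (λ k _ e → axis-swerve-distinct (τ k) (Y k) (trans
          (cong axis (unit-injective {Y (suc k)} {opp (Y k)} (trans (sym (dir-W (suc k)))
            (trans e (trans (cong neg (dir-W k)) (sym (unit-opp (Y k))))))))
          (axis-opp (Y k)))) ,
        (λ e → V-turnsLeft⇐ 0 (W-turnsLeft⇒ e)) ,
        (λ e → W-turnsLeft⇐ (V-turnsLeft⇒ 0 e))
        where
        winds⇒weaves : ∀ j → j ℕ.< n → Winds n V j → Weaves n W j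
        winds⇒weaves j lt w with same-or-flip (τ (j ℕ.+ m)) (τ (suc (j ℕ.+ m)))
        ... | inj₁ e = W-weaves⇐ j lt (⇒weavesW (j ℕ.+ m) e)
        ... | inj₂ e = contradiction (V-weaves⇐ j lt (⇒weavesV (j ℕ.+ m) e)) w

      module Area (W-closes : W n ≡ origin) where

        W-periodic : ∀ k → W (k ℕ.+ n) ≡ W k
        W-periodic zero    = W-closes
        W-periodic (suc k) = cong₂ (λ p d → p ⊕ unit d) (W-periodic k) (Y-periodic k)

        area : ℕ → ℤ
        area k = sixTimesSignedArea k W

        area-periodic : ∀ k → area (k ℕ.+ n) ≡ area k + area n
        area-periodic zero    = sym (ℤ.+-identityˡ (area n))
        area-periodic (suc k) = begin
          area (k ℕ.+ n) + det (W (k ℕ.+ n)) (W (suc k ℕ.+ n))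
            ≡⟨ cong₂ _+_ (area-periodic k) (cong₂ det (W-periodic k) (W-periodic (suc k))) ⟩
          (area k + area n) + det (W k) (W (suc k))
            ≡⟨ h (area k) (area n) (det (W k) (W (suc k))) ⟩
          (area k + det (W k) (W (suc k))) + area n ∎
          where
          open ≡-Reasoning
          h : ∀ x y z → (x + y) + z ≡ (x + z) + y
          h = solve-∀

        module Tracked (v w : ℕ → Pt) (k₀ : ℕ) (v₀ : L (+ 0) (v 0))
          (tracks : ∀ k → k ℕ.< n → tail (loop (k ℕ.+ k₀)) ≡ v k × head (loop (k ℕ.+ k₀)) ≡ v (suc k))
          (shadows : Shadows n v w)
          where

          w₀ : L (+ 0) (w 0)
          w₀ = proj₁ shadows

          w-edge : ∀ k → k ℕ.< n → GridEdge (w k) (w (suc k))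
          w-edge = proj₁ (proj₂ shadows)

          w-weaves⇒ : ∀ j → j ℕ.< n → Weaves n w j → Winds n v j
          w-weaves⇒ j lt = proj₁ (proj₁ (proj₂ (proj₂ shadows)) j lt)

          w-weaves⇐ : ∀ j → j ℕ.< n → Winds n v j → Weaves n w j
          w-weaves⇐ j lt = proj₂ (proj₁ (proj₂ (proj₂ shadows)) j lt)

          no-backtrack : ∀ k → suc k ℕ.< n → dir w (suc k) ≢ neg (dir w k)
          no-backtrack = proj₁ (proj₂ (proj₂ (proj₂ shadows)))

          first-turn⇒ : TurnsLeft w 0 → TurnsLeft v 0
          first-turn⇒ = proj₁ (proj₂ (proj₂ (proj₂ (proj₂ shadows))))

          first-turn⇐ : TurnsLeft v 0 → TurnsLeft w 0
          first-turn⇐ = proj₂ (proj₂ (proj₂ (proj₂ (proj₂ shadows))))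

          dir-v : ∀ k → k ℕ.< n → dir v k ≡ unit (D (k ℕ.+ k₀))
          dir-v k lt with tracks k lt
          ... | t , h = trans (cong₂ _⊖_ (sym h) (sym t)) (⊖-cancel (tail (loop (k ℕ.+ k₀))) (unit (D (k ℕ.+ k₀))))

          0<n : 0 ℕ.< n
          0<n = ℕ.s≤s ℕ.z≤n

          w-suc : ∀ k d → dir w k ≡ unit d → w (suc k) ≡ w k ⊕ unit d
          w-suc k d e = trans (sym (⊕-cancel (w k) (w (suc k)))) (cong (w k ⊕_) e)

          D-fwd : residue (D k₀) ≡ + 0
          D-fwd = residue-unique (D k₀) (fwd x0) (v 0)
            (subst (L (residue (D k₀))) (proj₁ (tracks 0 0<n)) (tail-residue (loop k₀) (loop-boundary k₀))) v₀

          abstract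
            first-dir : ∃ λ d → dir w 0 ≡ unit d × residue d ≡ + 0
            first-dir with isUnit⁻¹ (proj₂ (proj₂ (w-edge 0 0<n)))
            ... | d , e = d , e , residue-forced (fwd x0) d (w 0) w₀
              (subst Vertex (w-suc 0 d e) (proj₁ (proj₂ (w-edge 0 0<n))))

            rotation : ∃ λ j → proj₁ first-dir ≡ spins j (Y k₀)
            rotation = rotate-onto (Y k₀) (proj₁ first-dir)
              (trans (trans (parity k₀) D-fwd) (sym (proj₂ (proj₂ first-dir))))

          j₀ : ℕ
          j₀ = proj₁ rotation

          E : ℕ → Dir
          E k = spins j₀ (Y (k ℕ.+ k₀))

          E-suc : ∀ k → E (suc k) ≡ swerve (τ (k ℕ.+ k₀)) (E k)
          E-suc k = sym (swerve-spins j₀ (τ (k ℕ.+ k₀)) (Y (k ℕ.+ k₀)))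

          E-residue : ∀ k → residue (E k) ≡ residue (Y (k ℕ.+ k₀))
          E-residue k = residue-spins j₀ (Y (k ℕ.+ k₀))

          Follows : ℕ → Set
          Follows k = L (residue (E k)) (w k) × dir w k ≡ unit (E k)

          some-turn : ∀ k → suc k ℕ.< n → Follows k →
                      ∃ λ t → L (residue (opp (E k))) (w (suc k)) × dir w (suc k) ≡ unit (swerve t (E k))
          some-turn k lt (l , e) with isUnit⁻¹ (proj₂ (proj₂ (w-edge (suc k) lt)))
          ... | d , e' with turn-or-back (E k) d
                 (residue-forced (opp (E k)) d (w (suc k)) l'
                   (subst Vertex (w-suc (suc k) d e') (proj₁ (proj₂ (w-edge (suc k) lt)))))
            where
            l' : L (residue (opp (E k))) (w (suc k))
            l' = subst (L (residue (opp (E k)))) (sym (w-suc k (E k) e)) (L-unit (E k) (w k) l)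
          ...   | inj₁ (t , refl) with turn-as-swerve t (E k)
          ...     | t' , eq = t' , subst (L (residue (opp (E k)))) (sym (w-suc k (E k) e)) (L-unit (E k) (w k) l) ,
                       trans e' (cong unit eq)
          some-turn k lt (l , e) | d , e' | inj₂ refl =
            contradiction (trans e' (trans (unit-opp (E k)) (cong neg (sym e)))) (no-backtrack k lt)

          follows-suc : ∀ k t → L (residue (opp (E k))) (w (suc k)) →
                        dir w (suc k) ≡ unit (swerve t (E k)) → t ≡ τ (k ℕ.+ k₀) → Follows (suc k)
          follows-suc k t l e refl =
            subst (λ r → L r (w (suc k))) (sym (trans (cong residue (E-suc k)) (residue-swerve t (E k)))) l ,
            trans e (cong unit (sym (E-suc k)))

          left-iff : ∀ t t' → (t ≡ left → t' ≡ left) → (t' ≡ left → t ≡ left) → t ≡ t'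
          left-iff left  t'    f g = sym (f refl)
          left-iff right left  f g = g refl
          left-iff right right f g = refl

          swerve-fwd : ∀ t e → residue e ≡ + 0 → swerve t e ≡ turn t e
          swerve-fwd t (fwd z) _ = refl
          swerve-fwd t (bwd z) ()

          follows : ∀ k → k ℕ.< n → Follows k
          follows zero lt = subst (λ r → L r (w 0)) (sym (trans (E-residue 0) (trans (parity k₀) D-fwd))) w₀ ,
            trans (proj₁ (proj₂ first-dir)) (cong unit (proj₂ rotation))
          follows (suc zero) lt with follows zero 0<n
          ... | l , e with some-turn 0 lt (l , e)
          ...   | t , l' , e' = follows-suc 0 t l' e' (left-iff t (τ k₀) f g)
            where
            sw : swerve t (E 0) ≡ turn t (E 0)
            sw = swerve-fwd t (E 0) (trans (E-residue 0) (trans (parity k₀) D-fwd))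
            dv : dir v 1 ≡ unit (turn (τ k₀) (D k₀))
            dv = trans (dir-v 1 lt) (cong unit (D-suc k₀))
            f : t ≡ left → τ k₀ ≡ left
            f refl = turnsLeft⇒left (τ k₀) (D k₀) (trans (sym dv) (trans
              (first-turn⇒ (trans e' (trans (cong unit sw) (trans (sym (unit-left (E 0))) (cong (neg ω² ⊗_) (sym e))))))
              (cong (neg ω² ⊗_) (dir-v 0 0<n))))
            g : τ k₀ ≡ left → t ≡ left
            g eq = turnsLeft⇒left t (E 0) (trans (sym (trans e' (cong unit sw))) (trans
              (first-turn⇐ (trans dv (trans (cong (λ t → unit (turn t (D k₀))) eq)
                (trans (sym (unit-left (D k₀))) (cong (neg ω² ⊗_) (sym (dir-v 0 0<n)))))))
              (cong (neg ω² ⊗_) e)))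
          follows (suc (suc k)) lt with follows k (ℕ.<-trans (ℕ.n<1+n k) (ℕ.<-trans (ℕ.n<1+n (suc k)) lt))
                                      | follows (suc k) (ℕ.<-trans (ℕ.n<1+n (suc k)) lt)
          ... | l , e | l' , e' with some-turn (suc k) lt (l' , e')
          ...   | t , l'' , e'' = follows-suc (suc k) t l'' e'' same
            where
            K : ℕ
            K = k ℕ.+ k₀
            lt' : suc k ℕ.< n
            lt' = ℕ.<-trans (ℕ.n<1+n (suc k)) lt
            lt'' : k ℕ.< n
            lt'' = ℕ.<-trans (ℕ.n<1+n k) lt'
            ni : nextIdx n (suc k) ≡ suc (suc k)
            ni = nextIdx-inner n (suc k) lt
            dw : dir w (suc (suc k)) ≡ unit (swerve t (swerve (τ K) (E k)))
            dw = trans e'' (cong (λ d → unit (swerve t d)) (E-suc k))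
            w⇒ : Weaves n w (suc k) → t ≡ τ K
            w⇒ p = axis-swerve²⁻¹ (τ K) t (E k) (sym (parallel⇒axis (E k) (swerve t (swerve (τ K) (E k)))
              (subst₂ Parallel e (trans (cong (dir w) ni) dw) p)))
            w⇐ : t ≡ τ K → Weaves n w (suc k)
            w⇐ eq = subst₂ Parallel (sym e) (sym (trans (cong (dir w) ni) dw))
              (axis⇒parallel (E k) (swerve t (swerve (τ K) (E k)))
                (sym (trans (cong (λ t → axis (swerve t (swerve (τ K) (E k)))) eq) (axis-swerve² (τ K) (E k)))))
            v⇒ : Weaves n v (suc k) → τ (suc K) ≡ flip (τ K)
            v⇒ p = weavesV⇒ K (parallel⇒axis (D K) (D (2 ℕ.+ K))
              (subst₂ Parallel (dir-v k lt'') (trans (cong (dir v) ni) (dir-v (suc (suc k)) lt)) p))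
            v⇐ : τ (suc K) ≡ flip (τ K) → Weaves n v (suc k)
            v⇐ eq = subst₂ Parallel (sym (dir-v k lt'')) (sym (trans (cong (dir v) ni) (dir-v (suc (suc k)) lt)))
              (axis⇒parallel (D K) (D (2 ℕ.+ K)) (⇒weavesV K eq))
            same : t ≡ τ (suc K)
            same with same-or-flip (τ K) (τ (suc K)) | same-or-flip (τ K) t
            ... | inj₁ p | inj₁ q = trans q (sym p)
            ... | inj₂ p | inj₂ q = trans q (sym p)
            ... | inj₁ p | inj₂ q = contradiction
              (trans (sym q) (w⇒ (w-weaves⇐ (suc k) lt' λ wv →
                flip-distinct (τ K) (trans (sym (v⇒ wv)) p)))) (flip-distinct (τ K))
            ... | inj₂ p | inj₁ q = contradiction (v⇐ p) (w-weaves⇒ (suc k) lt' (w⇐ q))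

          X : ℕ → Pt
          X k = W (k ℕ.+ k₀) ⊖ W k₀

          u : ℕ → Pt
          u k = unit (Y (k ℕ.+ k₀))

          X-suc : ∀ k → X (suc k) ≡ X k ⊕ u k
          X-suc k = h (W (k ℕ.+ k₀)) (u k) (neg (W k₀))
            where
            h' : ∀ x y z → (x + y) + z ≡ (x + z) + y
            h' = solve-∀
            h : ∀ p q r → (p ⊕ q) ⊕ r ≡ (p ⊕ r) ⊕ q
            h (x , y) (x' , y') (x'' , y'') = cong₂ _,_ (h' x x' x'') (h' y y' y'')

          X-zero : X 0 ≡ origin
          X-zero = h (W k₀)
            where
            h : ∀ p → p ⊖ p ≡ origin
            h (x , y) = cong₂ _,_ (ℤ.+-inverseʳ x) (ℤ.+-inverseʳ y)

          rots-origin : ∀ j → rots j origin ≡ origin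
          rots-origin zero    = refl
          rots-origin (suc j) = cong rot (rots-origin j)

          dir-w : ∀ k → k ℕ.< n → dir w k ≡ rots j₀ (u k)
          dir-w k lt = trans (proj₂ (follows k lt)) (unit-spins j₀ (Y (k ℕ.+ k₀)))

          position : ∀ k → k ℕ.≤ n → w k ≡ w 0 ⊕ rots j₀ (X k)
          position zero    _  = sym (trans (cong (w 0 ⊕_) (trans (cong (rots j₀) X-zero) (rots-origin j₀))) (⊕-origin (w 0)))
          position (suc k) lt = begin
            w (suc k)                                 ≡⟨ ⊕-cancel (w k) (w (suc k)) ⟨
            w k ⊕ dir w k                             ≡⟨ cong₂ _⊕_ (position k (ℕ.<⇒≤ lt)) (dir-w k lt) ⟩
            (w 0 ⊕ rots j₀ (X k)) ⊕ rots j₀ (u k)     ≡⟨ ⊕-assoc (w 0) (rots j₀ (X k)) (rots j₀ (u k)) ⟩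
            w 0 ⊕ (rots j₀ (X k) ⊕ rots j₀ (u k))     ≡⟨ cong (w 0 ⊕_) (rots-⊕ j₀ (X k) (u k)) ⟨
            w 0 ⊕ rots j₀ (X k ⊕ u k)                 ≡⟨ cong (λ p → w 0 ⊕ rots j₀ p) (X-suc k) ⟨
            w 0 ⊕ rots j₀ (X (suc k))                 ∎
            where open ≡-Reasoning

          swept : ℕ → ℤ
          swept k = (det (w 0) (rots j₀ (X k)) + (area (k ℕ.+ k₀) - area k₀)) + det (neg (W k₀)) (X k)

          det-origin : ∀ p → det p origin ≡ + 0
          det-origin (x , y) = h x y
            where
            h : ∀ x y → x * + 0 - + 0 * y ≡ + 0
            h = solve-∀

          area-w : ∀ k → k ℕ.≤ n → sixTimesSignedArea k w ≡ swept k
          area-w zero _ = sym (begin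
            swept 0
              ≡⟨ cong₂ (λ p q → (det (w 0) p + (area k₀ - area k₀)) + det (neg (W k₀)) q)
                   (trans (cong (rots j₀) X-zero) (rots-origin j₀)) X-zero ⟩
            (det (w 0) origin + (area k₀ - area k₀)) + det (neg (W k₀)) origin
              ≡⟨ cong₂ (λ p q → (p + (area k₀ - area k₀)) + q) (det-origin (w 0)) (det-origin (neg (W k₀))) ⟩
            (+ 0 + (area k₀ - area k₀)) + + 0
              ≡⟨ h (area k₀) ⟩
            + 0 ∎)
            where
            open ≡-Reasoning
            h : ∀ x → (+ 0 + (x - x)) + + 0 ≡ + 0
            h = solve-∀
          area-w (suc k) lt = begin
            sixTimesSignedArea k w + det (w k) (w (suc k))
              ≡⟨ cong₂ _+_ (area-w k (ℕ.<⇒≤ lt)) increment ⟩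
            swept k + (det (w 0) (R (u k)) + det (X k) (u k))
              ≡⟨ cong (λ z → swept k + (det (w 0) (R (u k)) + z)) (det-⊕ˡ (W (k ℕ.+ k₀)) (neg (W k₀)) (u k)) ⟩
            swept k + (det (w 0) (R (u k)) + (det (W (k ℕ.+ k₀)) (u k) + det (neg (W k₀)) (u k)))
              ≡⟨ shuffle (det (w 0) (R (X k))) (area (k ℕ.+ k₀)) (area k₀) (det (neg (W k₀)) (X k))
                   (det (w 0) (R (u k))) (det (W (k ℕ.+ k₀)) (u k)) (det (neg (W k₀)) (u k)) ⟩
            ((det (w 0) (R (X k)) + det (w 0) (R (u k))) + ((area (k ℕ.+ k₀) + det (W (k ℕ.+ k₀)) (u k)) - area k₀))
              + (det (neg (W k₀)) (X k) + det (neg (W k₀)) (u k))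
              ≡⟨ cong₂ (λ p q → (p + ((area (k ℕ.+ k₀) + det (W (k ℕ.+ k₀)) (u k)) - area k₀)) + q)
                   (trans (sym (det-⊕ʳ (w 0) (R (X k)) (R (u k))))
                     (cong (det (w 0)) (trans (sym (rots-⊕ j₀ (X k) (u k))) (cong R (sym (X-suc k))))))
                   (trans (sym (det-⊕ʳ (neg (W k₀)) (X k) (u k))) (cong (det (neg (W k₀))) (sym (X-suc k)))) ⟩
            (det (w 0) (R (X (suc k))) + ((area (k ℕ.+ k₀) + det (W (k ℕ.+ k₀)) (u k)) - area k₀))
              + det (neg (W k₀)) (X (suc k))
              ≡⟨ cong (λ z → (det (w 0) (R (X (suc k))) + ((area (k ℕ.+ k₀) + z) - area k₀)) + det (neg (W k₀)) (X (suc k)))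
                   (sym (det-step (W (k ℕ.+ k₀)) (u k))) ⟩
            swept (suc k) ∎
            where
            open ≡-Reasoning
            R : Pt → Pt
            R = rots j₀
            shuffle : ∀ a b c d e f g → ((a + (b - c)) + d) + (e + (f + g)) ≡ ((a + e) + ((b + f) - c)) + (d + g)
            shuffle = solve-∀
            increment : det (w k) (w (suc k)) ≡ det (w 0) (R (u k)) + det (X k) (u k)
            increment = begin
              det (w k) (w (suc k))                             ≡⟨ cong (det (w k)) (⊕-cancel (w k) (w (suc k))) ⟨
              det (w k) (w k ⊕ dir w k)                         ≡⟨ det-step (w k) (dir w k) ⟩
              det (w k) (dir w k)                               ≡⟨ cong₂ det (position k (ℕ.<⇒≤ lt)) (dir-w k lt) ⟩
              det (w 0 ⊕ R (X k)) (R (u k))                     ≡⟨ det-⊕ˡ (w 0) (R (X k)) (R (u k)) ⟩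
              det (w 0) (R (u k)) + det (R (X k)) (R (u k))     ≡⟨ cong (_+_ (det (w 0) (R (u k)))) (det-rots j₀ (X k) (u k)) ⟩
              det (w 0) (R (u k)) + det (X k) (u k)             ∎

          X-n : X n ≡ origin
          X-n = trans (cong (_⊖ W k₀) (trans (cong W (ℕ.+-comm n k₀)) (W-periodic k₀))) X-zero

          w-closes : w n ≡ w 0
          w-closes = trans (position n ℕ.≤-refl)
            (trans (cong (w 0 ⊕_) (trans (cong (rots j₀) X-n) (rots-origin j₀))) (⊕-origin (w 0)))

          area-invariant : sixTimesSignedArea n w ≡ area n
          area-invariant = begin
            sixTimesSignedArea n w
              ≡⟨ area-w n ℕ.≤-refl ⟩
            swept n
              ≡⟨ cong₂ (λ p q → (det (w 0) p + (area (n ℕ.+ k₀) - area k₀)) + det (neg (W k₀)) q)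
                   (trans (cong (rots j₀) X-n) (rots-origin j₀)) X-n ⟩
            (det (w 0) origin + (area (n ℕ.+ k₀) - area k₀)) + det (neg (W k₀)) origin
              ≡⟨ cong₂ (λ p q → (p + (area (n ℕ.+ k₀) - area k₀)) + q) (det-origin (w 0)) (det-origin (neg (W k₀))) ⟩
            (+ 0 + (area (n ℕ.+ k₀) - area k₀)) + + 0
              ≡⟨ cong (λ z → (+ 0 + (z - area k₀)) + + 0) (trans (cong area (ℕ.+-comm n k₀)) (area-periodic k₀)) ⟩
            (+ 0 + ((area k₀ + area n) - area k₀)) + + 0
              ≡⟨ h (area k₀) (area n) ⟩
            area n ∎
            where
            open ≡-Reasoning
            h : ∀ x y → (+ 0 + ((x + y) - x)) + + 0 ≡ y
            h = solve-∀

        track : ∀ n' v → BoundaryPath a b n' v → ∀ δ → Boundary δ → tail δ ≡ v 0 → head δ ≡ v 1 →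
                ∀ k → k ℕ.< n' → tail (walk k δ) ≡ v k × head (walk k δ) ≡ v (suc k)
        track n' v bp δ bd t h zero    lt = t , h
        track n' v bp δ bd t h (suc k) lt
          with edge⇒dart (v (suc k)) (v (suc (suc k))) (proj₁ (proj₂ (proj₂ (proj₂ bp))) (suc k) lt)
             | track n' v bp δ bd t h k (ℕ.<-trans (ℕ.n<1+n k) lt)
        ... | δ' , bd' , t' , h' | _ , h'' =
          subst (λ δ' → tail δ' ≡ v (suc k) × head δ' ≡ v (suc (suc k)))
            (step-unique (walk k δ) δ' (walk-boundary k δ bd) bd' (trans h'' (sym t'))) (t' , h')

        rigidity : ∀ n' v w → BoundaryPath a b n' v → Shadows n' v w →
                   w n' ≡ w 0 × sixTimesSignedArea n' w ≡ area n
        rigidity zero v w (() , _) sh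
        rigidity n'@(suc m') v w bp@(_ , v₀ , vc , es , inj , _) sh
          with edge⇒dart (v 0) (v 1) (es 0 (ℕ.s≤s ℕ.z≤n))
        ... | δ , bd , t , h with on-loop δ bd
        ...   | k₀ , refl with ℕ.<-cmp n' n
        ...     | tri< lt _ _ = contradiction
                    (walk-injective k₀ (walk n' δ₀) δ₀ (loop-boundary n') start
                      (trans (walk-comm k₀ n' δ₀) (sym period))) (minimal n' (ℕ.s≤s ℕ.z≤n) lt)
          where
          period : loop k₀ ≡ walk n' (loop k₀)
          period = step-unique (walk m' (loop k₀)) (loop k₀) (walk-boundary m' (loop k₀) bd) bd
            (trans (proj₂ (track n' v bp (loop k₀) bd t h m' ℕ.≤-refl)) (trans vc (sym t)))
        ...     | tri> _ _ gt = contradiction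
                    (inj n 0 gt (ℕ.s≤s ℕ.z≤n)
                      (trans (sym (proj₁ tn)) (trans (cong tail (walk-n k₀)) t))
                      (trans (sym (proj₂ tn)) (trans (cong head (walk-n k₀)) h)))
                    (λ ())
          where
          tn : tail (walk n (loop k₀)) ≡ v n × head (walk n (loop k₀)) ≡ v (suc n)
          tn = track n' v bp (loop k₀) bd t h n gt
        ...     | tri≈ _ refl _ = w-closes , area-invariant
          where
          open Tracked v w k₀ v₀ (λ k lt →
            subst (λ δ → tail δ ≡ v k × head δ ≡ v (suc k)) (sym (walk-+ k k₀ δ₀))
              (track n v bp (loop k₀) bd t h k lt)) sh

-- Cells cut out by linear inequalities, and symbolic verification of boundary words

-- A cell centre (x , y) has coordinates y, -x, x - y of sum zero; the cell lies in the
-- (a,b)-benzel when they all lie between -B and A, where A = a - 1 and B = b - 1.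

slacks : ℤ → ℤ → Pt → List ℤ
slacks A B (x , y) =
  (A - y) ∷ (B + y) ∷ (A + x) ∷ (B - x) ∷ (A - (x - y)) ∷ (B + (x - y)) ∷ []

Region : ℤ → ℤ → Pt → Set
Region A B α = All (+ 0 ≤_) (slacks A B α)

region? : ∀ A B α → Dec (Region A B α)
region? A B α = all? (+ 0 ℤ.≤?_) (slacks A B α)

region-rot : ∀ A B α → Region A B α → Region A B (rot α)
region-rot A B (x , y) (a ∷ b ∷ c ∷ d ∷ e ∷ f ∷ []) =
  e ∷ f ∷ subst (+ 0 ≤_) refl a ∷ subst (+ 0 ≤_) (h₁ B y) b ∷
  subst (+ 0 ≤_) (h₂ A x y) c ∷ subst (+ 0 ≤_) (h₃ B x y) d ∷ []
  where
  h₁ : ∀ B y → B + y ≡ B - (- y)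
  h₁ = solve-∀
  h₂ : ∀ A x y → A + x ≡ A - ((- y) - (x - y))
  h₂ = solve-∀
  h₃ : ∀ B x y → B - x ≡ B + ((- y) - (x - y))
  h₃ = solve-∀

-- (c , p , q , r) stands for the affine form c + p s + q t + r i.
Lin : Set
Lin = ℤ × ℤ × ℤ × ℤ

Env : Set
Env = ℤ × ℤ × ℤ

⟦_⟧ˡ : Lin → Env → ℤ
⟦ c , p , q , r ⟧ˡ (s , t , i) = c + (p * s + (q * t + r * i))

const : ℤ → Lin
const c = (c , + 0 , + 0 , + 0)

infixl 6 _⊞_ _⊟_
infixl 7 _·_

_⊞_ _⊟_ : Lin → Lin → Lin
(c , p , q , r) ⊞ (c' , p' , q' , r') = (c + c' , p + p' , q + q' , r + r')
(c , p , q , r) ⊟ (c' , p' , q' , r') = (c - c' , p - p' , q - q' , r - r')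

_·_ : ℤ → Lin → Lin
k · (c , p , q , r) = (k * c , k * p , k * q , k * r)

⟦⊞⟧ : ∀ l l' ρ → ⟦ l ⊞ l' ⟧ˡ ρ ≡ ⟦ l ⟧ˡ ρ + ⟦ l' ⟧ˡ ρ
⟦⊞⟧ (c , p , q , r) (c' , p' , q' , r') (s , t , i) = h c p q r c' p' q' r' s t i
  where
  h : ∀ c p q r c' p' q' r' s t i →
      (c + c') + ((p + p') * s + ((q + q') * t + (r + r') * i)) ≡
      (c + (p * s + (q * t + r * i))) + (c' + (p' * s + (q' * t + r' * i)))
  h = solve-∀

⟦⊟⟧ : ∀ l l' ρ → ⟦ l ⊟ l' ⟧ˡ ρ ≡ ⟦ l ⟧ˡ ρ - ⟦ l' ⟧ˡ ρ
⟦⊟⟧ (c , p , q , r) (c' , p' , q' , r') (s , t , i) = h c p q r c' p' q' r' s t i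
  where
  h : ∀ c p q r c' p' q' r' s t i →
      (c - c') + ((p - p') * s + ((q - q') * t + (r - r') * i)) ≡
      (c + (p * s + (q * t + r * i))) - (c' + (p' * s + (q' * t + r' * i)))
  h = solve-∀

⟦·⟧ : ∀ k l ρ → ⟦ k · l ⟧ˡ ρ ≡ k * ⟦ l ⟧ˡ ρ
⟦·⟧ k (c , p , q , r) (s , t , i) = h k c p q r s t i
  where
  h : ∀ k c p q r s t i → k * c + ((k * p) * s + ((k * q) * t + (k * r) * i)) ≡
      k * (c + (p * s + (q * t + r * i)))
  h = solve-∀

⟦const⟧ : ∀ c ρ → ⟦ const c ⟧ˡ ρ ≡ c
⟦const⟧ c (s , t , i) = h c s t i
  where
  h : ∀ c s t i → c + (+ 0 * s + (+ 0 * t + + 0 * i)) ≡ c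
  h = solve-∀

Subst : Set
Subst = Lin × Lin × Lin

infixl 8 _[_]

_[_] : Lin → Subst → Lin
(c , p , q , r) [ S , T , I ] = const c ⊞ (p · S ⊞ (q · T ⊞ r · I))

⟦_⟧ˢ : Subst → Env → Env
⟦ S , T , I ⟧ˢ ρ = (⟦ S ⟧ˡ ρ , ⟦ T ⟧ˡ ρ , ⟦ I ⟧ˡ ρ)

⟦[]⟧ : ∀ l σ ρ → ⟦ l [ σ ] ⟧ˡ ρ ≡ ⟦ l ⟧ˡ (⟦ σ ⟧ˢ ρ)
⟦[]⟧ (c , p , q , r) (S , T , I) ρ =
  trans (⟦⊞⟧ (const c) (p · S ⊞ (q · T ⊞ r · I)) ρ) (cong₂ _+_ (⟦const⟧ c ρ)
    (trans (⟦⊞⟧ (p · S) (q · T ⊞ r · I) ρ) (cong₂ _+_ (⟦·⟧ p S ρ)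
      (trans (⟦⊞⟧ (q · T) (r · I) ρ) (cong₂ _+_ (⟦·⟧ q T ρ) (⟦·⟧ r I ρ))))))

data Nonneg : Env → Set where
  nonneg : ∀ s t i → Nonneg (+ s , + t , + i)

nonneg? : Lin → Bool
nonneg? (c , p , q , r) = (+ 0 ≤ᵇ c) ∧ ((+ 0 ≤ᵇ p) ∧ ((+ 0 ≤ᵇ q) ∧ (+ 0 ≤ᵇ r)))

∧-fst : ∀ {x y} → T (x ∧ y) → T x
∧-fst {true} _ = tt

∧-snd : ∀ {x y} → T (x ∧ y) → T y
∧-snd {true} p = p

0≤+ : ∀ {x y} → + 0 ≤ x → + 0 ≤ y → + 0 ≤ x + y
0≤+ = ℤ.+-mono-≤

0≤* : ∀ p s → T (+ 0 ≤ᵇ p) → + 0 ≤ p * + s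
0≤* (+ p) s _ = subst (+ 0 ≤_) (ℤ.pos-* p s) (+≤+ ℕ.z≤n)

nonneg?-sound : ∀ l → T (nonneg? l) → ∀ {ρ} → Nonneg ρ → + 0 ≤ ⟦ l ⟧ˡ ρ
nonneg?-sound (c , p , q , r) ok (nonneg s t i) =
  0≤+ (ℤ.≤ᵇ⇒≤ {+ 0} {c} (∧-fst {+ 0 ≤ᵇ c} ok)) (0≤+ (0≤* p s (∧-fst (∧-snd {+ 0 ≤ᵇ c} ok)))
    (0≤+ (0≤* q t (∧-fst (∧-snd {+ 0 ≤ᵇ p} (∧-snd {+ 0 ≤ᵇ c} ok))))
      (0≤* r i (∧-snd {+ 0 ≤ᵇ q} (∧-snd {+ 0 ≤ᵇ p} (∧-snd {+ 0 ≤ᵇ c} ok))))))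

negative? : Lin → Bool
negative? l = nonneg? (const (- + 1) ⊟ l)

negative?-sound : ∀ l → T (negative? l) → ∀ {ρ} → Nonneg ρ → ¬ (+ 0 ≤ ⟦ l ⟧ˡ ρ)
negative?-sound l ok {ρ} nn 0≤l = contradiction
  (subst (+ 0 ≤_) (trans (⟦⊟⟧ (const (- + 1)) l ρ) (cong (_- ⟦ l ⟧ˡ ρ) (⟦const⟧ (- + 1) ρ)))
    (nonneg?-sound (const (- + 1) ⊟ l) ok nn))
  (h 0≤l)
  where
  h : ∀ {z} → + 0 ≤ z → ¬ (+ 0 ≤ - + 1 - z)
  h {+ zero}  _ ()
  h {+ suc n} _ ()

LPt LDart : Set
LPt   = Lin × Lin
LDart = LPt × Dir

⟦_⟧ᵖ : LPt → Env → Pt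
⟦ x , y ⟧ᵖ ρ = (⟦ x ⟧ˡ ρ , ⟦ y ⟧ˡ ρ)

⟦_⟧ᵈ : LDart → Env → Dart
⟦ α , d ⟧ᵈ ρ = (⟦ α ⟧ᵖ ρ , d)

_[_]ᵈ : LDart → Subst → LDart
((x , y) , d) [ σ ]ᵈ = ((x [ σ ] , y [ σ ]) , d)

⟦[]⟧ᵈ : ∀ δ σ ρ → ⟦ δ [ σ ]ᵈ ⟧ᵈ ρ ≡ ⟦ δ ⟧ᵈ (⟦ σ ⟧ˢ ρ)
⟦[]⟧ᵈ ((x , y) , d) σ ρ = cong (_, d) (cong₂ _,_ (⟦[]⟧ x σ ρ) (⟦[]⟧ y σ ρ))

lslacks : Lin → Lin → LPt → List Lin
lslacks A B (x , y) =
  (A ⊟ y) ∷ (B ⊞ y) ∷ (A ⊞ x) ∷ (B ⊟ x) ∷ (A ⊟ (x ⊟ y)) ∷ (B ⊞ (x ⊟ y)) ∷ []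

⟦lslacks⟧ : ∀ A B α ρ → map (λ l → ⟦ l ⟧ˡ ρ) (lslacks A B α) ≡ slacks (⟦ A ⟧ˡ ρ) (⟦ B ⟧ˡ ρ) (⟦ α ⟧ᵖ ρ)
⟦lslacks⟧ A B (x , y) ρ =
  cong₂ _∷_ (⟦⊟⟧ A y ρ) (cong₂ _∷_ (⟦⊞⟧ B y ρ) (cong₂ _∷_ (⟦⊞⟧ A x ρ) (cong₂ _∷_ (⟦⊟⟧ B x ρ)
    (cong₂ _∷_ (trans (⟦⊟⟧ A (x ⊟ y) ρ) (cong (_-_ (⟦ A ⟧ˡ ρ)) (⟦⊟⟧ x y ρ)))
      (cong₂ _∷_ (trans (⟦⊞⟧ B (x ⊟ y) ρ) (cong (_+_ (⟦ B ⟧ˡ ρ)) (⟦⊟⟧ x y ρ))) refl)))))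

lfront : LDart → LPt
lfront ((x , y) , d) = (x ⊞ const (proj₁ (ahead d)) , y ⊞ const (proj₂ (ahead d)))

lmove : Turn → LDart → LDart
lmove left  (α , d) = (α , turn left d)
lmove right δ       = (lfront δ , turn right (proj₂ δ))

lmoves : List Turn → LDart → LDart
lmoves []       δ = δ
lmoves (t ∷ ts) δ = lmoves ts (lmove t δ)

lrot : LDart → LDart
lrot ((x , y) , d) = ((const (+ 0) ⊟ y , x ⊟ y) , spin d)

⟦lfront⟧ : ∀ δ ρ → ⟦ lfront δ ⟧ᵖ ρ ≡ front (⟦ δ ⟧ᵈ ρ)
⟦lfront⟧ ((x , y) , d) ρ = cong₂ _,_
  (trans (⟦⊞⟧ x (const (proj₁ (ahead d))) ρ) (cong (_+_ (⟦ x ⟧ˡ ρ)) (⟦const⟧ (proj₁ (ahead d)) ρ)))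
  (trans (⟦⊞⟧ y (const (proj₂ (ahead d))) ρ) (cong (_+_ (⟦ y ⟧ˡ ρ)) (⟦const⟧ (proj₂ (ahead d)) ρ)))

⟦lmove⟧ : ∀ t δ ρ → ⟦ lmove t δ ⟧ᵈ ρ ≡ move t (⟦ δ ⟧ᵈ ρ)
⟦lmove⟧ left  (α , d) ρ = refl
⟦lmove⟧ right δ       ρ = cong (_, turn right (proj₂ δ)) (⟦lfront⟧ δ ρ)

⟦lrot⟧ : ∀ δ ρ → ⟦ lrot δ ⟧ᵈ ρ ≡ rotD (⟦ δ ⟧ᵈ ρ)
⟦lrot⟧ ((x , y) , d) ρ = cong (_, spin d) (cong₂ _,_
  (trans (⟦⊟⟧ (const (+ 0)) y ρ) (trans (cong (_- ⟦ y ⟧ˡ ρ) (⟦const⟧ (+ 0) ρ)) (ℤ.+-identityˡ (- ⟦ y ⟧ˡ ρ))))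
  (⟦⊟⟧ x y ρ))

_≟ᴰ_ : DecidableEquality Dir
d ≟ᴰ d' = map′ (unit-injective {d} {d'}) (cong unit) (≡-dec ℤ._≟_ ℤ._≟_ (unit d) (unit d'))

_≟ˡ_ : DecidableEquality Lin
_≟ˡ_ = ≡-dec ℤ._≟_ (≡-dec ℤ._≟_ (≡-dec ℤ._≟_ ℤ._≟_))

_≟ᵈ_ : DecidableEquality LDart
_≟ᵈ_ = ≡-dec (≡-dec _≟ˡ_ _≟ˡ_) _≟ᴰ_

-- The result is nothing if the signs of the coefficients do not decide whether the cell ahead is inside.
lturn : Lin → Lin → LDart → Maybe Turn
lturn A B δ = if all nonneg? S then just right else if any negative? S then just left else nothing
  where
  S : List Lin
  S = lslacks A B (lfront δ)

definite? : Lin → Bool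
definite? l = negative? l ∨ negative? (const (+ 0) ⊟ l)

definite?-sound : ∀ l → T (definite? l) → ∀ {ρ} → Nonneg ρ → ⟦ l ⟧ˡ ρ ≢ + 0
definite?-sound l ok {ρ} nn e with Equivalence.to T-∨ ok
... | inj₁ p = negative?-sound l p nn (subst (+ 0 ≤_) (sym e) (+≤+ ℕ.z≤n))
... | inj₂ p = negative?-sound (const (+ 0) ⊟ l) p nn
  (subst (+ 0 ≤_) (sym (trans (⟦⊟⟧ (const (+ 0)) l ρ) (cong₂ _-_ (⟦const⟧ (+ 0) ρ) e))) (+≤+ ℕ.z≤n))

apart? : LDart → LDart → Bool
apart? ((x , y) , d) ((x' , y') , d') = not ⌊ d ≟ᴰ d' ⌋ ∨ (definite? (x ⊟ x') ∨ definite? (y ⊟ y'))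

apart?-sound : ∀ δ ε → T (apart? δ ε) → ∀ {ρ} → Nonneg ρ → ⟦ δ ⟧ᵈ ρ ≢ ⟦ ε ⟧ᵈ ρ
apart?-sound ((x , y) , d) ((x' , y') , d') ok {ρ} nn e with d ≟ᴰ d'
... | no ¬p = ¬p (cong proj₂ e)
... | yes _ with Equivalence.to T-∨ ok
...   | inj₁ p = definite?-sound (x ⊟ x') p nn
  (trans (⟦⊟⟧ x x' ρ) (ℤ.i≡j⇒i-j≡0 (cong (λ δ → proj₁ (proj₁ δ)) e)))
...   | inj₂ p = definite?-sound (y ⊟ y') p nn
  (trans (⟦⊟⟧ y y' ρ) (ℤ.i≡j⇒i-j≡0 (cong (λ δ → proj₂ (proj₁ δ)) e)))

isJust? : Turn → Maybe Turn → Bool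
isJust? left  (just left)  = true
isJust? right (just right) = true
isJust? _     _            = false

isJust?-sound : ∀ t m → T (isJust? t m) → m ≡ just t
isJust?-sound left  (just left)  _ = refl
isJust?-sound right (just right) _ = refl

follows? : Lin → Lin → List LDart → List Turn → LDart → Bool
follows? A B marks []       δ = true
follows? A B marks (t ∷ ts) δ =
  isJust? t (lturn A B δ) ∧ (all (apart? (lmove t δ)) marks ∧ follows? A B marks ts (lmove t δ))

among? : List LDart → LDart → Bool
among? targets δ = any (λ ε → ⌊ δ ≟ᵈ ε ⌋) targets

mutual
  search? : ℕ → Lin → Lin → List LDart → LDart → Bool
  search? zero    A B targets δ = among? targets δ
  search? (suc k) A B targets δ = among? targets δ ∨ resume? k A B targets δ (lturn A B δ)

  resume? : ℕ → Lin → Lin → List LDart → LDart → Maybe Turn → Bool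
  resume? k A B targets δ (just t) = search? k A B targets (lmove t δ)
  resume? k A B targets δ nothing  = false

module Symbolic (A B : ℤ) where

  open Walk (Region A B) (region? A B) (region-rot A B) public

  module _ (SA SB : Lin) {ρ : Env} (nn : Nonneg ρ) (eA : ⟦ SA ⟧ˡ ρ ≡ A) (eB : ⟦ SB ⟧ˡ ρ ≡ B) where

    slacks-front : ∀ δ → map (λ l → ⟦ l ⟧ˡ ρ) (lslacks SA SB (lfront δ)) ≡ slacks A B (front (⟦ δ ⟧ᵈ ρ))
    slacks-front δ = trans (⟦lslacks⟧ SA SB (lfront δ) ρ)
      (trans (cong₂ (λ A B → slacks A B (⟦ lfront δ ⟧ᵖ ρ)) eA eB) (cong (slacks A B) (⟦lfront⟧ δ ρ)))

    lturn-sound : ∀ δ t → lturn SA SB δ ≡ just t → turnAt (⟦ δ ⟧ᵈ ρ) ≡ t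
    lturn-sound δ t e with all nonneg? (lslacks SA SB (lfront δ)) in eq₁
    lturn-sound δ t refl | true = turnAt-right (⟦ δ ⟧ᵈ ρ) (subst (All (+ 0 ≤_)) (slacks-front δ)
      (All.map⁺ (All.map (λ {l} p → nonneg?-sound l p nn)
        (All.all⁺ nonneg? (lslacks SA SB (lfront δ)) (subst T (sym eq₁) tt)))))
    ... | false with any negative? (lslacks SA SB (lfront δ)) in eq₂
    lturn-sound δ t refl | false | true = turnAt-left (⟦ δ ⟧ᵈ ρ) λ i →
      All.Any¬⇒¬All (Any.map (λ {l} p → negative?-sound l p nn)
        (Any.any⁻ negative? (lslacks SA SB (lfront δ)) (subst T (sym eq₂) tt)))
        (All.map⁻ (subst (All (+ 0 ≤_)) (sym (slacks-front δ)) i))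

    Leads : Dart → List LDart → Set
    Leads δ targets = Any (λ ε → ∃ λ j → walk j δ ≡ ⟦ ε ⟧ᵈ ρ) targets

    among?-sound : ∀ targets δ → T (among? targets δ) → Leads (⟦ δ ⟧ᵈ ρ) targets
    among?-sound targets δ ok = Any.map (λ {ε} p → 0 , cong (λ δ → ⟦ δ ⟧ᵈ ρ) (toWitness {a? = δ ≟ᵈ ε} p))
      (Any.any⁻ (λ ε → ⌊ δ ≟ᵈ ε ⌋) targets ok)

    mutual
      search?-sound : ∀ k targets δ → T (search? k SA SB targets δ) → Leads (⟦ δ ⟧ᵈ ρ) targets
      search?-sound zero    targets δ ok = among?-sound targets δ ok
      search?-sound (suc k) targets δ ok with Equivalence.to (T-∨ {among? targets δ}) ok
      ... | inj₁ p = among?-sound targets δ p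
      ... | inj₂ p = resume?-sound k targets δ (lturn SA SB δ) refl p

      resume?-sound : ∀ k targets δ m → lturn SA SB δ ≡ m → T (resume? k SA SB targets δ m) →
                      Leads (⟦ δ ⟧ᵈ ρ) targets
      resume?-sound k targets δ (just t) e ok =
        Any.map (λ { {ε} (j , p) → suc j ,
            trans (walk-comm 1 j (⟦ δ ⟧ᵈ ρ)) (trans (cong (walk j)
              (trans (cong (λ t → move t (⟦ δ ⟧ᵈ ρ)) (lturn-sound δ t e)) (sym (⟦lmove⟧ t δ ρ)))) p) })
          (search?-sound k targets (lmove t δ) ok)

  data Follows (Marked : Dart → Set) : Dart → List Turn → Dart → Set where
    []   : ∀ {δ} → Follows Marked δ [] δ
    advance : ∀ {δ t ts ε} → turnAt δ ≡ t → ¬ Marked (move t δ) → Follows Marked (move t δ) ts ε →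
           Follows Marked δ (t ∷ ts) ε

  _++ᶠ_ : ∀ {M δ ε ζ ts us} → Follows M δ ts ε → Follows M ε us ζ → Follows M δ (ts ++ us) ζ
  []         ++ᶠ g = g
  advance e m f ++ᶠ g = advance e m (f ++ᶠ g)

  follows?-sound : ∀ SA SB {ρ} → Nonneg ρ → ⟦ SA ⟧ˡ ρ ≡ A → ⟦ SB ⟧ˡ ρ ≡ B →
    ∀ marks ts δ → T (follows? SA SB marks ts δ) →
    Follows (λ δ → Any (λ μ → δ ≡ ⟦ μ ⟧ᵈ ρ) marks) (⟦ δ ⟧ᵈ ρ) ts (⟦ lmoves ts δ ⟧ᵈ ρ)
  follows?-sound SA SB nn eA eB marks []       δ ok = []
  follows?-sound SA SB {ρ} nn eA eB marks (t ∷ ts) δ ok =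
    advance (lturn-sound SA SB nn eA eB δ t (isJust?-sound t (lturn SA SB δ) (∧-fst ok)))
      (subst (λ ε → ¬ Any (λ μ → ε ≡ ⟦ μ ⟧ᵈ ρ) marks) (⟦lmove⟧ t δ ρ)
        (All.All¬⇒¬Any (All.map (λ {μ} p → apart?-sound (lmove t δ) μ p nn)
          (All.all⁺ (apart? (lmove t δ)) marks (∧-fst (∧-snd {isJust? t (lturn SA SB δ)} ok))))))
      (subst (λ ε → Follows _ ε ts (⟦ lmoves ts (lmove t δ) ⟧ᵈ ρ)) (⟦lmove⟧ t δ ρ)
        (follows?-sound SA SB nn eA eB marks ts (lmove t δ)
          (∧-snd {all (apart? (lmove t δ)) marks} (∧-snd {isJust? t (lturn SA SB δ)} ok))))

-- The three families of benzels

-- With A = a - 1 and B = b - 1, the generic benzels of class 1, 0, -1 are those with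
-- A = s + 2t + κ and B = 2s + t + κ for natural numbers s, t and κ = 1, 2, 3 respectively.
κ : Cls → ℕ
κ c1  = 1
κ c0  = 2
κ c-1 = 3

upper lower : Cls → Lin
upper c = (+ κ c , + 1 , + 2 , + 0)
lower c = (+ κ c , + 2 , + 1 , + 0)

data Depth : Set where
  outer inner : Depth

depth : Depth → ℕ
depth outer = 0
depth inner = 1

-- The cells at the given depth below a side have their i-th member at distance
-- offset + 3i from its end; wide rows have one more member than the number of periods of the side.
record Row : Set where
  constructor row
  field
    offset  : ℕ
    wide    : Bool
    carry   : ℕ
    surplus : ℕ
open Row

top bottom : Cls → Depth → Row
top c1  outer = row 0 false 1 1
top c1  inner = row 2 false 0 2
top c0  outer = row 2 false 1 2
top c0  inner = row 1 false 1 0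
top c-1 outer = row 1 false 2 0
top c-1 inner = row 0 true  2 1
bottom c1  outer = row 1 false 0 2
bottom c1  inner = row 0 false 0 0
bottom c0  outer = row 0 false 1 0
bottom c0  inner = row 2 false 0 1
bottom c-1 outer = row 2 false 1 1
bottom c-1 inner = row 1 true  1 2

bit : Bool → ℕ
bit false = 0
bit true  = 1

top-carry : ∀ c e → 2 ℕ.* κ c ℕ.+ 1 ≡ offset (top c e) ℕ.+ 3 ℕ.* carry (top c e) ℕ.+ depth e
top-carry c0  outer = refl
top-carry c0  inner = refl
top-carry c1  outer = refl
top-carry c1  inner = refl
top-carry c-1 outer = refl
top-carry c-1 inner = refl

bottom-carry : ∀ c e → 2 ℕ.* κ c ≡ offset (bottom c e) ℕ.+ 3 ℕ.* carry (bottom c e) ℕ.+ depth e ℕ.+ 1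
bottom-carry c0  outer = refl
bottom-carry c0  inner = refl
bottom-carry c1  outer = refl
bottom-carry c1  inner = refl
bottom-carry c-1 outer = refl
bottom-carry c-1 inner = refl

top-surplus : ∀ c e → offset (top c e) ℕ.+ 3 ℕ.* bit (wide (top c e)) ℕ.+ 2 ≡ κ c ℕ.+ depth e ℕ.+ surplus (top c e)
top-surplus c0  outer = refl
top-surplus c0  inner = refl
top-surplus c1  outer = refl
top-surplus c1  inner = refl
top-surplus c-1 outer = refl
top-surplus c-1 inner = refl

bottom-surplus : ∀ c e → offset (bottom c e) ℕ.+ 3 ℕ.* bit (wide (bottom c e)) ℕ.+ 2 ≡ κ c ℕ.+ depth e ℕ.+ surplus (bottom c e)
bottom-surplus c0  outer = refl
bottom-surplus c0  inner = refl
bottom-surplus c1  outer = refl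
bottom-surplus c1  inner = refl
bottom-surplus c-1 outer = refl
bottom-surplus c-1 inner = refl

offset<3 : ∀ c e → offset (top c e) ℕ.< 3 × offset (bottom c e) ℕ.< 3
offset<3 c0  outer = ℕ.≤ᵇ⇒≤ _ _ tt , ℕ.≤ᵇ⇒≤ _ _ tt
offset<3 c0  inner = ℕ.≤ᵇ⇒≤ _ _ tt , ℕ.≤ᵇ⇒≤ _ _ tt
offset<3 c1  outer = ℕ.≤ᵇ⇒≤ _ _ tt , ℕ.≤ᵇ⇒≤ _ _ tt
offset<3 c1  inner = ℕ.≤ᵇ⇒≤ _ _ tt , ℕ.≤ᵇ⇒≤ _ _ tt
offset<3 c-1 outer = ℕ.≤ᵇ⇒≤ _ _ tt , ℕ.≤ᵇ⇒≤ _ _ tt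
offset<3 c-1 inner = ℕ.≤ᵇ⇒≤ _ _ tt , ℕ.≤ᵇ⇒≤ _ _ tt

variable-s variable-t variable-i : Lin
variable-s = (+ 0 , + 1 , + 0 , + 0)
variable-t = (+ 0 , + 0 , + 1 , + 0)
variable-i = (+ 0 , + 0 , + 0 , + 1)

topDart bottomDart : Cls → Depth → Dir → LDart
topDart c e d =
  ((lower c ⊟ const (+ offset (top c e)) ⊟ + 3 · variable-i , upper c ⊟ const (+ depth e)) , d)
bottomDart c e d =
  ((const (+ offset (bottom c e)) ⊟ upper c ⊞ + 3 · variable-i , const (+ depth e) ⊟ lower c) , d)

-- A third of the boundary, from the right end of the top side to the rotated position.  The left turn
-- ending the second corner is omitted, because it leads to a marked dart.
block₁ block₂ corner₁ corner₂ : Cls → List Turn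
block₁ _   = right ∷ right ∷ left ∷ left ∷ []
block₂ c1  = left ∷ left ∷ right ∷ right ∷ []
block₂ _   = right ∷ right ∷ left ∷ left ∷ []
corner₁ c1  = right ∷ []
corner₁ c0  = left ∷ []
corner₁ c-1 = right ∷ left ∷ right ∷ left ∷ left ∷ []
corner₂ c1  = left ∷ left ∷ []
corner₂ c0  = right ∷ left ∷ right ∷ left ∷ []
corner₂ c-1 = right ∷ left ∷ []

side₁ side₂ : Cls → LDart
side₁ c = topDart c outer (fwd x2)
side₂ c = ((proj₁ (proj₁ end) ⊟ + 3 · variable-i , proj₂ (proj₁ end) ⊟ + 3 · variable-i) , proj₂ end)
  where
  end : LDart
  end = lmoves (corner₁ c) (side₁ c [ variable-s , variable-t , variable-s ]ᵈ)

-- The starting dart and its rotations: meeting them only at the ends of the three thirds, the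
-- boundary word does not close up early.
marks : Cls → List LDart
marks c = side₁ c ∷ lrot (side₁ c) ∷ lrot (lrot (side₁ c)) ∷ []

-- In the checks below the three variables are nonnegative integers u, v, w; a side of length s
-- is examined at its i-th period with s = u + v + 1, i = u, or at its end, with s = i = u.
u u+1 u+v+1 w : Lin
u     = variable-s
u+1   = u ⊞ const (+ 1)
u+v+1 = u ⊞ variable-t ⊞ const (+ 1)
w     = variable-i

o : Lin
o = const (+ 0)

run? : Cls → Lin → Lin → LDart → List Turn → LDart → Bool
run? c S T δ ts ε =
  follows? (upper c [ S , T , o ]) (lower c [ S , T , o ]) (map _[ S , T , o ]ᵈ (marks c)) ts δ
    ∧ ⌊ lmoves ts δ ≟ᵈ ε ⌋

block₁-runs : ∀ c → T (run? c u+v+1 w (side₁ c [ u+v+1 , w , u ]ᵈ) (block₁ c) (side₁ c [ u+v+1 , w , u+1 ]ᵈ))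
block₁-runs c0  = tt
block₁-runs c1  = tt
block₁-runs c-1 = tt

corner₁-runs : ∀ c → T (run? c u w (side₁ c [ u , w , u ]ᵈ) (corner₁ c) (side₂ c [ u , w , o ]ᵈ))
corner₁-runs c0  = tt
corner₁-runs c1  = tt
corner₁-runs c-1 = tt

block₂-runs : ∀ c → T (run? c w u+v+1 (side₂ c [ w , u+v+1 , u ]ᵈ) (block₂ c) (side₂ c [ w , u+v+1 , u+1 ]ᵈ))
block₂-runs c0  = tt
block₂-runs c1  = tt
block₂-runs c-1 = tt

last : Cls → LDart
last c = lmoves (corner₂ c) (side₂ c [ w , u , u ]ᵈ)

corner₂-runs : ∀ c → T (run? c w u (side₂ c [ w , u , u ]ᵈ) (corner₂ c) (last c))
corner₂-runs c0  = tt
corner₂-runs c1  = tt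
corner₂-runs c-1 = tt

last-turn : ∀ c → lturn (upper c [ w , u , o ]) (lower c [ w , u , o ]) (last c) ≡ just left
last-turn c0  = refl
last-turn c1  = refl
last-turn c-1 = refl

last-move : ∀ c → lmove left (last c) ≡ lrot (side₁ c) [ w , u , o ]ᵈ
last-move c0  = refl
last-move c1  = refl
last-move c-1 = refl

leads? : Cls → Lin → Lin → List LDart → LDart → Bool
leads? c S T targets δ = search? 8 (upper c [ S , T , o ]) (lower c [ S , T , o ]) targets δ

when : Bool → Bool → Bool
when false _ = true
when true  b = b

topTargets bottomTargets : Cls → Lin → Lin → List LDart
topTargets c S I    = side₁ c [ S , w , I ]ᵈ ∷ side₂ c [ S , w , o ]ᵈ ∷ []
bottomTargets c T I = lrot (side₂ c) [ w , T , I ]ᵈ ∷ lrot (lrot (side₁ c)) [ w , T , o ]ᵈ ∷ []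

top? : Cls → Depth → Dir → Bool
top? c e d =
  (leads? c u+v+1 w (topTargets c u+v+1 u ++ topTargets c u+v+1 u+1) (topDart c e d [ u+v+1 , w , u ]ᵈ)
  ∧ leads? c u w (topTargets c u u) (topDart c e d [ u , w , u ]ᵈ))
  ∧ when (wide (top c e)) (leads? c u w (topTargets c u u) (topDart c e d [ u , w , u+1 ]ᵈ))

bottom? : Cls → Depth → Dir → Bool
bottom? c e d =
  (leads? c w u+v+1 (bottomTargets c u+v+1 u ++ bottomTargets c u+v+1 u+1) (bottomDart c e d [ w , u+v+1 , u ]ᵈ)
  ∧ leads? c w u (bottomTargets c u u) (bottomDart c e d [ w , u , u ]ᵈ))
  ∧ when (wide (bottom c e)) (leads? c w u (bottomTargets c u u) (bottomDart c e d [ w , u , u+1 ]ᵈ))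

data TopDir : Depth → Dir → Set where
  straight : ∀ {e} → TopDir e (bwd x0)
  falling  : TopDir outer (fwd x2)
  rising   : TopDir outer (fwd x1)

data BottomDir : Depth → Dir → Set where
  straight : ∀ {e} → BottomDir e (fwd x0)
  falling  : BottomDir outer (bwd x1)
  rising   : BottomDir outer (bwd x2)

top-leads : ∀ c {e d} → TopDir e d → T (top? c e d)
top-leads c0  {outer} straight = tt
top-leads c0  {inner} straight = tt
top-leads c0  falling = tt
top-leads c0  rising  = tt
top-leads c1  {outer} straight = tt
top-leads c1  {inner} straight = tt
top-leads c1  falling = tt
top-leads c1  rising  = tt
top-leads c-1 {outer} straight = tt
top-leads c-1 {inner} straight = tt
top-leads c-1 falling = tt
top-leads c-1 rising  = tt

bottom-leads : ∀ c {e d} → BottomDir e d → T (bottom? c e d)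
bottom-leads c0  {outer} straight = tt
bottom-leads c0  {inner} straight = tt
bottom-leads c0  falling = tt
bottom-leads c0  rising  = tt
bottom-leads c1  {outer} straight = tt
bottom-leads c1  {inner} straight = tt
bottom-leads c1  falling = tt
bottom-leads c1  rising  = tt
bottom-leads c-1 {outer} straight = tt
bottom-leads c-1 {inner} straight = tt
bottom-leads c-1 falling = tt
bottom-leads c-1 rising  = tt

-- The boundary word of a generic benzel

⟦u⟧ : ∀ x y z → ⟦ u ⟧ˡ (x , y , z) ≡ x
⟦u⟧ x y z = h x y z
  where
  h : ∀ x y z → + 0 + (+ 1 * x + (+ 0 * y + + 0 * z)) ≡ x
  h = solve-∀

⟦w⟧ : ∀ x y z → ⟦ w ⟧ˡ (x , y , z) ≡ z
⟦w⟧ x y z = h x y z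
  where
  h : ∀ x y z → + 0 + (+ 0 * x + (+ 0 * y + + 1 * z)) ≡ z
  h = solve-∀

⟦u+1⟧ : ∀ x y z → ⟦ u+1 ⟧ˡ (x , y , z) ≡ + 1 + x
⟦u+1⟧ x y z = h x y z
  where
  h : ∀ x y z → + 1 + (+ 1 * x + (+ 0 * y + + 0 * z)) ≡ + 1 + x
  h = solve-∀

⟦u+v+1⟧ : ∀ x y z → ⟦ u+v+1 ⟧ˡ (x , y , z) ≡ x + (+ 1 + y)
⟦u+v+1⟧ x y z = h x y z
  where
  h : ∀ x y z → + 1 + (+ 1 * x + (+ 1 * y + + 0 * z)) ≡ x + (+ 1 + y)
  h = solve-∀

slot : ∀ z (q : ℤ) f N (e : ℤ) → f ℕ.< 3 → + 0 ≤ z → + 0 ≤ e → z ≡ + f + + 3 * q → z + e ≡ + (f ℕ.+ 3 ℕ.* N ℕ.+ 2) →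
       ∃ λ i → i ℕ.≤ N × z ≡ + (f ℕ.+ 3 ℕ.* i)
slot z (+ i) f N (+ e) f<3 0≤z 0≤e refl bound =
  i , ℕ.<⇒≤pred (ℕ.*-cancelˡ-< 3 i (suc N) lt) , z≡
  where
  z≡ : + f + + 3 * + i ≡ + (f ℕ.+ 3 ℕ.* i)
  z≡ = cong (_+_ (+ f)) (sym (ℤ.pos-* 3 i))
  bound' : f ℕ.+ 3 ℕ.* i ℕ.+ e ≡ f ℕ.+ 3 ℕ.* N ℕ.+ 2
  bound' = ℤ.+-injective (trans (cong (_+ + e) (sym z≡)) bound)
  le : f ℕ.+ 3 ℕ.* i ℕ.≤ f ℕ.+ (3 ℕ.* N ℕ.+ 2)
  le = ℕ.≤-trans (ℕ.m≤m+n (f ℕ.+ 3 ℕ.* i) e) (ℕ.≤-reflexive (trans bound' (ℕ.+-assoc f (3 ℕ.* N) 2)))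
  lt : 3 ℕ.* i ℕ.< 3 ℕ.* suc N
  lt = ℕ.≤-trans (ℕ.s≤s (ℕ.+-cancelˡ-≤ f (3 ℕ.* i) (3 ℕ.* N ℕ.+ 2) le))
    (ℕ.≤-reflexive (trans (sym (ℕ.+-suc (3 ℕ.* N) 2)) (trans (ℕ.+-comm (3 ℕ.* N) 3) (sym (ℕ.*-suc 3 N)))))
slot z -[1+ k ] f N e f<3 0≤z 0≤e refl bound = contradiction 0≤z (ℤ.<⇒≱ (begin-strict
  + f + + 3 * -[1+ k ]   ≡⟨ h (+ f) (+ k) ⟩
  (+ f - + 3) - + 3 * + k ≤⟨ ℤ.+-monoʳ-≤ (+ f - + 3) (ℤ.neg-mono-≤ (subst (+ 0 ≤_) (ℤ.pos-* 3 k) (+≤+ ℕ.z≤n))) ⟩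
  (+ f - + 3) - + 0      ≡⟨ ℤ.+-identityʳ (+ f - + 3) ⟩
  + f - + 3              <⟨ ℤ.+-monoˡ-< (- + 3) (+<+ f<3) ⟩
  + 3 - + 3              ≡⟨⟩
  + 0                    ∎))
  where
  open ℤ.≤-Reasoning
  h : ∀ f k → f + + 3 * (- (+ 1 + k)) ≡ (f - + 3) - + 3 * k
  h = solve-∀

shallow₁ : ∀ z → + 0 ≤ z → ¬ (+ 0 ≤ z - + 1) → z ≡ + 0
shallow₁ (+ zero)  _ _ = refl
shallow₁ (+ suc n) _ ¬p = contradiction (+≤+ ℕ.z≤n) ¬p

shallow₂ : ∀ z → + 0 ≤ z → ¬ (+ 0 ≤ z - + 2) → ∃ λ e → z ≡ + depth e
shallow₂ (+ 0) _ _ = outer , refl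
shallow₂ (+ 1) _ _ = inner , refl
shallow₂ (+ suc (suc n)) _ ¬p = contradiction (+≤+ ℕ.z≤n) ¬p

module Assembled (c : Cls) (s t : ℕ) where

  A B : ℤ
  A = ⟦ upper c ⟧ˡ (+ s , + t , + 0)
  B = ⟦ lower c ⟧ˡ (+ s , + t , + 0)

  open Symbolic A B public

  at : LDart → ℕ → Dart
  at δ i = ⟦ δ ⟧ᵈ (+ s , + t , + i)

  Marked : Dart → Set
  Marked δ = Any (λ μ → δ ≡ at μ 0) (marks c)

  module Evaluate (S T′ : Lin) {ρ : Env} (nn : Nonneg ρ) (eS : ⟦ S ⟧ˡ ρ ≡ + s) (eT : ⟦ T′ ⟧ˡ ρ ≡ + t) where

    env : ∀ {I j} → ⟦ I ⟧ˡ ρ ≡ + j → ⟦ S , T′ , I ⟧ˢ ρ ≡ (+ s , + t , + j)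
    env eI = cong₂ _,_ eS (cong₂ _,_ eT eI)

    env-o : ⟦ S , T′ , o ⟧ˢ ρ ≡ (+ s , + t , + 0)
    env-o = env {o} {0} (⟦const⟧ (+ 0) ρ)

    at-[] : ∀ δ I j → ⟦ I ⟧ˡ ρ ≡ + j → ⟦ δ [ S , T′ , I ]ᵈ ⟧ᵈ ρ ≡ at δ j
    at-[] δ I j eI = trans (⟦[]⟧ᵈ δ (S , T′ , I) ρ) (cong ⟦ δ ⟧ᵈ (env {I} {j} eI))

    at-o : ∀ δ → ⟦ δ [ S , T′ , o ]ᵈ ⟧ᵈ ρ ≡ at δ 0
    at-o δ = at-[] δ o 0 (⟦const⟧ (+ 0) ρ)

    eA : ⟦ upper c [ S , T′ , o ] ⟧ˡ ρ ≡ A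
    eA = trans (⟦[]⟧ (upper c) (S , T′ , o) ρ) (cong ⟦ upper c ⟧ˡ env-o)

    eB : ⟦ lower c [ S , T′ , o ] ⟧ˡ ρ ≡ B
    eB = trans (⟦[]⟧ (lower c) (S , T′ , o) ρ) (cong ⟦ lower c ⟧ˡ env-o)

    MarkedHere : Dart → Set
    MarkedHere δ = Any (λ μ → δ ≡ ⟦ μ ⟧ᵈ ρ) (map _[ S , T′ , o ]ᵈ (marks c))

    marked-here : ∀ {δ} → Marked δ → MarkedHere δ
    marked-here (here e)                 = here (trans e (sym (at-o (side₁ c))))
    marked-here (there (here e))         = there (here (trans e (sym (at-o (lrot (side₁ c))))))
    marked-here (there (there (here e))) = there (there (here (trans e (sym (at-o (lrot (lrot (side₁ c))))))))

    weaken : ∀ {δ ts ε} → Follows MarkedHere δ ts ε → Follows Marked δ ts ε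
    weaken []              = []
    weaken (advance e m f) = advance e (λ n → m (marked-here n)) (weaken f)

    run-sound : ∀ δ ts ε → T (run? c S T′ δ ts ε) → Follows Marked (⟦ δ ⟧ᵈ ρ) ts (⟦ ε ⟧ᵈ ρ)
    run-sound δ ts ε ok = subst (λ ζ → Follows Marked (⟦ δ ⟧ᵈ ρ) ts (⟦ ζ ⟧ᵈ ρ))
      (toWitness {a? = lmoves ts δ ≟ᵈ ε} (∧-snd {follows? SA SB M ts δ} ok))
      (weaken (follows?-sound SA SB nn eA eB M ts δ (∧-fst ok)))
      where
      SA SB : Lin
      SA = upper c [ S , T′ , o ]
      SB = lower c [ S , T′ , o ]
      M : List LDart
      M = map _[ S , T′ , o ]ᵈ (marks c)

    leads-sound : ∀ targets δ → T (leads? c S T′ targets δ) →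
                  Any (λ ε → ∃ λ j → walk j (⟦ δ ⟧ᵈ ρ) ≡ ⟦ ε ⟧ᵈ ρ) targets
    leads-sound targets δ ok =
      search?-sound (upper c [ S , T′ , o ]) (lower c [ S , T′ , o ]) nn eA eB 8 targets δ ok

  split : ∀ i r n → i ℕ.+ suc r ≡ n → + i + (+ 1 + + r) ≡ + n
  split i r n e = cong +_ e

  runs₁ : ∀ r i → i ℕ.+ r ≡ s → Follows Marked (at (side₁ c) i) (repeat r (block₁ c)) (at (side₁ c) s)
  runs₁ zero i e = subst (λ j → Follows Marked (at (side₁ c) i) [] (at (side₁ c) j)) (trans (sym (ℕ.+-identityʳ i)) e) []
  runs₁ (suc r) i e =
    subst₂ (λ δ ε → Follows Marked δ (block₁ c) ε)
      (at-[] (side₁ c) u i (⟦u⟧ (+ i) (+ r) (+ t))) (at-[] (side₁ c) u+1 (suc i) (⟦u+1⟧ (+ i) (+ r) (+ t)))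
      (run-sound (side₁ c [ u+v+1 , w , u ]ᵈ) (block₁ c) (side₁ c [ u+v+1 , w , u+1 ]ᵈ) (block₁-runs c))
    ++ᶠ runs₁ r (suc i) (trans (sym (ℕ.+-suc i r)) e)
    where
    open Evaluate u+v+1 w (nonneg i r t)
      (trans (⟦u+v+1⟧ (+ i) (+ r) (+ t)) (split i r s e)) (⟦w⟧ (+ i) (+ r) (+ t))

  runs₂ : ∀ r i → i ℕ.+ r ≡ t → Follows Marked (at (side₂ c) i) (repeat r (block₂ c)) (at (side₂ c) t)
  runs₂ zero i e = subst (λ j → Follows Marked (at (side₂ c) i) [] (at (side₂ c) j)) (trans (sym (ℕ.+-identityʳ i)) e) []
  runs₂ (suc r) i e =
    subst₂ (λ δ ε → Follows Marked δ (block₂ c) ε)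
      (at-[] (side₂ c) u i (⟦u⟧ (+ i) (+ r) (+ s))) (at-[] (side₂ c) u+1 (suc i) (⟦u+1⟧ (+ i) (+ r) (+ s)))
      (run-sound (side₂ c [ w , u+v+1 , u ]ᵈ) (block₂ c) (side₂ c [ w , u+v+1 , u+1 ]ᵈ) (block₂-runs c))
    ++ᶠ runs₂ r (suc i) (trans (sym (ℕ.+-suc i r)) e)
    where
    open Evaluate w u+v+1 (nonneg i r s)
      (⟦w⟧ (+ i) (+ r) (+ s)) (trans (⟦u+v+1⟧ (+ i) (+ r) (+ s)) (split i r t e))

  turns-corner₁ : Follows Marked (at (side₁ c) s) (corner₁ c) (at (side₂ c) 0)
  turns-corner₁ = subst₂ (λ δ ε → Follows Marked δ (corner₁ c) ε)
    (at-[] (side₁ c) u s (⟦u⟧ (+ s) (+ 0) (+ t))) (at-o (side₂ c))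
    (run-sound (side₁ c [ u , w , u ]ᵈ) (corner₁ c) (side₂ c [ u , w , o ]ᵈ) (corner₁-runs c))
    where
    open Evaluate u w (nonneg s 0 t) (⟦u⟧ (+ s) (+ 0) (+ t)) (⟦w⟧ (+ s) (+ 0) (+ t))

  module End where
    open Evaluate w u (nonneg t 0 s) (⟦w⟧ (+ t) (+ 0) (+ s)) (⟦u⟧ (+ t) (+ 0) (+ s)) public

    ρ : Env
    ρ = (+ t , + 0 , + s)

    turns-corner₂ : Follows Marked (at (side₂ c) t) (corner₂ c) (⟦ last c ⟧ᵈ ρ)
    turns-corner₂ = subst (λ δ → Follows Marked δ (corner₂ c) (⟦ last c ⟧ᵈ ρ))
      (at-[] (side₂ c) u t (⟦u⟧ (+ t) (+ 0) (+ s))) (run-sound (side₂ c [ w , u , u ]ᵈ) (corner₂ c) (last c) (corner₂-runs c))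

    turns-left : turnAt (⟦ last c ⟧ᵈ ρ) ≡ left
    turns-left = lturn-sound (upper c [ w , u , o ]) (lower c [ w , u , o ]) (nonneg t 0 s) eA eB
      (last c) left (last-turn c)

    returns : move left (⟦ last c ⟧ᵈ ρ) ≡ rotD (at (side₁ c) 0)
    returns = trans (sym (⟦lmove⟧ left (last c) ρ))
      (trans (cong (λ δ → ⟦ δ ⟧ᵈ ρ) (last-move c)) (trans (at-o (lrot (side₁ c))) (⟦lrot⟧ (side₁ c) (+ s , + t , + 0))))

  open End using (turns-corner₂; turns-left; returns)

  δ₀ penultimate : Dart
  δ₀ = at (side₁ c) 0
  penultimate = ⟦ last c ⟧ᵈ End.ρ

  thirdWord : List Turn
  thirdWord = repeat s (block₁ c) ++ (corner₁ c ++ (repeat t (block₂ c) ++ corner₂ c))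

  from-side₂ : ∀ r i → i ℕ.+ r ≡ t → Follows Marked (at (side₂ c) i) (repeat r (block₂ c) ++ corner₂ c) penultimate
  from-side₂ r i e = runs₂ r i e ++ᶠ turns-corner₂

  from-side₁ : ∀ r i → i ℕ.+ r ≡ s → Follows Marked (at (side₁ c) i)
    (repeat r (block₁ c) ++ (corner₁ c ++ (repeat t (block₂ c) ++ corner₂ c))) penultimate
  from-side₁ r i e = runs₁ r i e ++ᶠ (turns-corner₁ ++ᶠ from-side₂ t 0 refl)

  third : Follows Marked δ₀ thirdWord penultimate
  third = from-side₁ s 0 refl

  walk-follows : ∀ {M δ ts ε} → Follows M δ ts ε → walk (length ts) δ ≡ ε
  walk-follows [] = refl
  walk-follows {M} {δ} {t ∷ ts} (advance e m f) =
    trans (walk-comm 1 (length ts) δ) (trans (cong (λ t → walk (length ts) (move t δ)) e) (walk-follows f))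

  unmarked : ∀ {M δ ts ε} → Follows M δ ts ε → ∀ j → j ℕ.< length ts → ¬ M (walk (suc j) δ)
  unmarked {M} {δ} (advance {t = t} e m f) zero    lt = subst (λ t → ¬ M (move t δ)) (sym e) m
  unmarked {M} {δ} (advance {t = t} e m f) (suc j) (ℕ.s≤s lt) =
    subst (λ ε → ¬ M ε) (trans (cong (λ t → walk (suc j) (move t δ)) (sym e)) (walk-comm (suc j) 1 δ)) (unmarked f j lt)

  marked₀ : Marked δ₀
  marked₀ = here refl

  rotD-marked : ∀ {δ} → Marked δ → Marked (rotD δ)
  rotD-marked (here e)                 = there (here (trans (cong rotD e) (sym (⟦lrot⟧ (side₁ c) (+ s , + t , + 0)))))
  rotD-marked (there (here e))         =
    there (there (here (trans (cong rotD e) (sym (⟦lrot⟧ (lrot (side₁ c)) (+ s , + t , + 0))))))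
  rotD-marked (there (there (here e))) = here (trans (cong rotD e)
    (trans (cong rotD (trans (⟦lrot⟧ (lrot (side₁ c)) (+ s , + t , + 0)) (cong rotD (⟦lrot⟧ (side₁ c) (+ s , + t , + 0)))))
      (rotD³ δ₀)))

  rotD-marked⁻¹ : ∀ {δ} → Marked (rotD δ) → Marked δ
  rotD-marked⁻¹ {δ} m = subst Marked (rotD³ δ) (rotD-marked (rotD-marked m))

  l M₃ : ℕ
  l  = length thirdWord
  M₃ = suc l

  walk-third : walk M₃ δ₀ ≡ rotD δ₀
  walk-third = trans (cong step (walk-follows third))
    (trans (cong (λ t → move t penultimate) turns-left) returns)

  walk-third′ : walk M₃ (rotD δ₀) ≡ rotD (rotD δ₀)
  walk-third′ = trans (walk-rotD M₃ δ₀) (cong rotD walk-third)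

  walk-third″ : walk M₃ (rotD (rotD δ₀)) ≡ δ₀
  walk-third″ = trans (walk-rotD M₃ (rotD δ₀)) (trans (cong rotD walk-third′) (rotD³ δ₀))

  m : ℕ
  m = l ℕ.+ (M₃ ℕ.+ M₃)

  walk-2M₃ : walk (M₃ ℕ.+ M₃) δ₀ ≡ rotD (rotD δ₀)
  walk-2M₃ = trans (walk-+ M₃ M₃ δ₀) (trans (cong (walk M₃) walk-third) walk-third′)

  closes : walk (suc m) δ₀ ≡ δ₀
  closes = trans (walk-+ M₃ (M₃ ℕ.+ M₃) δ₀) (trans (cong (walk M₃) walk-2M₃) walk-third″)

  unmarked₀ : ∀ r → 0 ℕ.< r → r ℕ.< M₃ → ¬ Marked (walk r δ₀)
  unmarked₀ (suc r) _ (ℕ.s≤s lt) = unmarked third r lt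

  unmarked₁ : ∀ r → 0 ℕ.< r → r ℕ.< M₃ → ¬ Marked (walk r (rotD δ₀))
  unmarked₁ r p q k = unmarked₀ r p q (rotD-marked⁻¹ (subst Marked (walk-rotD r δ₀) k))

  unmarked₂ : ∀ r → 0 ℕ.< r → r ℕ.< M₃ → ¬ Marked (walk r (rotD (rotD δ₀)))
  unmarked₂ r p q k = unmarked₁ r p q (rotD-marked⁻¹ (subst Marked (walk-rotD r (rotD δ₀)) k))

  minimal : ∀ j → 0 ℕ.< j → j ℕ.< suc m → walk j δ₀ ≢ δ₀
  minimal j 0<j j<3M e with ℕ.<-≤-connex j M₃
  ... | inj₁ j<M = unmarked₀ j 0<j j<M (subst Marked (sym e) marked₀)
  ... | inj₂ M≤j with ℕ.m≤n⇒∃[o]m+o≡n M≤j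
  ...   | r , refl = middle r e′ (ℕ.+-cancelˡ-< M₃ r (M₃ ℕ.+ M₃) j<3M)
    where
    e′ : walk r (rotD δ₀) ≡ δ₀
    e′ = trans (cong (walk r) (sym walk-third)) (trans (sym (walk-+ r M₃ δ₀)) (trans (cong (λ k → walk k δ₀) (ℕ.+-comm r M₃)) e))
    final : ∀ r → walk r (rotD (rotD δ₀)) ≡ δ₀ → r ℕ.< M₃ → ⊥
    final zero    e lt = contradiction (cong proj₂ e) (λ ())
    final (suc r) e lt = unmarked₂ (suc r) (ℕ.s≤s ℕ.z≤n) lt (subst Marked (sym e) marked₀)
    middle : ∀ r → walk r (rotD δ₀) ≡ δ₀ → r ℕ.< M₃ ℕ.+ M₃ → ⊥
    middle zero    e lt = contradiction (cong proj₂ e) (λ ())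
    middle (suc r) e lt with ℕ.<-≤-connex (suc r) M₃
    ... | inj₁ r<M = unmarked₁ (suc r) (ℕ.s≤s ℕ.z≤n) r<M (subst Marked (sym e) marked₀)
    ... | inj₂ M≤r with ℕ.m≤n⇒∃[o]m+o≡n M≤r
    ...   | r′ , eq = final r′
      (trans (cong (walk r′) (sym walk-third′)) (trans (sym (walk-+ r′ M₃ (rotD δ₀)))
        (trans (cong (λ k → walk k (rotD δ₀)) (trans (ℕ.+-comm r′ M₃) eq)) e)))
      (ℕ.+-cancelˡ-< M₃ r′ M₃ (subst (ℕ._< M₃ ℕ.+ M₃) (sym eq) lt))

  Reaches : Dart → Set
  Reaches δ = ∃ λ k → Marked (walk k δ)

  reaches-walk : ∀ j δ → Reaches (walk j δ) → Reaches δ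
  reaches-walk j δ (k , p) = k ℕ.+ j , subst Marked (sym (walk-+ k j δ)) p

  reaches-rotD⁻¹ : ∀ δ → Reaches (rotD δ) → Reaches δ
  reaches-rotD⁻¹ δ (k , p) = k , rotD-marked⁻¹ (subst Marked (walk-rotD k δ) p)

  reaches-rotD : ∀ δ → Reaches δ → Reaches (rotD δ)
  reaches-rotD δ (k , p) = k , subst Marked (sym (walk-rotD k δ)) (rotD-marked p)

  reaches-follows : ∀ {δ ts} → Follows Marked δ ts penultimate → Reaches δ
  reaches-follows {δ} {ts} f = reaches-walk (length ts) δ (subst Reaches (sym (walk-follows f))
    (1 , subst Marked (sym (trans (cong (λ t → move t penultimate) turns-left) returns)) (rotD-marked marked₀)))

  reaches-side₁ : ∀ i → i ℕ.≤ s → Reaches (at (side₁ c) i)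
  reaches-side₁ i i≤s = reaches-follows (from-side₁ (s ℕ.∸ i) i (ℕ.m+[n∸m]≡n i≤s))

  reaches-side₂ : ∀ i → i ℕ.≤ t → Reaches (at (side₂ c) i)
  reaches-side₂ i i≤t = reaches-follows (from-side₂ (t ℕ.∸ i) i (ℕ.m+[n∸m]≡n i≤t))

  covers-from : ∀ δ → Reaches δ → ∃ λ k → walk k δ ≡ δ₀
  covers-from δ (k , here e) = k , e
  covers-from δ (k , there (here e)) = (M₃ ℕ.+ M₃) ℕ.+ k , trans (walk-+ (M₃ ℕ.+ M₃) k δ)
    (trans (cong (walk (M₃ ℕ.+ M₃)) (trans e (⟦lrot⟧ (side₁ c) (+ s , + t , + 0))))
      (trans (walk-+ M₃ M₃ (rotD δ₀)) (trans (cong (walk M₃) walk-third′) walk-third″)))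
  covers-from δ (k , there (there (here e))) = M₃ ℕ.+ k , trans (walk-+ M₃ k δ)
    (trans (cong (walk M₃) (trans e (trans (⟦lrot⟧ (lrot (side₁ c)) (+ s , + t , + 0))
      (cong rotD (⟦lrot⟧ (side₁ c) (+ s , + t , + 0)))))) walk-third″)

-- Every boundary dart lies on the boundary word

difference : ∀ {x y : ℤ} → x ≡ y → x - y ≡ + 0
difference = ℤ.i≡j⇒i-j≡0

vanish : ∀ {z} r {a b c : ℤ} → a ≡ + 0 → b ≡ + 0 → c ≡ + 0 → z ≡ ((r + a) + b) + c → z ≡ r
vanish r refl refl refl e = trans e (h r)
  where
  h : ∀ r → ((r + + 0) + + 0) + + 0 ≡ r
  h = solve-∀

carry-top : ∀ κ s t x y k f g ε → x + y ≡ - + 1 + + 3 * k → (κ + (+ 1 * s + (+ 2 * t + + 0))) - y ≡ ε → (κ + (κ + + 0)) + + 1 ≡ (f + (g + (g + (g + + 0)))) + ε →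
  (κ + (+ 2 * s + (+ 1 * t + + 0))) - x ≡ f + + 3 * (((s + t) + g) - k)
carry-top κ s t x y k f g ε e₁ e₂ e₃ =
  vanish (f + + 3 * (((s + t) + g) - k)) (difference (sym e₁)) (difference (sym e₂)) (difference e₃) (h κ s t x y k f g ε)
  where
  h : ∀ κ s t x y k f g ε → (κ + (+ 2 * s + (+ 1 * t + + 0))) - x ≡
    ((f + + 3 * (((s + t) + g) - k)) + ((- + 1 + + 3 * k) - (x + y))) +
    (ε - ((κ + (+ 1 * s + (+ 2 * t + + 0))) - y)) + (((κ + (κ + + 0)) + + 1) - ((f + (g + (g + (g + + 0)))) + ε))
  h = solve-∀

carry-bottom : ∀ κ s t x y k f g ε → x + y ≡ - + 1 + + 3 * k → (κ + (+ 2 * s + (+ 1 * t + + 0))) + y ≡ ε → κ + (κ + + 0) ≡ ((f + (g + (g + (g + + 0)))) + ε) + + 1 →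
  (κ + (+ 1 * s + (+ 2 * t + + 0))) + x ≡ f + + 3 * (((s + t) + g) + k)
carry-bottom κ s t x y k f g ε e₁ e₂ e₃ =
  vanish (f + + 3 * (((s + t) + g) + k)) (difference e₁) (difference (sym e₂)) (difference e₃) (h κ s t x y k f g ε)
  where
  h : ∀ κ s t x y k f g ε → (κ + (+ 1 * s + (+ 2 * t + + 0))) + x ≡
    ((f + + 3 * (((s + t) + g) + k)) + ((x + y) - (- + 1 + + 3 * k))) +
    (ε - ((κ + (+ 2 * s + (+ 1 * t + + 0))) + y)) + ((κ + (κ + + 0)) - (((f + (g + (g + (g + + 0)))) + ε) + + 1))
  h = solve-∀

bound-top : ∀ κ s t x y f ε b h → (κ + (+ 1 * s + (+ 2 * t + + 0))) - y ≡ ε → (f + (b + (b + (b + + 0)))) + + 2 ≡ (κ + ε) + h →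
  ((κ + (+ 2 * s + (+ 1 * t + + 0))) - x) + (((κ + (+ 2 * s + (+ 1 * t + + 0))) + (x - y)) + h) ≡ (f + ((s + b) + ((s + b) + ((s + b) + + 0)))) + + 2
bound-top κ s t x y f ε b h e₁ e₂ =
  vanish ((f + ((s + b) + ((s + b) + ((s + b) + + 0)))) + + 2) refl (difference e₁) (difference (sym e₂)) (i κ s t x y f ε b h)
  where
  i : ∀ κ s t x y f ε b h → ((κ + (+ 2 * s + (+ 1 * t + + 0))) - x) + (((κ + (+ 2 * s + (+ 1 * t + + 0))) + (x - y)) + h) ≡
    (((f + ((s + b) + ((s + b) + ((s + b) + + 0)))) + + 2) + + 0) + (((κ + (+ 1 * s + (+ 2 * t + + 0))) - y) - ε) + (((κ + ε) + h) - ((f + (b + (b + (b + + 0)))) + + 2))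
  i = solve-∀

bound-bottom : ∀ κ s t x y f ε b h → (κ + (+ 2 * s + (+ 1 * t + + 0))) + y ≡ ε → (f + (b + (b + (b + + 0)))) + + 2 ≡ (κ + ε) + h →
  ((κ + (+ 1 * s + (+ 2 * t + + 0))) + x) + (((κ + (+ 1 * s + (+ 2 * t + + 0))) - (x - y)) + h) ≡ (f + ((t + b) + ((t + b) + ((t + b) + + 0)))) + + 2
bound-bottom κ s t x y f ε b h e₁ e₂ =
  vanish ((f + ((t + b) + ((t + b) + ((t + b) + + 0)))) + + 2) refl (difference e₁) (difference (sym e₂)) (i κ s t x y f ε b h)
  where
  i : ∀ κ s t x y f ε b h → ((κ + (+ 1 * s + (+ 2 * t + + 0))) + x) + (((κ + (+ 1 * s + (+ 2 * t + + 0))) - (x - y)) + h) ≡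
    (((f + ((t + b) + ((t + b) + ((t + b) + + 0)))) + + 2) + + 0) + (((κ + (+ 2 * s + (+ 1 * t + + 0))) + y) - ε) + (((κ + ε) + h) - ((f + (b + (b + (b + + 0)))) + + 2))
  i = solve-∀

module Covered (c : Cls) (s t : ℕ) where
  open Assembled c s t

  leads-reach : ∀ {δ ρ} targets → All (λ ε → Reaches (⟦ ε ⟧ᵈ ρ)) targets →
                Any (λ ε → ∃ λ j → walk j δ ≡ ⟦ ε ⟧ᵈ ρ) targets → Reaches δ
  leads-reach {δ} (ε ∷ _) (r ∷ _)  (here (j , e)) = reaches-walk j δ (subst Reaches (sym e) r)
  leads-reach (_ ∷ εs)    (_ ∷ rs) (there p)      = leads-reach εs rs p

  within : ∀ {i n} → i ℕ.< n → ∃ λ r → i ℕ.+ suc r ≡ n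
  within {i} lt with ℕ.m≤n⇒∃[o]m+o≡n lt
  ... | r , e = r , trans (ℕ.+-suc i r) e

  top-reach : ∀ {e d} → TopDir e d → ∀ i → i ℕ.≤ s ℕ.+ bit (wide (top c e)) → Reaches (at (topDart c e d) i)
  top-reach {e} {d} td i i≤ with ℕ.<-cmp i s
  ... | tri< lt _ _ with within lt
  ...   | r , eq = subst Reaches (at-[] δ u i (⟦u⟧ (+ i) (+ r) (+ t)))
      (leads-reach (topTargets c u+v+1 u ++ topTargets c u+v+1 u+1)
        ( subst Reaches (sym (at-[] (side₁ c) u i (⟦u⟧ (+ i) (+ r) (+ t)))) (reaches-side₁ i (ℕ.<⇒≤ lt))
        ∷ subst Reaches (sym (at-o (side₂ c))) (reaches-side₂ 0 ℕ.z≤n)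
        ∷ subst Reaches (sym (at-[] (side₁ c) u+1 (suc i) (⟦u+1⟧ (+ i) (+ r) (+ t)))) (reaches-side₁ (suc i) lt)
        ∷ subst Reaches (sym (at-o (side₂ c))) (reaches-side₂ 0 ℕ.z≤n)
        ∷ [])
        (leads-sound (topTargets c u+v+1 u ++ topTargets c u+v+1 u+1) (δ [ u+v+1 , w , u ]ᵈ)
          (∧-fst (∧-fst (top-leads c td)))))
    where
    δ : LDart
    δ = topDart c e d
    open Evaluate u+v+1 w (nonneg i r t)
      (trans (⟦u+v+1⟧ (+ i) (+ r) (+ t)) (split i r s eq)) (⟦w⟧ (+ i) (+ r) (+ t))
  top-reach {e} {d} td i i≤ | tri≈ _ refl _ = subst Reaches (at-[] δ u s (⟦u⟧ (+ s) (+ 0) (+ t)))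
      (leads-reach (topTargets c u u)
        ( subst Reaches (sym (at-[] (side₁ c) u s (⟦u⟧ (+ s) (+ 0) (+ t)))) (reaches-side₁ s ℕ.≤-refl)
        ∷ subst Reaches (sym (at-o (side₂ c))) (reaches-side₂ 0 ℕ.z≤n)
        ∷ [])
        (leads-sound (topTargets c u u) (δ [ u , w , u ]ᵈ)
          (∧-snd {leads? c u+v+1 w (topTargets c u+v+1 u ++ topTargets c u+v+1 u+1) (δ [ u+v+1 , w , u ]ᵈ)}
            (∧-fst (top-leads c td)))))
    where
    δ : LDart
    δ = topDart c e d
    open Evaluate u w (nonneg s 0 t) (⟦u⟧ (+ s) (+ 0) (+ t)) (⟦w⟧ (+ s) (+ 0) (+ t))
  top-reach {e} {d} td i i≤ | tri> _ _ gt with wide (top c e) in weq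
  ... | false = contradiction gt (ℕ.≤⇒≯ (subst (i ℕ.≤_) (ℕ.+-identityʳ s) i≤))
  ... | true with ℕ.≤-antisym (subst (i ℕ.≤_) (ℕ.+-comm s 1) i≤) gt
  ...   | refl = subst Reaches (at-[] δ u+1 (suc s) (⟦u+1⟧ (+ s) (+ 0) (+ t)))
      (leads-reach (topTargets c u u)
        ( subst Reaches (sym (at-[] (side₁ c) u s (⟦u⟧ (+ s) (+ 0) (+ t)))) (reaches-side₁ s ℕ.≤-refl)
        ∷ subst Reaches (sym (at-o (side₂ c))) (reaches-side₂ 0 ℕ.z≤n)
        ∷ [])
        (leads-sound (topTargets c u u) (δ [ u , w , u+1 ]ᵈ)
          (subst (λ b → T (when b (leads? c u w (topTargets c u u) (δ [ u , w , u+1 ]ᵈ)))) weq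
            (∧-snd {leads? c u+v+1 w (topTargets c u+v+1 u ++ topTargets c u+v+1 u+1) (δ [ u+v+1 , w , u ]ᵈ)
                     ∧ leads? c u w (topTargets c u u) (δ [ u , w , u ]ᵈ)}
              (top-leads c td)))))
    where
    δ : LDart
    δ = topDart c e d
    open Evaluate u w (nonneg s 0 t) (⟦u⟧ (+ s) (+ 0) (+ t)) (⟦w⟧ (+ s) (+ 0) (+ t))

  reaches-side₂′ : ∀ i → i ℕ.≤ t → Reaches (at (lrot (side₂ c)) i)
  reaches-side₂′ i i≤ = subst Reaches (sym (⟦lrot⟧ (side₂ c) (+ s , + t , + i)))
    (reaches-rotD (at (side₂ c) i) (reaches-side₂ i i≤))

  reaches-end : Reaches (at (lrot (lrot (side₁ c))) 0)
  reaches-end = 0 , there (there (here refl))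

  bottom-reach : ∀ {e d} → BottomDir e d → ∀ i → i ℕ.≤ t ℕ.+ bit (wide (bottom c e)) → Reaches (at (bottomDart c e d) i)
  bottom-reach {e} {d} td i i≤ with ℕ.<-cmp i t
  ... | tri< lt _ _ with within lt
  ...   | r , eq = subst Reaches (at-[] δ u i (⟦u⟧ (+ i) (+ r) (+ s)))
      (leads-reach (bottomTargets c u+v+1 u ++ bottomTargets c u+v+1 u+1)
        ( subst Reaches (sym (at-[] (lrot (side₂ c)) u i (⟦u⟧ (+ i) (+ r) (+ s)))) (reaches-side₂′ i (ℕ.<⇒≤ lt))
        ∷ subst Reaches (sym (at-o (lrot (lrot (side₁ c))))) reaches-end
        ∷ subst Reaches (sym (at-[] (lrot (side₂ c)) u+1 (suc i) (⟦u+1⟧ (+ i) (+ r) (+ s)))) (reaches-side₂′ (suc i) lt)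
        ∷ subst Reaches (sym (at-o (lrot (lrot (side₁ c))))) reaches-end
        ∷ [])
        (leads-sound (bottomTargets c u+v+1 u ++ bottomTargets c u+v+1 u+1) (δ [ w , u+v+1 , u ]ᵈ)
          (∧-fst (∧-fst (bottom-leads c td)))))
    where
    δ : LDart
    δ = bottomDart c e d
    open Evaluate w u+v+1 (nonneg i r s)
      (⟦w⟧ (+ i) (+ r) (+ s)) (trans (⟦u+v+1⟧ (+ i) (+ r) (+ s)) (split i r t eq))
  bottom-reach {e} {d} td i i≤ | tri≈ _ refl _ = subst Reaches (at-[] δ u t (⟦u⟧ (+ t) (+ 0) (+ s)))
      (leads-reach (bottomTargets c u u)
        ( subst Reaches (sym (at-[] (lrot (side₂ c)) u t (⟦u⟧ (+ t) (+ 0) (+ s)))) (reaches-side₂′ t ℕ.≤-refl)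
        ∷ subst Reaches (sym (at-o (lrot (lrot (side₁ c))))) reaches-end
        ∷ [])
        (leads-sound (bottomTargets c u u) (δ [ w , u , u ]ᵈ)
          (∧-snd {leads? c w u+v+1 (bottomTargets c u+v+1 u ++ bottomTargets c u+v+1 u+1) (δ [ w , u+v+1 , u ]ᵈ)}
            (∧-fst (bottom-leads c td)))))
    where
    δ : LDart
    δ = bottomDart c e d
    open Evaluate w u (nonneg t 0 s) (⟦w⟧ (+ t) (+ 0) (+ s)) (⟦u⟧ (+ t) (+ 0) (+ s))
  bottom-reach {e} {d} td i i≤ | tri> _ _ gt with wide (bottom c e) in weq
  ... | false = contradiction gt (ℕ.≤⇒≯ (subst (i ℕ.≤_) (ℕ.+-identityʳ t) i≤))
  ... | true with ℕ.≤-antisym (subst (i ℕ.≤_) (ℕ.+-comm t 1) i≤) gt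
  ...   | refl = subst Reaches (at-[] δ u+1 (suc t) (⟦u+1⟧ (+ t) (+ 0) (+ s)))
      (leads-reach (bottomTargets c u u)
        ( subst Reaches (sym (at-[] (lrot (side₂ c)) u t (⟦u⟧ (+ t) (+ 0) (+ s)))) (reaches-side₂′ t ℕ.≤-refl)
        ∷ subst Reaches (sym (at-o (lrot (lrot (side₁ c))))) reaches-end
        ∷ [])
        (leads-sound (bottomTargets c u u) (δ [ w , u , u+1 ]ᵈ)
          (subst (λ b → T (when b (leads? c w u (bottomTargets c u u) (δ [ w , u , u+1 ]ᵈ)))) weq
            (∧-snd {leads? c w u+v+1 (bottomTargets c u+v+1 u ++ bottomTargets c u+v+1 u+1) (δ [ w , u+v+1 , u ]ᵈ)
                     ∧ leads? c w u (bottomTargets c u u) (δ [ w , u , u ]ᵈ)}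
              (bottom-leads c td)))))
    where
    δ : LDart
    δ = bottomDart c e d
    open Evaluate w u (nonneg t 0 s) (⟦w⟧ (+ t) (+ 0) (+ s)) (⟦u⟧ (+ t) (+ 0) (+ s))

  ⟦topDart⟧ : ∀ e d i → at (topDart c e d) i ≡ (((B - + offset (top c e)) - + 3 * + i , A - + depth e) , d)
  ⟦topDart⟧ e d i = cong (_, d) (cong₂ _,_
    (trans (⟦⊟⟧ (lower c ⊟ const (+ f)) (+ 3 · variable-i) ρ) (cong₂ _-_
      (trans (⟦⊟⟧ (lower c) (const (+ f)) ρ) (cong (_-_ B) (⟦const⟧ (+ f) ρ)))
      (trans (⟦·⟧ (+ 3) variable-i ρ) (cong (_*_ (+ 3)) (⟦w⟧ (+ s) (+ t) (+ i))))))
    (trans (⟦⊟⟧ (upper c) (const (+ depth e)) ρ) (cong (_-_ A) (⟦const⟧ (+ depth e) ρ))))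
    where
    f : ℕ
    f = offset (top c e)
    ρ : Env
    ρ = (+ s , + t , + i)

  ⟦bottomDart⟧ : ∀ e d i →
    at (bottomDart c e d) i ≡ (((+ offset (bottom c e) - A) + + 3 * + i , + depth e - B) , d)
  ⟦bottomDart⟧ e d i = cong (_, d) (cong₂ _,_
    (trans (⟦⊞⟧ (const (+ f) ⊟ upper c) (+ 3 · variable-i) ρ) (cong₂ _+_
      (trans (⟦⊟⟧ (const (+ f)) (upper c) ρ) (cong (_- A) (⟦const⟧ (+ f) ρ)))
      (trans (⟦·⟧ (+ 3) variable-i ρ) (cong (_*_ (+ 3)) (⟦w⟧ (+ s) (+ t) (+ i))))))
    (trans (⟦⊟⟧ (const (+ depth e)) (lower c) ρ) (cong (_- B) (⟦const⟧ (+ depth e) ρ))))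
    where
    f : ℕ
    f = offset (bottom c e)
    ρ : Env
    ρ = (+ s , + t , + i)

  top-row : ∀ x y e → L (- + 1) (x , y) → Region A B (x , y) → A - y ≡ + depth e →
            ∃ λ i → i ℕ.≤ s ℕ.+ bit (wide (top c e)) × (∀ d → ((x , y) , d) ≡ at (topDart c e d) i)
  top-row x y e l (_ ∷ _ ∷ _ ∷ z≥0 ∷ _ ∷ e≥0 ∷ []) eq with L-elim (- + 1) (x , y) l
  ... | k , ek with slot (B - x) (((+ s + + t) + + carry (top c e)) - k) f (s ℕ.+ bit (wide (top c e)))
        ((B + (x - y)) + + surplus (top c e)) (proj₁ (offset<3 c e)) z≥0 (0≤+ e≥0 (+≤+ ℕ.z≤n))
        (carry-top (+ κ c) (+ s) (+ t) x y k (+ f) (+ carry (top c e)) (+ depth e) ek eq (cong +_ (top-carry c e)))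
        (bound-top (+ κ c) (+ s) (+ t) x y (+ f) (+ depth e) (+ bit (wide (top c e))) (+ surplus (top c e)) eq
          (cong +_ (top-surplus c e)))
      where
      f : ℕ
      f = offset (top c e)
  ...   | i , i≤ , ez = i , i≤ , λ d → trans (cong (_, d) (cong₂ _,_
          (trans (h B x) (trans (cong (_-_ B) (trans ez (cong (_+_ (+ f)) (ℤ.pos-* 3 i)))) (h′ B (+ f) (+ 3 * + i))))
          (trans (h A y) (cong (_-_ A) eq)))) (sym (⟦topDart⟧ e d i))
    where
    f : ℕ
    f = offset (top c e)
    h : ∀ B x → x ≡ B - (B - x)
    h = solve-∀
    h′ : ∀ B f z → B - (f + z) ≡ (B - f) - z
    h′ = solve-∀

  bottom-row : ∀ x y e → L (- + 1) (x , y) → Region A B (x , y) → B + y ≡ + depth e →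
            ∃ λ i → i ℕ.≤ t ℕ.+ bit (wide (bottom c e)) × (∀ d → ((x , y) , d) ≡ at (bottomDart c e d) i)
  bottom-row x y e l (_ ∷ _ ∷ z≥0 ∷ _ ∷ e≥0 ∷ _ ∷ []) eq with L-elim (- + 1) (x , y) l
  ... | k , ek with slot (A + x) (((+ s + + t) + + carry (bottom c e)) + k) f (t ℕ.+ bit (wide (bottom c e)))
        ((A - (x - y)) + + surplus (bottom c e)) (proj₂ (offset<3 c e)) z≥0 (0≤+ e≥0 (+≤+ ℕ.z≤n))
        (carry-bottom (+ κ c) (+ s) (+ t) x y k (+ f) (+ carry (bottom c e)) (+ depth e) ek eq (cong +_ (bottom-carry c e)))
        (bound-bottom (+ κ c) (+ s) (+ t) x y (+ f) (+ depth e) (+ bit (wide (bottom c e))) (+ surplus (bottom c e)) eq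
          (cong +_ (bottom-surplus c e)))
      where
      f : ℕ
      f = offset (bottom c e)
  ...   | i , i≤ , ez = i , i≤ , λ d → trans (cong (_, d) (cong₂ _,_
          (trans (h A x) (trans (cong (_- A) (trans ez (cong (_+_ (+ f)) (ℤ.pos-* 3 i)))) (h′ A (+ f) (+ 3 * + i))))
          (trans (h B y) (cong (_- B) eq)))) (sym (⟦bottomDart⟧ e d i))
    where
    f : ℕ
    f = offset (bottom c e)
    h : ∀ B x → x ≡ (B + x) - B
    h = solve-∀
    h′ : ∀ A f z → (f + z) - A ≡ (f - A) + z
    h′ = solve-∀

  nonneg-shift : ∀ {z z′} k → z′ ≡ z + + k → + 0 ≤ z → + 0 ≤ z′
  nonneg-shift k e p = subst (+ 0 ≤_) (sym e) (0≤+ p (+≤+ ℕ.z≤n))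

  via-top : ∀ {x y e d} → TopDir e d → L (- + 1) (x , y) → Region A B (x , y) → A - y ≡ + depth e →
            Reaches ((x , y) , d)
  via-top {x} {y} {e} {d} td l r eq with top-row x y e l r eq
  ... | i , i≤ , f = subst Reaches (sym (f d)) (top-reach td i i≤)

  via-bottom : ∀ {x y e d} → BottomDir e d → L (- + 1) (x , y) → Region A B (x , y) → B + y ≡ + depth e →
               Reaches ((x , y) , d)
  via-bottom {x} {y} {e} {d} td l r eq with bottom-row x y e l r eq
  ... | i , i≤ , f = subst Reaches (sym (f d)) (bottom-reach td i i≤)

  reach-top : ∀ δ → Boundary δ → ¬ (+ 0 ≤ A - proj₂ (beside δ)) → Reaches δ
  reach-top ((x , y) , fwd x0) (boundary l r@(a ∷ _) _) n = contradiction (nonneg-shift 2 (h A y) a) n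
    where
    h : ∀ A y → A - (y + - + 2) ≡ (A - y) + + 2
    h = solve-∀
  reach-top ((x , y) , fwd x1) (boundary l r@(a ∷ _) _) n = via-top rising l r
    (shallow₁ (A - y) a (λ p → n (subst (+ 0 ≤_) (h A y) p)))
    where
    h : ∀ A y → (A - y) - + 1 ≡ A - (y + + 1)
    h = solve-∀
  reach-top ((x , y) , fwd x2) (boundary l r@(a ∷ _) _) n = via-top falling l r
    (shallow₁ (A - y) a (λ p → n (subst (+ 0 ≤_) (h A y) p)))
    where
    h : ∀ A y → (A - y) - + 1 ≡ A - (y + + 1)
    h = solve-∀
  reach-top ((x , y) , bwd x0) (boundary l r@(a ∷ _) _) n
    with shallow₂ (A - y) a (λ p → n (subst (+ 0 ≤_) (h A y) p))
    where
    h : ∀ A y → (A - y) - + 2 ≡ A - (y + + 2)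
    h = solve-∀
  ... | e , eq = via-top {e = e} straight l r eq
  reach-top ((x , y) , bwd x1) (boundary l r@(a ∷ _) _) n = contradiction (nonneg-shift 1 (h A y) a) n
    where
    h : ∀ A y → A - (y + - + 1) ≡ (A - y) + + 1
    h = solve-∀
  reach-top ((x , y) , bwd x2) (boundary l r@(a ∷ _) _) n = contradiction (nonneg-shift 1 (h A y) a) n
    where
    h : ∀ A y → A - (y + - + 1) ≡ (A - y) + + 1
    h = solve-∀

  reach-bottom : ∀ δ → Boundary δ → ¬ (+ 0 ≤ B + proj₂ (beside δ)) → Reaches δ
  reach-bottom ((x , y) , bwd x0) (boundary l r@(_ ∷ b ∷ _) _) n = contradiction (nonneg-shift 2 (h B y) b) n
    where
    h : ∀ B y → B + (y + + 2) ≡ (B + y) + + 2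
    h = solve-∀
  reach-bottom ((x , y) , bwd x1) (boundary l r@(_ ∷ b ∷ _) _) n = via-bottom falling l r
    (shallow₁ (B + y) b (λ p → n (subst (+ 0 ≤_) (h B y) p)))
    where
    h : ∀ B y → (B + y) - + 1 ≡ B + (y + - + 1)
    h = solve-∀
  reach-bottom ((x , y) , bwd x2) (boundary l r@(_ ∷ b ∷ _) _) n = via-bottom rising l r
    (shallow₁ (B + y) b (λ p → n (subst (+ 0 ≤_) (h B y) p)))
    where
    h : ∀ B y → (B + y) - + 1 ≡ B + (y + - + 1)
    h = solve-∀
  reach-bottom ((x , y) , fwd x0) (boundary l r@(_ ∷ b ∷ _) _) n
    with shallow₂ (B + y) b (λ p → n (subst (+ 0 ≤_) (h B y) p))
    where
    h : ∀ B y → (B + y) - + 2 ≡ B + (y + - + 2)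
    h = solve-∀
  ... | e , eq = via-bottom {e = e} straight l r eq
  reach-bottom ((x , y) , fwd x1) (boundary l r@(_ ∷ b ∷ _) _) n = contradiction (nonneg-shift 1 (h B y) b) n
    where
    h : ∀ B y → B + (y + + 1) ≡ (B + y) + + 1
    h = solve-∀
  reach-bottom ((x , y) , fwd x2) (boundary l r@(_ ∷ b ∷ _) _) n = contradiction (nonneg-shift 1 (h B y) b) n
    where
    h : ∀ B y → B + (y + + 1) ≡ (B + y) + + 1
    h = solve-∀

  -- Rotation permutes the three coordinates, so it brings any violated bound to the top or the bottom side.
  reach : ∀ δ → Boundary δ → Reaches δ
  reach δ bd with All.¬All⇒Any¬ (+ 0 ℤ.≤?_) (slacks A B (beside δ)) (outside bd)
  ... | here n = reach-top δ bd n
  ... | there (here n) = reach-bottom δ bd n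
  ... | there (there (here n)) = reaches-rotD⁻¹ δ (reaches-rotD⁻¹ (rotD δ)
      (reach-top (rotD (rotD δ)) (rotD-boundary (rotD δ) (rotD-boundary δ bd))
        (λ p → n (subst (+ 0 ≤_) eq p))))
    where
    h : ∀ A x y → A - ((- y) - (x - y)) ≡ A + x
    h = solve-∀
    eq : A - proj₂ (beside (rotD (rotD δ))) ≡ A + proj₁ (beside δ)
    eq = trans (cong (λ p → A - proj₂ p) (trans (beside-rotD (rotD δ)) (cong rot (beside-rotD δ))))
      (h A (proj₁ (beside δ)) (proj₂ (beside δ)))
  ... | there (there (there (here n))) = reaches-rotD⁻¹ δ (reaches-rotD⁻¹ (rotD δ)
      (reach-bottom (rotD (rotD δ)) (rotD-boundary (rotD δ) (rotD-boundary δ bd))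
        (λ p → n (subst (+ 0 ≤_) eq p))))
    where
    h : ∀ B x y → B + ((- y) - (x - y)) ≡ B - x
    h = solve-∀
    eq : B + proj₂ (beside (rotD (rotD δ))) ≡ B - proj₁ (beside δ)
    eq = trans (cong (λ p → B + proj₂ p) (trans (beside-rotD (rotD δ)) (cong rot (beside-rotD δ))))
      (h B (proj₁ (beside δ)) (proj₂ (beside δ)))
  ... | there (there (there (there (here n)))) = reaches-rotD⁻¹ δ
      (reach-top (rotD δ) (rotD-boundary δ bd)
        (λ p → n (subst (+ 0 ≤_) (cong (λ p → A - proj₂ p) (beside-rotD δ)) p)))
  ... | there (there (there (there (there (here n))))) = reaches-rotD⁻¹ δ
      (reach-bottom (rotD δ) (rotD-boundary δ bd)
        (λ p → n (subst (+ 0 ≤_) (cong (λ p → B + proj₂ p) (beside-rotD δ)) p)))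

  covers : ∀ δ → Boundary δ → ∃ λ k → walk k δ ≡ δ₀
  covers δ bd = covers-from δ (reach δ bd)

-- The signed area of the shadow

shadowThird : Cls → ℤ → ℤ → Pt × ℤ
shadowThird c1  s t = ((+ 3 * s , - (+ 3 + + 3 * t)) , - (+ 3 + + 6 * s + + 3 * t + + 9 * (s * t)))
shadowThird c0  s t = ((+ 3 * s + + 3 * t , + 3 * t) , + 6 + + 3 * s + + 3 * t + + 9 * (s * t))
shadowThird c-1 s t = ((+ 3 * s - + 3 * t - + 3 , - + 3) , - (+ 3 + + 6 * s))

-- The left-hand sides of hx, hy and hz are the definitional unfoldings of the four joins.
third-run : ∀ c s t →
  run (fwd x0) ((repeat s (block₁ c) ++ (corner₁ c ++ (repeat t (block₂ c) ++ corner₂ c))) ++ (left ∷ [])) ≡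
  (fwd x2 , shadowThird c (+ s) (+ t))
third-run c1 s t = trans
  (run-then (repeat s (block₁ c1) ++ (corner₁ c1 ++ (repeat t (block₂ c1) ++ corner₂ c1))) (left ∷ [])
    (run-then (repeat s (block₁ c1)) (corner₁ c1 ++ (repeat t (block₂ c1) ++ corner₂ c1))
      (run-repeat {fwd x0} {((+ 3 , + 0) , + 3)} (block₁ c1) s refl)
      (run-then {fwd x0} {bwd x1} (corner₁ c1) (repeat t (block₂ c1) ++ corner₂ c1) refl
        (run-then (repeat t (block₂ c1)) (corner₂ c1)
          (run-repeat {bwd x1} {((+ 0 , - + 3) , + 3)} (block₂ c1) t refl) refl)))
    refl)
  (cong (fwd x2 ,_) (cong₂ _,_ (cong₂ _,_ (hx (+ s) (+ t)) (hy (+ s) (+ t))) (hz (+ s) (+ t))))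
  where
  hx : ∀ s t → (((s * (+ 3)) + ((+ 1) + ((t * (+ 0)) + (- + 1)))) + (+ 0)) ≡ + 3 * s
  hx = solve-∀
  hy : ∀ s t → (((s * (+ 0)) + ((+ 0) + ((t * (- + 3)) + (- + 2)))) + (- + 1)) ≡ - (+ 3 + + 3 * t)
  hy = solve-∀
  hz : ∀ s t →
    (((((s * (+ 3)) + (((+ 0) + (((t * (+ 3)) + (- + 1)) + ((t * (+ 0)) * (- + 2) - (- + 1) * (t * (- + 3))))) + ((+ 1) * ((t * (- + 3)) + (- + 2)) - ((t * (+ 0)) + (- + 1)) * (+ 0)))) + ((s * (+ 3)) * ((+ 0) + ((t * (- + 3)) + (- + 2))) - ((+ 1) + ((t * (+ 0)) + (- + 1))) * (s * (+ 0)))) + (+ 0)) + (((s * (+ 3)) + ((+ 1) + ((t * (+ 0)) + (- + 1)))) * (- + 1) - (+ 0) * ((s * (+ 0)) + ((+ 0) + ((t * (- + 3)) + (- + 2)))))) ≡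
    - (+ 3 + + 6 * s + + 3 * t + + 9 * (s * t))
  hz = solve-∀
third-run c0 s t = trans
  (run-then (repeat s (block₁ c0) ++ (corner₁ c0 ++ (repeat t (block₂ c0) ++ corner₂ c0))) (left ∷ [])
    (run-then (repeat s (block₁ c0)) (corner₁ c0 ++ (repeat t (block₂ c0) ++ corner₂ c0))
      (run-repeat {fwd x0} {((+ 3 , + 0) , + 3)} (block₁ c0) s refl)
      (run-then {fwd x0} {bwd x2} (corner₁ c0) (repeat t (block₂ c0) ++ corner₂ c0) refl
        (run-then (repeat t (block₂ c0)) (corner₂ c0)
          (run-repeat {bwd x2} {((+ 3 , + 3) , - + 3)} (block₂ c0) t refl) refl)))
    refl)
  (cong (fwd x2 ,_) (cong₂ _,_ (cong₂ _,_ (hx (+ s) (+ t)) (hy (+ s) (+ t))) (hz (+ s) (+ t))))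
  where
  hx : ∀ s t → (((s * (+ 3)) + ((+ 1) + ((t * (+ 3)) + (- + 1)))) + (+ 0)) ≡ + 3 * s + + 3 * t
  hx = solve-∀
  hy : ∀ s t → (((s * (+ 0)) + ((+ 0) + ((t * (+ 3)) + (+ 1)))) + (- + 1)) ≡ + 3 * t
  hy = solve-∀
  hz : ∀ s t →
    (((((s * (+ 3)) + (((+ 0) + (((t * (- + 3)) + (+ 5)) + ((t * (+ 3)) * (+ 1) - (- + 1) * (t * (+ 3))))) + ((+ 1) * ((t * (+ 3)) + (+ 1)) - ((t * (+ 3)) + (- + 1)) * (+ 0)))) + ((s * (+ 3)) * ((+ 0) + ((t * (+ 3)) + (+ 1))) - ((+ 1) + ((t * (+ 3)) + (- + 1))) * (s * (+ 0)))) + (+ 0)) + (((s * (+ 3)) + ((+ 1) + ((t * (+ 3)) + (- + 1)))) * (- + 1) - (+ 0) * ((s * (+ 0)) + ((+ 0) + ((t * (+ 3)) + (+ 1)))))) ≡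
    + 6 + + 3 * s + + 3 * t + + 9 * (s * t)
  hz = solve-∀
third-run c-1 s t = trans
  (run-then (repeat s (block₁ c-1) ++ (corner₁ c-1 ++ (repeat t (block₂ c-1) ++ corner₂ c-1))) (left ∷ [])
    (run-then (repeat s (block₁ c-1)) (corner₁ c-1 ++ (repeat t (block₂ c-1) ++ corner₂ c-1))
      (run-repeat {fwd x0} {((+ 3 , + 0) , + 3)} (block₁ c-1) s refl)
      (run-then {fwd x0} {bwd x0} (corner₁ c-1) (repeat t (block₂ c-1) ++ corner₂ c-1) refl
        (run-then (repeat t (block₂ c-1)) (corner₂ c-1)
          (run-repeat {bwd x0} {((- + 3 , + 0) , - + 3)} (block₂ c-1) t refl) refl)))
    refl)
  (cong (fwd x2 ,_) (cong₂ _,_ (cong₂ _,_ (hx (+ s) (+ t)) (hy (+ s) (+ t))) (hz (+ s) (+ t))))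
  where
  hx : ∀ s t → (((s * (+ 3)) + ((- + 1) + ((t * (- + 3)) + (- + 2)))) + (+ 0)) ≡ + 3 * s - + 3 * t - + 3
  hx = solve-∀
  hy : ∀ s t → (((s * (+ 0)) + ((- + 1) + ((t * (+ 0)) + (- + 1)))) + (- + 1)) ≡ - + 3
  hy = solve-∀
  hz : ∀ s t →
    (((((s * (+ 3)) + (((- + 6) + (((t * (- + 3)) + (+ 1)) + ((t * (- + 3)) * (- + 1) - (- + 2) * (t * (+ 0))))) + ((- + 1) * ((t * (+ 0)) + (- + 1)) - ((t * (- + 3)) + (- + 2)) * (- + 1)))) + ((s * (+ 3)) * ((- + 1) + ((t * (+ 0)) + (- + 1))) - ((- + 1) + ((t * (- + 3)) + (- + 2))) * (s * (+ 0)))) + (+ 0)) + (((s * (+ 3)) + ((- + 1) + ((t * (- + 3)) + (- + 2)))) * (- + 1) - (+ 0) * ((s * (+ 0)) + ((- + 1) + ((t * (+ 0)) + (- + 1)))))) ≡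
    - (+ 3 + + 6 * s)
  hz = solve-∀

-- The shadow of the whole boundary consists of three copies of the shadow of a third,
-- successively rotated by ω², so it closes up.
three-thirds : ∀ p z → join (p , z) (join (rotate (rotate (p , z))) (rotate (p , z))) ≡
  (origin , + 3 * z + det p (rot (rot p)))
three-thirds (x , y) z = cong₂ _,_ (cong₂ _,_ (hx x y) (hy x y)) (hz x y z)
  where
  hx : ∀ x y → x + ((- (x - y)) + (- y)) ≡ + 0
  hx = solve-∀
  hy : ∀ x y → y + (((- y) - (x - y)) + (x - y)) ≡ + 0
  hy = solve-∀
  hz : ∀ x y z →
    (z + ((z + z) + ((- (x - y)) * (x - y) - (- y) * ((- y) - (x - y)))))
      + (x * (((- y) - (x - y)) + (x - y)) - ((- (x - y)) + (- y)) * y) ≡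
    + 3 * z + (x * ((- y) - (x - y)) - (- (x - y)) * y)
  hz = solve-∀

total-area : ∀ c s t → let (p , z) = shadowThird c s t in
  + 3 * z + det p (rot (rot p)) ≡
  + 3 * numer c (+ 1 + (+ κ c + (+ 1 * s + (+ 2 * t + + 0)))) (+ 1 + (+ κ c + (+ 2 * s + (+ 1 * t + + 0))))
total-area c1 s t = h s t
  where
  h : ∀ s t → let x = + 3 * s; y = - (+ 3 + + 3 * t); z = - (+ 3 + + 6 * s + + 3 * t + + 9 * (s * t))
                  a = + 1 + (+ 1 + (+ 1 * s + (+ 2 * t + + 0))); b = + 1 + (+ 1 + (+ 2 * s + (+ 1 * t + + 0))) in
    + 3 * z + (x * ((- y) - (x - y)) - (- (x - y)) * y) ≡ + 3 * (((((a * a - + 4 * a * b) + b * b) + a) + b) - + 2)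
  h = solve-∀
total-area c0 s t = h s t
  where
  h : ∀ s t → let x = + 3 * s + + 3 * t; y = + 3 * t; z = + 6 + + 3 * s + + 3 * t + + 9 * (s * t)
                  a = + 1 + (+ 2 + (+ 1 * s + (+ 2 * t + + 0))); b = + 1 + (+ 2 + (+ 2 * s + (+ 1 * t + + 0))) in
    + 3 * z + (x * ((- y) - (x - y)) - (- (x - y)) * y) ≡
    + 3 * ((((- (+ 3 * a * a)) + + 6 * a * b) - + 3 * b * b) + a + b)
  h = solve-∀
total-area c-1 s t = h s t
  where
  h : ∀ s t → let x = + 3 * s - + 3 * t - + 3; y = - + 3; z = - (+ 3 + + 6 * s)
                  a = + 1 + (+ 3 + (+ 1 * s + (+ 2 * t + + 0))); b = + 1 + (+ 3 + (+ 2 * s + (+ 1 * t + + 0))) in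
    + 3 * z + (x * ((- y) - (x - y)) - (- (x - y)) * y) ≡
    + 3 * (((((- (+ 3 * a * a)) + + 6 * a * b) - + 3 * b * b) - a - b) + + 2)
  h = solve-∀

start-inside : ∀ c → T (all nonneg? (lslacks (upper c [ u , w , o ]) (lower c [ u , w , o ]) (proj₁ (side₁ c [ u , w , o ]ᵈ))))
start-inside c0  = tt
start-inside c1  = tt
start-inside c-1 = tt

Conclusion : ℤ → ℤ → ℤ → Set
Conclusion a b N =
  (Σ ℕ λ n → Σ (ℕ → Pt) λ v → Σ (ℕ → Pt) λ w → BoundaryPath a b n v × Shadows n v w) ×
  (∀ n (v w : ℕ → Pt) → BoundaryPath a b n v → Shadows n v w →
    w n ≡ w 0 × sixTimesSignedArea n w ≡ + 3 * N)

module Generic (c : Cls) (s t : ℕ) where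

  open Assembled c s t
  open Covered c s t using (covers)
  open End using (turns-left)

  start : Boundary δ₀
  start = boundary centre₀ inside₀ outside₀
    where
    open Evaluate u w (nonneg s 0 t) (⟦u⟧ (+ s) (+ 0) (+ t)) (⟦w⟧ (+ s) (+ 0) (+ t))
    f : ℕ
    f = offset (top c outer)
    δ≡ : δ₀ ≡ (((B - + f) - + 0 , A - + 0) , fwd x2)
    δ≡ = Covered.⟦topDart⟧ c s t outer (fwd x2) 0
    centre₀ : L (- + 1) (proj₁ δ₀)
    centre₀ = subst (λ δ → L (- + 1) (proj₁ δ)) (sym δ≡) (L-intro (- + 1) ((B - + f) - + 0 , A - + 0)
      ((+ s + + t) + + carry (top c outer))
      (vanish (- + 1 + + 3 * ((+ s + + t) + + carry (top c outer))) refl refl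
        (difference (cong +_ (top-carry c outer))) (h (+ κ c) (+ s) (+ t) (+ f) (+ carry (top c outer)))))
      where
      h : ∀ κ s t f g → (((κ + (+ 2 * s + (+ 1 * t + + 0))) - f) - + 0) + ((κ + (+ 1 * s + (+ 2 * t + + 0))) - + 0) ≡
        (((- + 1 + + 3 * ((s + t) + g)) + + 0) + + 0)
          + (((κ + (κ + + 0)) + + 1) - ((f + (g + (g + (g + + 0)))) + + 0))
      h = solve-∀
    inside₀ : Region A B (proj₁ δ₀)
    inside₀ = subst (All (+ 0 ≤_))
      (trans (⟦lslacks⟧ (upper c [ u , w , o ]) (lower c [ u , w , o ]) (proj₁ (side₁ c [ u , w , o ]ᵈ)) (+ s , + 0 , + t))
        (trans (cong₂ (λ A B → slacks A B (⟦ proj₁ (side₁ c [ u , w , o ]ᵈ) ⟧ᵖ (+ s , + 0 , + t))) eA eB)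
          (cong (λ δ → slacks A B (proj₁ δ)) (at-o (side₁ c)))))
      (All.map⁺ (All.map (λ {l} p → nonneg?-sound l p (nonneg s 0 t))
        (All.all⁺ nonneg? (lslacks (upper c [ u , w , o ]) (lower c [ u , w , o ]) (proj₁ (side₁ c [ u , w , o ]ᵈ)))
          (start-inside c))))
    outside₀ : ¬ Region A B (beside δ₀)
    outside₀ r with subst (λ δ → Region A B (beside δ)) δ≡ r
    ... | p ∷ _ = contradiction (subst (+ 0 ≤_) (h A) p) (λ ())
      where
      h : ∀ A → A - ((A - + 0) + + 1) ≡ - + 1
      h = solve-∀

  spells : ∀ {M δ ts ε} → Follows M δ ts ε → Spells δ ts
  spells []                       = tt
  spells (advance {δ} {ts = ts} e _ f) = e , subst (λ t → Spells (move t δ) ts) (sym e) (spells f)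

  thirdTurns word : List Turn
  thirdTurns = thirdWord ++ (left ∷ [])
  word       = thirdTurns ++ (thirdTurns ++ thirdTurns)

  length-third : length thirdTurns ≡ M₃
  length-third = trans (List.length-++ thirdWord) (ℕ.+-comm l 1)

  length-word : length word ℕ.+ 0 ≡ suc m
  length-word = trans (ℕ.+-identityʳ (length word)) (trans (List.length-++ thirdTurns)
    (cong₂ ℕ._+_ length-third (trans (List.length-++ thirdTurns) (cong₂ ℕ._+_ length-third length-third))))

  spells-third : Spells δ₀ thirdTurns
  spells-third = spells-++ thirdWord (left ∷ []) δ₀ (spells third)
    (subst (λ δ → Spells δ (left ∷ [])) (sym (walk-follows third)) (turns-left , tt))

  walk-length : ∀ {δ ε} → walk M₃ δ ≡ ε → walk (length thirdTurns) δ ≡ ε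
  walk-length {δ} e = trans (cong (λ k → walk k δ) length-third) e

  spells-word : Spells δ₀ word
  spells-word = spells-++ thirdTurns (thirdTurns ++ thirdTurns) δ₀ spells-third
    (subst (λ δ → Spells δ (thirdTurns ++ thirdTurns)) (sym (walk-length walk-third))
      (spells-++ thirdTurns thirdTurns (rotD δ₀) (spells-rotD thirdTurns δ₀ spells-third)
        (subst (λ δ → Spells δ thirdTurns) (sym (walk-length walk-third′))
          (spells-rotD thirdTurns (rotD δ₀) (spells-rotD thirdTurns δ₀ spells-third)))))

  g : Pt × ℤ
  g = shadowThird c (+ s) (+ t)

  run-word : run (fwd x0) word ≡ (fwd x0 , (origin , + 3 * proj₂ g + det (proj₁ g) (rot (rot (proj₁ g)))))
  run-word = trans
    (run-then thirdTurns (thirdTurns ++ thirdTurns) (third-run c s t)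
      (run-then {fwd x2} {fwd x1} {fwd x0} thirdTurns thirdTurns
        (spun (spun (third-run c s t))) (spun (third-run c s t))))
    (cong (fwd x0 ,_) (three-thirds (proj₁ g) (proj₂ g)))
    where
    spun : ∀ {e e' h} → run e thirdTurns ≡ (e' , h) → run (spin e) thirdTurns ≡ (spin e' , rotate h)
    spun {e} eq = trans (run-spin e thirdTurns) (cong (λ r → spin (proj₁ r) , rotate (proj₂ r)) eq)

  conclusion : ∀ a b → (∀ α → InBenzel a b α → Region A B α) →
               (∀ α → L (- + 1) α → Region A B α → InBenzel a b α) →
               Conclusion a b (numer c (+ 1 + A) (+ 1 + B))
  conclusion a b f f⁻¹ = (n , V , W , V-path , W-shadows) ,
    λ n' v w bp sh → proj₁ (rigidity n' v w bp sh) ,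
      trans (proj₂ (rigidity n' v w bp sh)) (trans (cong proj₂ end) (total-area c (+ s) (+ t)))
    where
    open Circuit (Region A B) (region? A B) (region-rot A B) a b f f⁻¹
    open Loop δ₀ m start refl closes minimal covers
    traced : _
    traced = traces word 0 spells-word
    end : (W n , sixTimesSignedArea n W) ≡ (origin , + 3 * proj₂ g + det (proj₁ g) (rot (rot (proj₁ g))))
    end = trans (cong (λ k → W k , sixTimesSignedArea k W) (sym length-word))
      (trans (proj₂ traced) (trans (join-identityˡ (proj₂ (run (fwd x0) word))) (cong proj₂ run-word)))
    open Shadow (trans (cong Y (sym length-word)) (trans (proj₁ traced) (cong proj₁ run-word)))
    open Area (cong proj₁ end)

-- Benzels as regions

slack : ∀ {x y z} → y - x ≡ z → x ≤ y → + 0 ≤ z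
slack e p = subst (+ 0 ≤_) e (ℤ.i≤j⇒0≤j-i p)

unslack : ∀ {x y z} → y - x ≡ z → + 0 ≤ z → x ≤ y
unslack e p = ℤ.0≤i-j⇒j≤i (subst (+ 0 ≤_) (sym e) p)

benzel⇒region : ∀ A B α → InBenzel (+ 1 + A) (+ 1 + B) α → Region A B α
benzel⇒region A B (x , y) (_ , (_ , (_ , x≤) , (_ , x-y≤)) , (_ , (≤x , _) , (≤x-y , _)) , ((_ , y≤) , _) , ((≤y , _) , _) , _) =
  slack (h₁ A y) y≤ ∷ slack (h₂ B y) ≤y ∷ slack (h₃ A x) ≤x ∷ slack (h₄ B x) x≤ ∷
  slack (h₅ A x y) x-y≤ ∷ slack (h₆ B x y) ≤x-y ∷ []
  where
  h₁ : ∀ A y → (+ 1 + A) - (y + + 1) ≡ A - y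
  h₁ = solve-∀
  h₂ : ∀ B y → (y + - + 1) - (- (+ 1 + B)) ≡ B + y
  h₂ = solve-∀
  h₃ : ∀ A x → (x + - + 1) - (- (+ 1 + A)) ≡ A + x
  h₃ = solve-∀
  h₄ : ∀ B x → (+ 1 + B) - (x + + 1) ≡ B - x
  h₄ = solve-∀
  h₅ : ∀ A x y → (+ 1 + A) - ((x + + 1) - (y + + 0)) ≡ A - (x - y)
  h₅ = solve-∀
  h₆ : ∀ B x y → ((x + - + 1) - (y + + 0)) - (- (+ 1 + B)) ≡ B + (x - y)
  h₆ = solve-∀

corner-in-hexagon : ∀ A B α q → Region A B α → All (+ 0 ≤_) (slacks (+ 1) (+ 1) q) → InHexagon (+ 1 + A) (+ 1 + B) (α ⊕ q)
corner-in-hexagon A B (x , y) (p , q) (a ∷ b ∷ c ∷ d ∷ e ∷ f ∷ []) (a' ∷ b' ∷ c' ∷ d' ∷ e' ∷ f' ∷ []) =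
  (unslack (h₂ B y q) (0≤+ b b') , unslack (h₁ A y q) (0≤+ a a')) ,
  (unslack (h₃ A x p) (0≤+ c c') , unslack (h₄ B x p) (0≤+ d d')) ,
  (unslack (h₆ B x y p q) (0≤+ f f') , unslack (h₅ A x y p q) (0≤+ e e'))
  where
  h₁ : ∀ A y q → (+ 1 + A) - (y + q) ≡ (A - y) + (+ 1 - q)
  h₁ = solve-∀
  h₂ : ∀ B y q → (y + q) - (- (+ 1 + B)) ≡ (B + y) + (+ 1 + q)
  h₂ = solve-∀
  h₃ : ∀ A x p → (x + p) - (- (+ 1 + A)) ≡ (A + x) + (+ 1 + p)
  h₃ = solve-∀
  h₄ : ∀ B x p → (+ 1 + B) - (x + p) ≡ (B - x) + (+ 1 - p)
  h₄ = solve-∀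
  h₅ : ∀ A x y p q → (+ 1 + A) - ((x + p) - (y + q)) ≡ (A - (x - y)) + (+ 1 - (p - q))
  h₅ = solve-∀
  h₆ : ∀ B x y p q → ((x + p) - (y + q)) - (- (+ 1 + B)) ≡ (B + (x - y)) + (+ 1 + (p - q))
  h₆ = solve-∀

region⇒benzel : ∀ A B α → L (- + 1) α → Region A B α → InBenzel (+ 1 + A) (+ 1 + B) α
region⇒benzel A B α l r = l ,
  corner one tt , corner (neg one) tt , corner ω tt , corner (neg ω) tt , corner ω² tt , corner (neg ω²) tt
  where
  corner : ∀ q → T (all (+ 0 ≤ᵇ_) (slacks (+ 1) (+ 1) q)) → InHexagon (+ 1 + A) (+ 1 + B) (α ⊕ q)
  corner q ok = corner-in-hexagon A B α q r
    (All.map (λ {i} → ℤ.≤ᵇ⇒≤ {+ 0} {i}) (All.all⁺ (+ 0 ≤ᵇ_) (slacks (+ 1) (+ 1) q) ok))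

positive-sum : ∀ {u v} j → + 0 ≤ u → + 0 ≤ v → u - v ≡ - + 1 + + 3 * j → + 0 ≤ (u + v) - + 1
positive-sum {+ zero}  {+ zero}  j _ _ e = ⊥-elim (from-no (3 ℕ.∣? 1) (∣⇒∣ᵤ {+ 3} {+ 1} (divides j (begin
  + 1                          ≡⟨ cong (_+_ (+ 1)) e ⟩
  + 1 + (- + 1 + + 3 * j)      ≡⟨ h j ⟩
  j * + 3                      ∎))))
  where
  open ≡-Reasoning
  h : ∀ j → + 1 + (- + 1 + + 3 * j) ≡ j * + 3
  h = solve-∀
positive-sum {+ zero}  {+ suc v} j _ _ e = +≤+ ℕ.z≤n
positive-sum {+ suc u} {+ v}     j _ _ e = +≤+ ℕ.z≤n

-- The coordinates of a cell centre sum to zero and are pairwise incongruent modulo 3, so if all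
-- are at least -B then none exceeds 2B - 1.
tighten-upper : ∀ A B α → L (- + 1) α → Region A B α → Region (+ 2 * B - + 1) B α
tighten-upper A B (x , y) l (_ ∷ b ∷ _ ∷ d ∷ _ ∷ f ∷ []) with L-elim (- + 1) (x , y) l
... | k , e =
  subst (+ 0 ≤_) (h₁ B x y) (positive-sum (k - x) d f (trans (g₁ B x y) (trans (cong (_- + 3 * x) e) (g k x)))) ∷ b ∷
  subst (+ 0 ≤_) (h₂ B x y) (positive-sum (k - y) f b (trans (g₂ B x y) (trans (cong (_- + 3 * y) e) (g k y)))) ∷ d ∷
  subst (+ 0 ≤_) (h₃ B x y) (positive-sum k b d (trans (g₃ B x y) e)) ∷ f ∷ []
  where
  g : ∀ k x → (- + 1 + + 3 * k) - + 3 * x ≡ - + 1 + + 3 * (k - x)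
  g = solve-∀
  g₁ : ∀ B x y → (B - x) - (B + (x - y)) ≡ (x + y) - + 3 * x
  g₁ = solve-∀
  g₂ : ∀ B x y → (B + (x - y)) - (B + y) ≡ (x + y) - + 3 * y
  g₂ = solve-∀
  g₃ : ∀ B x y → (B + y) - (B - x) ≡ x + y
  g₃ = solve-∀
  h₁ : ∀ B x y → ((B - x) + (B + (x - y))) - + 1 ≡ (+ 2 * B - + 1) - y
  h₁ = solve-∀
  h₂ : ∀ B x y → ((B + (x - y)) + (B + y)) - + 1 ≡ (+ 2 * B - + 1) + x
  h₂ = solve-∀
  h₃ : ∀ B x y → ((B + y) + (B - x)) - + 1 ≡ (+ 2 * B - + 1) - (x - y)
  h₃ = solve-∀

tighten-lower : ∀ A B α → L (- + 1) α → Region A B α → Region A (+ 2 * A - + 1) α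
tighten-lower A B (x , y) l (a ∷ _ ∷ c ∷ _ ∷ e ∷ _ ∷ []) with L-elim (- + 1) (x , y) l
... | k , eq =
  a ∷ subst (+ 0 ≤_) (h₁ A x y) (positive-sum (k - x) e c (trans (g₁ A x y) (trans (cong (_- + 3 * x) eq) (g k x)))) ∷
  c ∷ subst (+ 0 ≤_) (h₂ A x y) (positive-sum (k - y) a e (trans (g₂ A x y) (trans (cong (_- + 3 * y) eq) (g k y)))) ∷
  e ∷ subst (+ 0 ≤_) (h₃ A x y) (positive-sum k c a (trans (g₃ A x y) eq)) ∷ []
  where
  g : ∀ k x → (- + 1 + + 3 * k) - + 3 * x ≡ - + 1 + + 3 * (k - x)
  g = solve-∀
  g₁ : ∀ A x y → (A - (x - y)) - (A + x) ≡ (x + y) - + 3 * x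
  g₁ = solve-∀
  g₂ : ∀ A x y → (A - y) - (A - (x - y)) ≡ (x + y) - + 3 * y
  g₂ = solve-∀
  g₃ : ∀ A x y → (A + x) - (A - y) ≡ x + y
  g₃ = solve-∀
  h₁ : ∀ A x y → ((A - (x - y)) + (A + x)) - + 1 ≡ (+ 2 * A - + 1) + y
  h₁ = solve-∀
  h₂ : ∀ A x y → ((A - y) + (A - (x - y))) - + 1 ≡ (+ 2 * A - + 1) - x
  h₂ = solve-∀
  h₃ : ∀ A x y → ((A + x) + (A - y)) - + 1 ≡ (+ 2 * A - + 1) + (x - y)
  h₃ = solve-∀

region-mono : ∀ A B p q α → Region A B α → Region (A + + p) (B + + q) α
region-mono A B p q (x , y) (a ∷ b ∷ c ∷ d ∷ e ∷ f ∷ []) =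
  up₋ A y p a ∷ up₊ B y q b ∷ up₊ A x p c ∷ up₋ B x q d ∷ up₋ A (x - y) p e ∷ up₊ B (x - y) q f ∷ []
  where
  up₋ : ∀ A z p → + 0 ≤ A - z → + 0 ≤ (A + + p) - z
  up₋ A z p h = subst (+ 0 ≤_) (i A z (+ p)) (0≤+ h (+≤+ {n = p} ℕ.z≤n))
    where
    i : ∀ A z p → (A - z) + p ≡ (A + p) - z
    i = solve-∀
  up₊ : ∀ A z p → + 0 ≤ A + z → + 0 ≤ (A + + p) + z
  up₊ A z p h = subst (+ 0 ≤_) (i A z (+ p)) (0≤+ h (+≤+ {n = p} ℕ.z≤n))
    where
    i : ∀ A z p → (A + z) + p ≡ (A + p) + z
    i = solve-∀

conclusion-generic : ∀ c s t {a b} → + 1 + Assembled.A c s t ≡ a → + 1 + Assembled.B c s t ≡ b →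
                     Conclusion a b (numer c a b)
conclusion-generic c s t refl refl =
  Generic.conclusion c s t (+ 1 + A) (+ 1 + B) (benzel⇒region A B) (region⇒benzel A B)
  where
  open Assembled c s t using (A; B)

-- For a = 2b - 2 + p with p = 0, 1, 2 the benzel is the same.
conclusion-upper : ∀ t p {a b N} → + 1 + (Assembled.A c1 0 t + + p) ≡ a → + 1 + Assembled.B c1 0 t ≡ b →
                   numer c1 (+ 1 + Assembled.A c1 0 t) (+ 1 + Assembled.B c1 0 t) ≡ N → Conclusion a b N
conclusion-upper t p refl refl refl = Generic.conclusion c1 0 t (+ 1 + (A + + p)) (+ 1 + B)
  (λ α i → subst (λ A → Region A B α) (h (+ t)) (tighten-upper (A + + p) B α (proj₁ i) (benzel⇒region (A + + p) B α i)))
  (λ α l r → region⇒benzel (A + + p) B α l (subst (λ B → Region (A + + p) B α) (ℤ.+-identityʳ B) (region-mono A B p 0 α r)))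
  where
  A B : ℤ
  A = Assembled.A c1 0 t
  B = Assembled.B c1 0 t
  h : ∀ t → + 2 * (+ 1 + (+ 0 + (+ 1 * t + + 0))) - + 1 ≡ + 1 + (+ 0 + (+ 2 * t + + 0))
  h = solve-∀

conclusion-lower : ∀ s p {a b N} → + 1 + Assembled.A c1 s 0 ≡ a → + 1 + (Assembled.B c1 s 0 + + p) ≡ b →
                   numer c1 (+ 1 + Assembled.A c1 s 0) (+ 1 + Assembled.B c1 s 0) ≡ N → Conclusion a b N
conclusion-lower s p refl refl refl = Generic.conclusion c1 s 0 (+ 1 + A) (+ 1 + (B + + p))
  (λ α i → subst (λ B → Region A B α) (h (+ s)) (tighten-lower A (B + + p) α (proj₁ i) (benzel⇒region A (B + + p) α i)))
  (λ α l r → region⇒benzel A (B + + p) α l (subst (λ A → Region A (B + + p) α) (ℤ.+-identityʳ A) (region-mono A B 0 p α r)))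
  where
  A B : ℤ
  A = Assembled.A c1 s 0
  B = Assembled.B c1 s 0
  h : ∀ s → + 2 * (+ 1 + (+ 1 * s + + 0)) - + 1 ≡ + 1 + (+ 2 * s + + 0)
  h = solve-∀

-- These are a and b for s = S and t = T; if a + b = r + 3q, then S = b - q - 1 and T = a - q - 1.
coordA coordB : Cls → ℤ → ℤ → ℤ
coordA c S T = + 1 + (+ κ c + (+ 1 * S + (+ 2 * T + + 0)))
coordB c S T = + 1 + (+ κ c + (+ 2 * S + (+ 1 * T + + 0)))

coordA-spec : ∀ r κ a b q → a + b ≡ r + + 3 * q → r + κ ≡ + 2 →
  a ≡ + 1 + (κ + (+ 1 * ((b - q) - + 1) + (+ 2 * ((a - q) - + 1) + + 0)))
coordA-spec r κ a b q e e' = sym (vanish a refl (difference e) (difference e') (h r κ a b q))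
  where
  h : ∀ r κ a b q → + 1 + (κ + (+ 1 * ((b - q) - + 1) + (+ 2 * ((a - q) - + 1) + + 0))) ≡
      ((a + + 0) + ((a + b) - (r + + 3 * q))) + ((r + κ) - + 2)
  h = solve-∀

coordB-spec : ∀ r κ a b q → a + b ≡ r + + 3 * q → r + κ ≡ + 2 →
  b ≡ + 1 + (κ + (+ 2 * ((b - q) - + 1) + (+ 1 * ((a - q) - + 1) + + 0)))
coordB-spec r κ a b q e e' = sym (vanish b refl (difference e) (difference e') (h r κ a b q))
  where
  h : ∀ r κ a b q → + 1 + (κ + (+ 2 * ((b - q) - + 1) + (+ 1 * ((a - q) - + 1) + + 0))) ≡
      ((b + + 0) + ((a + b) - (r + + 3 * q))) + ((r + κ) - + 2)
  h = solve-∀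

class-κ : ∀ c → ⟦ c ⟧ + + κ c ≡ + 2
class-κ c0  = refl
class-κ c1  = refl
class-κ c-1 = refl

twiceB : ∀ c S T → + 2 * coordB c S T - coordA c S T ≡ (+ 1 + + κ c) + + 3 * S
twiceB c S T = h (+ κ c) S T
  where
  h : ∀ κ S T → + 2 * (+ 1 + (κ + (+ 2 * S + (+ 1 * T + + 0)))) - (+ 1 + (κ + (+ 1 * S + (+ 2 * T + + 0)))) ≡
      (+ 1 + κ) + + 3 * S
  h = solve-∀

twiceA : ∀ c S T → + 2 * coordA c S T - coordB c S T ≡ (+ 1 + + κ c) + + 3 * T
twiceA c S T = h (+ κ c) S T
  where
  h : ∀ κ S T → + 2 * (+ 1 + (κ + (+ 1 * S + (+ 2 * T + + 0)))) - (+ 1 + (κ + (+ 2 * S + (+ 1 * T + + 0)))) ≡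
      (+ 1 + κ) + + 3 * T
  h = solve-∀

far-negative : ∀ c k → ¬ (+ 0 ≤ (+ 1 + + κ c) + + 3 * -[1+ suc k ])
far-negative c k p = go c (subst (+ 0 ≤_) (trans (h (+ κ c) (+ k)) (cong (λ z → (+ κ c - + 5) - z) (sym (ℤ.pos-* 3 k)))) p)
  where
  h : ∀ κ k → (+ 1 + κ) + + 3 * (- (+ 1 + (+ 1 + k))) ≡ (κ - + 5) - + 3 * k
  h = solve-∀
  go : ∀ c → ¬ (+ 0 ≤ (+ κ c - + 5) - + (3 ℕ.* k))
  go c q with ℤ.≤-trans q (ℤ.+-monoʳ-≤ (+ κ c - + 5) (ℤ.neg-mono-≤ (+≤+ {n = 3 ℕ.* k} ℕ.z≤n)))
  go c0  q | ()
  go c1  q | ()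
  go c-1 q | ()

c0-degenerate : ∀ x → numer c1 (+ 1 + (+ 1 + (+ 0 + (+ 2 * x + + 0)))) (+ 1 + (+ 1 + (+ 0 + (+ 1 * x + + 0)))) ≡
  numer c0 (+ 4 + + 2 * x) (+ 2 + x)
c0-degenerate = h
  where
  h : ∀ x → let a = + 1 + (+ 1 + (+ 0 + (+ 2 * x + + 0))); b = + 1 + (+ 1 + (+ 0 + (+ 1 * x + + 0)))
                a' = + 4 + + 2 * x; b' = + 2 + x in
    ((((a * a - + 4 * a * b) + b * b) + a) + b) - + 2 ≡ (((- (+ 3 * a' * a')) + + 6 * a' * b') - + 3 * b' * b') + a' + b'
  h = solve-∀

c-1-degenerate : ∀ x → numer c1 (+ 1 + (+ 1 + (+ 0 + (+ 2 * x + + 0)))) (+ 1 + (+ 1 + (+ 0 + (+ 1 * x + + 0)))) ≡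
  numer c-1 (+ 3 + + 2 * x) (+ 2 + x)
c-1-degenerate = h
  where
  h : ∀ x → let a = + 1 + (+ 1 + (+ 0 + (+ 2 * x + + 0))); b = + 1 + (+ 1 + (+ 0 + (+ 1 * x + + 0)))
                a' = + 3 + + 2 * x; b' = + 2 + x in
    ((((a * a - + 4 * a * b) + b * b) + a) + b) - + 2 ≡ ((((- (+ 3 * a' * a')) + + 6 * a' * b') - + 3 * b' * b') - a' - b') + + 2
  h = solve-∀

numer-sym : ∀ c a b → numer c a b ≡ numer c b a
numer-sym c0 a b = h a b
  where
  h : ∀ a b → (((- (+ 3 * a * a)) + + 6 * a * b) - + 3 * b * b) + a + b ≡ (((- (+ 3 * b * b)) + + 6 * b * a) - + 3 * a * a) + b + a
  h = solve-∀
numer-sym c1 a b = h a b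
  where
  h : ∀ a b → ((((a * a - + 4 * a * b) + b * b) + a) + b) - + 2 ≡ ((((b * b - + 4 * b * a) + a * a) + b) + a) - + 2
  h = solve-∀
numer-sym c-1 a b = h a b
  where
  h : ∀ a b → (((((- (+ 3 * a * a)) + + 6 * a * b) - + 3 * b * b) - a) - b) + + 2 ≡
      (((((- (+ 3 * b * b)) + + 6 * b * a) - + 3 * a * a) - b) - a) + + 2
  h = solve-∀

degenerate-upper : ∀ c t p a b → + 1 + (Assembled.A c1 0 t + + p) ≡ a → + 1 + Assembled.B c1 0 t ≡ b →
  ∀ a' b' → a ≡ a' → b ≡ b' → numer c1 (+ 1 + Assembled.A c1 0 t) (+ 1 + Assembled.B c1 0 t) ≡ numer c a' b' →
  Conclusion a b (numer c a b)
degenerate-upper c t p a b ea eb a' b' refl refl e = conclusion-upper t p ea eb e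

degenerate-lower : ∀ c s p a b → + 1 + Assembled.A c1 s 0 ≡ a → + 1 + (Assembled.B c1 s 0 + + p) ≡ b →
  ∀ a' b' → a ≡ a' → b ≡ b' → numer c1 (+ 1 + Assembled.A c1 s 0) (+ 1 + Assembled.B c1 s 0) ≡ numer c a' b' →
  Conclusion a b (numer c a b)
degenerate-lower c s p a b ea eb a' b' refl refl e = conclusion-lower s p ea eb e

at-coordinates : ∀ c S T → + 2 ≤ coordA c S T → coordA c S T ≤ + 2 * coordB c S T →
  + 2 ≤ coordB c S T → coordB c S T ≤ + 2 * coordA c S T →
  Conclusion (coordA c S T) (coordB c S T) (numer c (coordA c S T) (coordB c S T))
at-coordinates c (+ s) (+ t) _ _ _ _ = conclusion-generic c s t refl refl
at-coordinates c S@(-[1+ suc k ]) T _ a≤2b _ _ = ⊥-elim (far-negative c k (slack (twiceB c S T) a≤2b))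
at-coordinates c S T@(-[1+ suc k ]) _ _ _ b≤2a = ⊥-elim (far-negative c k (slack (twiceA c S T) b≤2a))
at-coordinates c1 S@(-[1+ 0 ]) T _ a≤2b _ _ with slack (twiceB c1 S T) a≤2b
... | ()
at-coordinates c1 S T@(-[1+ 0 ]) _ _ _ b≤2a with slack (twiceA c1 S T) b≤2a
... | ()
at-coordinates c0 -[1+ 0 ] -[1+ 0 ] (+≤+ ()) _ _ _
at-coordinates c0 -[1+ 0 ] (+ 0) _ _ (+≤+ (ℕ.s≤s ())) _
at-coordinates c0 (+ 0) -[1+ 0 ] (+≤+ (ℕ.s≤s ())) _ _ _
at-coordinates c0 -[1+ 0 ] (+ suc t) _ _ _ _ = degenerate-upper c0 t 2 _ _ (ha (+ t)) (hb (+ t))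
  (+ 4 + + 2 * + t) (+ 2 + + t) (ha' (+ t)) (hb' (+ t)) (c0-degenerate (+ t))
  where
  ha : ∀ t → + 1 + ((+ 1 + (+ 0 + (+ 2 * t + + 0))) + + 2) ≡ + 1 + (+ 2 + (- + 1 + (+ 2 * (+ 1 + t) + + 0)))
  ha = solve-∀
  hb : ∀ t → + 1 + (+ 1 + (+ 0 + (+ 1 * t + + 0))) ≡ + 1 + (+ 2 + (- + 2 + (+ 1 * (+ 1 + t) + + 0)))
  hb = solve-∀
  ha' : ∀ t → + 1 + (+ 2 + (- + 1 + (+ 2 * (+ 1 + t) + + 0))) ≡ + 4 + + 2 * t
  ha' = solve-∀
  hb' : ∀ t → + 1 + (+ 2 + (- + 2 + (+ 1 * (+ 1 + t) + + 0))) ≡ + 2 + t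
  hb' = solve-∀
at-coordinates c0 (+ suc s) -[1+ 0 ] _ _ _ _ = degenerate-lower c0 s 2 _ _ (ha (+ s)) (hb (+ s))
  (+ 2 + + s) (+ 4 + + 2 * + s) (ha' (+ s)) (hb' (+ s))
  (trans (numer-sym c1 (+ 1 + Assembled.A c1 s 0) (+ 1 + Assembled.B c1 s 0))
    (trans (cong₂ (numer c1) (hB (+ s)) (hA (+ s)))
    (trans (c0-degenerate (+ s)) (numer-sym c0 (+ 4 + + 2 * + s) (+ 2 + + s)))))
  where
  hA : ∀ s → + 1 + (+ 1 + (+ 1 * s + + 0)) ≡ + 1 + (+ 1 + (+ 0 + (+ 1 * s + + 0)))
  hA = solve-∀
  hB : ∀ s → + 1 + (+ 1 + (+ 2 * s + + 0)) ≡ + 1 + (+ 1 + (+ 0 + (+ 2 * s + + 0)))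
  hB = solve-∀
  ha : ∀ s → + 1 + (+ 1 + (+ 1 * s + + 0)) ≡ + 1 + (+ 2 + (+ 1 * (+ 1 + s) + - + 2))
  ha = solve-∀
  hb : ∀ s → + 1 + ((+ 1 + (+ 2 * s + + 0)) + + 2) ≡ + 1 + (+ 2 + (+ 2 * (+ 1 + s) + - + 1))
  hb = solve-∀
  ha' : ∀ s → + 1 + (+ 2 + (+ 1 * (+ 1 + s) + - + 2)) ≡ + 2 + s
  ha' = solve-∀
  hb' : ∀ s → + 1 + (+ 2 + (+ 2 * (+ 1 + s) + - + 1)) ≡ + 4 + + 2 * s
  hb' = solve-∀
at-coordinates c-1 -[1+ 0 ] -[1+ 0 ] (+≤+ (ℕ.s≤s ())) _ _ _
at-coordinates c-1 -[1+ 0 ] (+ t) _ _ _ _ = degenerate-upper c-1 t 1 _ _ (ha (+ t)) (hb (+ t))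
  (+ 3 + + 2 * + t) (+ 2 + + t) (ha' (+ t)) (hb' (+ t)) (c-1-degenerate (+ t))
  where
  ha : ∀ t → + 1 + ((+ 1 + (+ 0 + (+ 2 * t + + 0))) + + 1) ≡ + 1 + (+ 3 + (- + 1 + (+ 2 * t + + 0)))
  ha = solve-∀
  hb : ∀ t → + 1 + (+ 1 + (+ 0 + (+ 1 * t + + 0))) ≡ + 1 + (+ 3 + (- + 2 + (+ 1 * t + + 0)))
  hb = solve-∀
  ha' : ∀ t → + 1 + (+ 3 + (- + 1 + (+ 2 * t + + 0))) ≡ + 3 + + 2 * t
  ha' = solve-∀
  hb' : ∀ t → + 1 + (+ 3 + (- + 2 + (+ 1 * t + + 0))) ≡ + 2 + t
  hb' = solve-∀
at-coordinates c-1 (+ s) -[1+ 0 ] _ _ _ _ = degenerate-lower c-1 s 1 _ _ (ha (+ s)) (hb (+ s))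
  (+ 2 + + s) (+ 3 + + 2 * + s) (ha' (+ s)) (hb' (+ s))
  (trans (numer-sym c1 (+ 1 + Assembled.A c1 s 0) (+ 1 + Assembled.B c1 s 0))
    (trans (cong₂ (numer c1) (hB (+ s)) (hA (+ s)))
    (trans (c-1-degenerate (+ s)) (numer-sym c-1 (+ 3 + + 2 * + s) (+ 2 + + s)))))
  where
  hA : ∀ s → + 1 + (+ 1 + (+ 1 * s + + 0)) ≡ + 1 + (+ 1 + (+ 0 + (+ 1 * s + + 0)))
  hA = solve-∀
  hB : ∀ s → + 1 + (+ 1 + (+ 2 * s + + 0)) ≡ + 1 + (+ 1 + (+ 0 + (+ 2 * s + + 0)))
  hB = solve-∀
  ha : ∀ s → + 1 + (+ 1 + (+ 1 * s + + 0)) ≡ + 1 + (+ 3 + (+ 1 * s + - + 2))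
  ha = solve-∀
  hb : ∀ s → + 1 + ((+ 1 + (+ 2 * s + + 0)) + + 1) ≡ + 1 + (+ 3 + (+ 2 * s + - + 1))
  hb = solve-∀
  ha' : ∀ s → + 1 + (+ 3 + (+ 1 * s + - + 2)) ≡ + 2 + s
  ha' = solve-∀
  hb' : ∀ s → + 1 + (+ 3 + (+ 2 * s + - + 1)) ≡ + 3 + + 2 * s
  hb' = solve-∀

theorem2 : (a b : ℤ) → + 2 ≤ a → a ≤ + 2 * b → + 2 ≤ b → b ≤ + 2 * a →
    (c : Cls) → + 3 ∣ ((a + b) - ⟦ c ⟧) →
    (Σ ℕ λ n → Σ (ℕ → Pt) λ v → Σ (ℕ → Pt) λ w →
    BoundaryPath a b n v × Shadows n v w)
    ×
    (∀ n (v w : ℕ → Pt) → BoundaryPath a b n v → Shadows n v w →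
    w n ≡ w 0 × sixTimesSignedArea n w ≡ + 3 * numer c a b)
theorem2 a b 2≤a a≤2b 2≤b b≤2a c div with L-elim ⟦ c ⟧ (a , b) div
... | q , e = transport (coordA-spec ⟦ c ⟧ (+ κ c) a b q e (class-κ c)) (coordB-spec ⟦ c ⟧ (+ κ c) a b q e (class-κ c))
    2≤a a≤2b 2≤b b≤2a (at-coordinates c ((b - q) - + 1) ((a - q) - + 1))
  where
  transport : ∀ {a b a' b'} → a ≡ a' → b ≡ b' → + 2 ≤ a → a ≤ + 2 * b → + 2 ≤ b → b ≤ + 2 * a →
    (+ 2 ≤ a' → a' ≤ + 2 * b' → + 2 ≤ b' → b' ≤ + 2 * a' → Conclusion a' b' (numer c a' b')) →
    Conclusion a b (numer c a b)
  transport refl refl h₁ h₂ h₃ h₄ f = f h₁ h₂ h₃ h₄
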